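{- (a) For every $K_3N$ $n=pqr$, $B<\sqrt2\,\sqrt[4]{n}-\left(\sqrt3-\dfrac12\right)\sqrt[8]{\dfrac n4}+\dfrac{39+\sqrt3}{24}$. (b) For every $C_3N$ $n=pqr$ except $n=6601$, $B<\sqrt2\,\sqrt[4]{n}-\left(\sqrt7-\dfrac12\right)\sqrt[8]{\dfrac n4}+\dfrac{175-3\sqrt7}{56}$.
   Context: A $K_3N$ (Korselt number with three factors) is an integer $n$ together with a factorisation $n=pqr$, where $1<p<q<r$ are odd integers (not necessarily prime) such that each of $p-1,\ q-1,\ r-1$ divides $n-1$, and such that $E:=\dfrac{pq-1}{r-1}$ (which is an integer by the divisibility condition) satisfies $E\ge 2$. A $C_3N$ is a Carmichael number with exactly three prime factors $p<q<r$, i.e. a $K_3N$ $n=pqr$ in which $p,q,r$ are all prime. Put $H:=\gcd(p-1,q-1,r-1)$ and $B:=\frac{q-1}{H}$. -}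

module Defs where

open import Data.Nat as ℕ using (ℕ; zero; suc; _∸_; _≥_; NonZero)
import Data.Nat.Properties as ℕ
open import Data.Nat.Divisibility using (_∣_; quotient; ∣-trans; ∣m+n∣m⇒∣n; n∣m*n)
open import Data.Nat.DivMod using (m/n*n≤m; m≡m%n+[m/n]*n; m%n<n)
open import Data.Nat.GCD using (gcd; gcd[m,n]∣m; gcd[m,n]∣n)
open import Data.Nat.Primality using (Prime)
import Data.Nat.Solver as ℕSolver
open import Data.Integer as ℤ using (+_)
import Data.Integer.Properties as ℤ
import Data.Integer.Solver as ℤSolver
open import Data.Rational as ℚ using (ℚ; 0ℚ; 1ℚ; ½; ∣_∣; *<*; mkℚ)
import Data.Rational.Properties as ℚ
import Data.Rational.Unnormalised as ℚᵘ
import Data.Rational.Unnormalised.Properties as ℚᵘ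
import Data.Rational.Solver as ℚSolver
open import Data.Product using (∃-syntax; _×_; _,_)
open import Data.Sum using (inj₁; inj₂)
open import Relation.Nullary using (yes; no; contradiction)
open import Relation.Binary.PropositionalEquality

------------------------------------------------------------------------
-- Real numbers

-- A real is a Cauchy sequence of rationals; distinct sequences may
-- represent the same real. The witness in IsCauchy is its modulus.

IsCauchy : (ℕ → ℚ) → Set
IsCauchy x = ∀ ε → 0ℚ ℚ.< ε →
             ∃[ N ] (∀ m n → m ≥ N → n ≥ N → ∣ x m ℚ.- x n ∣ ℚ.< ε)

record ℝ : Set where
  constructor mkℝ
  field
    seq    : ℕ → ℚ
    cauchy : IsCauchy seq

open ℝ public

infix 4 _<_

-- Independent of the representing sequences: x < y holds precisely when
-- the limit of y exceeds that of x.
_<_ : ℝ → ℝ → Set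
x < y = ∃[ ε ] 0ℚ ℚ.< ε × ∃[ N ] (∀ m → m ≥ N → seq x m ℚ.+ ε ℚ.< seq y m)

private
  ≥⊔ˡ : ∀ {k} M N → k ≥ M ℕ.⊔ N → k ≥ M
  ≥⊔ˡ M N = ℕ.≤-trans (ℕ.m≤m⊔n M N)

  ≥⊔ʳ : ∀ {k} M N → k ≥ M ℕ.⊔ N → k ≥ N
  ≥⊔ʳ M N = ℕ.≤-trans (ℕ.m≤n⊔m M N)

  half-pos : ∀ ε → 0ℚ ℚ.< ε → 0ℚ ℚ.< ½ ℚ.* ε
  half-pos ε 0<ε = ℚ.positive⁻¹ _ {{ℚ.pos*pos⇒pos ½ ε {{ℚ.positive 0<ε}}}}

  half+half : ∀ ε → ½ ℚ.* ε ℚ.+ ½ ℚ.* ε ≡ ε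
  half+half ε = trans (sym (ℚ.*-distribʳ-+ ε ½ ½)) (ℚ.*-identityˡ ε)

  0<1 : 0ℚ ℚ.< 1ℚ
  0<1 = ℚ.positive⁻¹ 1ℚ

  ∣∣<-intro : ∀ a {ε} → a ℚ.< ε → ℚ.- a ℚ.< ε → ∣ a ∣ ℚ.< ε
  ∣∣<-intro a a<ε -a<ε with ℚ.∣p∣≡p∨∣p∣≡-p a
  ... | inj₁ eq rewrite eq = a<ε
  ... | inj₂ eq rewrite eq = -a<ε

  const-cauchy : ∀ a → IsCauchy (λ _ → a)
  const-cauchy a ε 0<ε = 0 , λ _ _ _ _ →
    subst (λ z → ∣ z ∣ ℚ.< ε) (sym (ℚ.+-inverseʳ a)) 0<ε

  +-cauchy : ∀ x y → IsCauchy x → IsCauchy y → IsCauchy (λ m → x m ℚ.+ y m)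
  +-cauchy x y cx cy ε 0<ε
    with cx (½ ℚ.* ε) (half-pos ε 0<ε) | cy (½ ℚ.* ε) (half-pos ε 0<ε)
  ... | M , hx | N , hy = M ℕ.⊔ N , λ m n m≥ n≥ → begin-strict
    ∣ (x m ℚ.+ y m) ℚ.- (x n ℚ.+ y n) ∣
      ≡⟨ cong ∣_∣ (rearrange (x m) (y m) (x n) (y n)) ⟩
    ∣ (x m ℚ.- x n) ℚ.+ (y m ℚ.- y n) ∣
      ≤⟨ ℚ.∣p+q∣≤∣p∣+∣q∣ (x m ℚ.- x n) (y m ℚ.- y n) ⟩
    ∣ x m ℚ.- x n ∣ ℚ.+ ∣ y m ℚ.- y n ∣
      <⟨ ℚ.+-mono-< (hx m n (≥⊔ˡ M N m≥) (≥⊔ˡ M N n≥))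
                    (hy m n (≥⊔ʳ M N m≥) (≥⊔ʳ M N n≥)) ⟩
    ½ ℚ.* ε ℚ.+ ½ ℚ.* ε
      ≡⟨ half+half ε ⟩
    ε ∎
    where
    open ℚ.≤-Reasoning
    open ℚSolver.+-*-Solver
    rearrange : ∀ a b c d → (a ℚ.+ b) ℚ.- (c ℚ.+ d) ≡ (a ℚ.- c) ℚ.+ (b ℚ.- d)
    rearrange = solve 4 (λ a b c d → (a :+ b) :- (c :+ d) := (a :- c) :+ (b :- d)) refl

  neg-cauchy : ∀ x → IsCauchy x → IsCauchy (λ m → ℚ.- x m)
  neg-cauchy x cx ε 0<ε with cx ε 0<ε
  ... | N , hx = N , λ m n m≥ n≥ →
    subst (ℚ._< ε) (cong ∣_∣ (swap (x m) (x n))) (hx n m n≥ m≥)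
    where
    open ℚSolver.+-*-Solver
    swap : ∀ a b → b ℚ.- a ≡ ℚ.- a ℚ.- ℚ.- b
    swap = solve 2 (λ a b → b :- a := :- a :- :- b) refl

  bounded : ∀ {x} → IsCauchy x →
            ∃[ K ] 0ℚ ℚ.< K × ∃[ N ] (∀ m → m ≥ N → ∣ x m ∣ ℚ.≤ K)
  bounded {x} cx with cx 1ℚ 0<1
  ... | N , hx = ∣ x N ∣ ℚ.+ 1ℚ , ℚ.+-mono-≤-< (ℚ.0≤∣p∣ (x N)) 0<1 , N , λ m m≥ → begin
    ∣ x m ∣                         ≡⟨ cong ∣_∣ (split (x m) (x N)) ⟩
    ∣ x N ℚ.+ (x m ℚ.- x N) ∣       ≤⟨ ℚ.∣p+q∣≤∣p∣+∣q∣ (x N) (x m ℚ.- x N) ⟩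
    ∣ x N ∣ ℚ.+ ∣ x m ℚ.- x N ∣     ≤⟨ ℚ.+-monoʳ-≤ ∣ x N ∣ (ℚ.<⇒≤ (hx m N m≥ ℕ.≤-refl)) ⟩
    ∣ x N ∣ ℚ.+ 1ℚ                  ∎
    where
    open ℚ.≤-Reasoning
    open ℚSolver.+-*-Solver
    split : ∀ a b → a ≡ b ℚ.+ (a ℚ.- b)
    split = solve 2 (λ a b → a := b :+ (a :- b)) refl

  -- δ = ε / (K + L)
  shrink : ∀ ε K L → 0ℚ ℚ.< ε → 0ℚ ℚ.< K → 0ℚ ℚ.< L →
           ∃[ δ ] 0ℚ ℚ.< δ × K ℚ.* δ ℚ.+ L ℚ.* δ ≡ ε
  shrink ε K L 0<ε 0<K 0<L = ε ℚ.* i , 0<δ , eq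
    where
    instance
      pos : ℚ.Positive (K ℚ.+ L)
      pos = ℚ.positive (ℚ.+-mono-< 0<K 0<L)
      nz : ℚ.NonZero (K ℚ.+ L)
      nz = ℚ.pos⇒nonZero (K ℚ.+ L)
    i = ℚ.1/ (K ℚ.+ L)
    0<δ : 0ℚ ℚ.< ε ℚ.* i
    0<δ = ℚ.positive⁻¹ _
      {{ℚ.pos*pos⇒pos ε {{ℚ.positive 0<ε}} i {{ℚ.1/pos⇒pos (K ℚ.+ L)}}}}
    open ℚSolver.+-*-Solver
    eq : K ℚ.* (ε ℚ.* i) ℚ.+ L ℚ.* (ε ℚ.* i) ≡ ε
    eq = trans
      (solve 4 (λ a b c d → a :* (c :* d) :+ b :* (c :* d) := c :* ((a :+ b) :* d))
        refl K L ε i)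
      (trans (cong (ε ℚ.*_) (ℚ.*-inverseʳ (K ℚ.+ L))) (ℚ.*-identityʳ ε))

  ∣a*b∣<C*δ : ∀ C δ a b → 0ℚ ℚ.< C → ∣ a ∣ ℚ.≤ C → ∣ b ∣ ℚ.< δ → ∣ a ℚ.* b ∣ ℚ.< C ℚ.* δ
  ∣a*b∣<C*δ C δ a b 0<C a≤C b<δ = begin-strict
    ∣ a ℚ.* b ∣       ≡⟨ ℚ.∣p*q∣≡∣p∣*∣q∣ a b ⟩
    ∣ a ∣ ℚ.* ∣ b ∣   ≤⟨ ℚ.*-monoʳ-≤-nonNeg ∣ b ∣ {{ℚ.∣-∣-nonNeg b}} a≤C ⟩
    C ℚ.* ∣ b ∣       <⟨ ℚ.*-monoʳ-<-pos C {{ℚ.positive 0<C}} b<δ ⟩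
    C ℚ.* δ           ∎
    where open ℚ.≤-Reasoning

  ∣ab-cd∣<Kδ+Lδ : ∀ K L δ a b c d → 0ℚ ℚ.< K → 0ℚ ℚ.< L → ∣ a ∣ ℚ.≤ K → ∣ d ∣ ℚ.≤ L →
    ∣ a ℚ.- c ∣ ℚ.< δ → ∣ b ℚ.- d ∣ ℚ.< δ →
    ∣ a ℚ.* b ℚ.- c ℚ.* d ∣ ℚ.< K ℚ.* δ ℚ.+ L ℚ.* δ
  ∣ab-cd∣<Kδ+Lδ K L δ a b c d 0<K 0<L a≤K d≤L ac bd = begin-strict
    ∣ a ℚ.* b ℚ.- c ℚ.* d ∣
      ≡⟨ cong ∣_∣ (rearrange a b c d) ⟩
    ∣ a ℚ.* (b ℚ.- d) ℚ.+ d ℚ.* (a ℚ.- c) ∣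
      ≤⟨ ℚ.∣p+q∣≤∣p∣+∣q∣ (a ℚ.* (b ℚ.- d)) (d ℚ.* (a ℚ.- c)) ⟩
    ∣ a ℚ.* (b ℚ.- d) ∣ ℚ.+ ∣ d ℚ.* (a ℚ.- c) ∣
      <⟨ ℚ.+-mono-< (∣a*b∣<C*δ K δ a (b ℚ.- d) 0<K a≤K bd)
                    (∣a*b∣<C*δ L δ d (a ℚ.- c) 0<L d≤L ac) ⟩
    K ℚ.* δ ℚ.+ L ℚ.* δ ∎
    where
    open ℚ.≤-Reasoning
    open ℚSolver.+-*-Solver using (solve; _:+_; _:*_; _:-_; _:=_)
    rearrange : ∀ a b c d →
      a ℚ.* b ℚ.- c ℚ.* d ≡ a ℚ.* (b ℚ.- d) ℚ.+ d ℚ.* (a ℚ.- c)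
    rearrange = solve 4 (λ a b c d →
      a :* b :- c :* d := a :* (b :- d) :+ d :* (a :- c)) refl

  *-cauchy : ∀ x y → IsCauchy x → IsCauchy y → IsCauchy (λ m → x m ℚ.* y m)
  *-cauchy x y cx cy ε 0<ε =
    let
      K , 0<K , M₀ , bx = bounded cx
      L , 0<L , N₀ , by = bounded cy
      δ , 0<δ , eq      = shrink ε K L 0<ε 0<K 0<L
      M , hx            = cx δ 0<δ
      N , hy            = cy δ 0<δ
    in (M₀ ℕ.⊔ N₀) ℕ.⊔ (M ℕ.⊔ N) , λ m n m≥ n≥ →
    let
      m≥₀ = ≥⊔ˡ (M₀ ℕ.⊔ N₀) (M ℕ.⊔ N) m≥ ; n≥₀ = ≥⊔ˡ (M₀ ℕ.⊔ N₀) (M ℕ.⊔ N) n≥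
      m≥₁ = ≥⊔ʳ (M₀ ℕ.⊔ N₀) (M ℕ.⊔ N) m≥ ; n≥₁ = ≥⊔ʳ (M₀ ℕ.⊔ N₀) (M ℕ.⊔ N) n≥
    in subst (∣ x m ℚ.* y m ℚ.- x n ℚ.* y n ∣ ℚ.<_) eq
      (∣ab-cd∣<Kδ+Lδ K L δ (x m) (y m) (x n) (y n) 0<K 0<L
        (bx m (≥⊔ˡ M₀ N₀ m≥₀)) (by n (≥⊔ʳ M₀ N₀ n≥₀))
        (hx m n (≥⊔ˡ M N m≥₁) (≥⊔ˡ M N n≥₁)) (hy m n (≥⊔ʳ M N m≥₁) (≥⊔ʳ M N n≥₁)))

infixl 6 _+_ _-_
infixl 7 _*_ _/_

fromℚ : ℚ → ℝ
fromℚ a = mkℝ (λ _ → a) (const-cauchy a)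

fromℕ : ℕ → ℝ
fromℕ n = fromℚ (+ n ℚ./ 1)

_+_ : ℝ → ℝ → ℝ
mkℝ x cx + mkℝ y cy = mkℝ (λ m → x m ℚ.+ y m) (+-cauchy x y cx cy)

_-_ : ℝ → ℝ → ℝ
mkℝ x cx - mkℝ y cy = mkℝ (λ m → x m ℚ.- y m) (+-cauchy x (λ m → ℚ.- y m) cx (neg-cauchy y cy))

_*_ : ℝ → ℝ → ℝ
mkℝ x cx * mkℝ y cy = mkℝ (λ m → x m ℚ.* y m) (*-cauchy x y cx cy)

_/_ : ℝ → (d : ℕ) → .{{NonZero d}} → ℝ
x / d = x * fromℚ (+ 1 ℚ./ d)

------------------------------------------------------------------------
-- Roots

-- The greatest j with j ^ k ≤ N, for k ≥ 1 (see iroot-lower, iroot-upper).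
iroot : ℕ → ℕ → ℕ
iroot k zero    = 0
iroot k (suc N) with suc (iroot k N) ℕ.^ k ℕ.≤? suc N
... | yes _ = suc (iroot k N)
... | no  _ = iroot k N

iroot-lower : ∀ k .{{_ : NonZero k}} N → iroot k N ℕ.^ k ℕ.≤ N
iroot-lower (suc k) zero = ℕ.z≤n
iroot-lower k (suc N) with suc (iroot k N) ℕ.^ k ℕ.≤? suc N
... | yes le = le
... | no  _  = ℕ.m≤n⇒m≤1+n (iroot-lower k N)

iroot-upper : ∀ k .{{_ : NonZero k}} N → N ℕ.< suc (iroot k N) ℕ.^ k
iroot-upper k zero = ℕ.m^n>0 1 k
iroot-upper k (suc N) with suc (iroot k N) ℕ.^ k ℕ.≤? suc N
... | yes _ = ℕ.≤-<-trans (iroot-upper k N) (ℕ.^-monoˡ-< k (ℕ.n<1+n _))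
... | no ¬p = ℕ.≰⇒> ¬p

-- The greatest j with (j / (m + 1)) ^ k ≤ P / Q.
rootNum : (k P Q : ℕ) .{{_ : NonZero Q}} → ℕ → ℕ
rootNum k P Q m = iroot k ((P ℕ.* suc m ℕ.^ k) ℕ./ Q)

rootNum-lower : ∀ k .{{_ : NonZero k}} P Q .{{_ : NonZero Q}} m →
                rootNum k P Q m ℕ.^ k ℕ.* Q ℕ.≤ P ℕ.* suc m ℕ.^ k
rootNum-lower k P Q m =
  ℕ.≤-trans (ℕ.*-monoˡ-≤ Q (iroot-lower k (X ℕ./ Q))) (m/n*n≤m X Q)
  where X = P ℕ.* suc m ℕ.^ k

rootNum-upper : ∀ k .{{_ : NonZero k}} P Q .{{_ : NonZero Q}} m →
                P ℕ.* suc m ℕ.^ k ℕ.< suc (rootNum k P Q m) ℕ.^ k ℕ.* Q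
rootNum-upper k P Q m = begin-strict
  X                          ≡⟨ m≡m%n+[m/n]*n X Q ⟩
  X ℕ.% Q ℕ.+ X ℕ./ Q ℕ.* Q  <⟨ ℕ.+-monoˡ-< _ (m%n<n X Q) ⟩
  suc (X ℕ./ Q) ℕ.* Q        ≤⟨ ℕ.*-monoˡ-≤ Q (iroot-upper k (X ℕ./ Q)) ⟩
  suc (rootNum k P Q m) ℕ.^ k ℕ.* Q ∎
  where
  open ℕ.≤-Reasoning
  X = P ℕ.* suc m ℕ.^ k

private
  ^-distrib-* : ∀ a b k → (a ℕ.* b) ℕ.^ k ≡ a ℕ.^ k ℕ.* b ℕ.^ k
  ^-distrib-* a b zero    = refl
  ^-distrib-* a b (suc k) =
    trans (cong (a ℕ.* b ℕ.*_) (^-distrib-* a b k))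
      (solve 4 (λ a b c d → a :* b :* (c :* d) := a :* c :* (b :* d)) refl
        a b (a ℕ.^ k) (b ℕ.^ k))
    where open ℕSolver.+-*-Solver

  ^-cancelˡ-< : ∀ k a b → a ℕ.^ k ℕ.< b ℕ.^ k → a ℕ.< b
  ^-cancelˡ-< k a b lt with a ℕ.<? b
  ... | yes p = p
  ... | no ¬p = contradiction lt (ℕ.≤⇒≯ (ℕ.^-monoˡ-≤ k (ℕ.≮⇒≥ ¬p)))

  rootNum-cross : ∀ k .{{_ : NonZero k}} P Q .{{_ : NonZero Q}} m l →
    rootNum k P Q m ℕ.* suc l ℕ.< suc (rootNum k P Q l) ℕ.* suc m
  rootNum-cross k P Q m l = ^-cancelˡ-< k _ _ (ℕ.*-cancelʳ-< Q _ _ (begin-strict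
    (a ℕ.* suc l) ℕ.^ k ℕ.* Q             ≡⟨ cong (ℕ._* Q) (^-distrib-* a (suc l) k) ⟩
    a ℕ.^ k ℕ.* suc l ℕ.^ k ℕ.* Q         ≡⟨ shuffle (a ℕ.^ k) (suc l ℕ.^ k) Q ⟩
    a ℕ.^ k ℕ.* Q ℕ.* suc l ℕ.^ k         ≤⟨ ℕ.*-monoˡ-≤ (suc l ℕ.^ k) (rootNum-lower k P Q m) ⟩
    P ℕ.* suc m ℕ.^ k ℕ.* suc l ℕ.^ k     ≡⟨ shuffle P (suc m ℕ.^ k) (suc l ℕ.^ k) ⟩
    P ℕ.* suc l ℕ.^ k ℕ.* suc m ℕ.^ k
      <⟨ ℕ.*-monoˡ-< (suc m ℕ.^ k) {{ℕ.m^n≢0 (suc m) k}} (rootNum-upper k P Q l) ⟩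
    b ℕ.^ k ℕ.* Q ℕ.* suc m ℕ.^ k         ≡⟨ shuffle (b ℕ.^ k) Q (suc m ℕ.^ k) ⟩
    b ℕ.^ k ℕ.* suc m ℕ.^ k ℕ.* Q         ≡⟨ cong (ℕ._* Q) (^-distrib-* b (suc m) k) ⟨
    (b ℕ.* suc m) ℕ.^ k ℕ.* Q             ∎))
    where
    open ℕ.≤-Reasoning
    open ℕSolver.+-*-Solver using (solve; _:*_; _:=_)
    a = rootNum k P Q m
    b = suc (rootNum k P Q l)
    shuffle : ∀ x y z → x ℕ.* y ℕ.* z ≡ x ℕ.* z ℕ.* y
    shuffle = solve 3 (λ x y z → x :* y :* z := x :* z :* y) refl

rootSeq : (k P Q : ℕ) .{{_ : NonZero Q}} → ℕ → ℚ
rootSeq k P Q m = + rootNum k P Q m ℚ./ suc m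

private
  frac-< : ∀ a b m n → a ℕ.* suc n ℕ.< b ℕ.* suc m → + a ℚ./ suc m ℚ.< + b ℚ./ suc n
  frac-< a b m n lt = ℚ.toℚᵘ-cancel-<
    (ℚᵘ.<-respˡ-≃ (ℚᵘ.≃-sym (ℚ.toℚᵘ-fromℚᵘ (ℚᵘ.mkℚᵘ (+ a) m)))
    (ℚᵘ.<-respʳ-≃ (ℚᵘ.≃-sym (ℚ.toℚᵘ-fromℚᵘ (ℚᵘ.mkℚᵘ (+ b) n)))
    (ℚᵘ.*<* (subst₂ ℤ._<_ (ℤ.pos-* a (suc n)) (ℤ.pos-* b (suc m)) (ℤ.+<+ lt)))))

  frac-suc : ∀ j n → + suc j ℚ./ suc n ≡ + j ℚ./ suc n ℚ.+ + 1 ℚ./ suc n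
  frac-suc j n = ℚ.toℚᵘ-injective (begin
    ℚ.toℚᵘ (+ suc j ℚ./ suc n)                       ≈⟨ ℚ.toℚᵘ-fromℚᵘ (ℚᵘ.mkℚᵘ (+ suc j) n) ⟩
    ℚᵘ.mkℚᵘ (+ suc j) n                              ≈⟨ ℚᵘ.*≡* (eq (+ j) (+ suc n)) ⟩
    ℚᵘ.mkℚᵘ (+ j) n ℚᵘ.+ ℚᵘ.mkℚᵘ (+ 1) n
      ≈⟨ ℚᵘ.+-cong (ℚ.toℚᵘ-fromℚᵘ (ℚᵘ.mkℚᵘ (+ j) n)) (ℚ.toℚᵘ-fromℚᵘ (ℚᵘ.mkℚᵘ (+ 1) n)) ⟨
    ℚ.toℚᵘ (+ j ℚ./ suc n) ℚᵘ.+ ℚ.toℚᵘ (+ 1 ℚ./ suc n)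
      ≈⟨ ℚ.toℚᵘ-homo-+ (+ j ℚ./ suc n) (+ 1 ℚ./ suc n) ⟨
    ℚ.toℚᵘ (+ j ℚ./ suc n ℚ.+ + 1 ℚ./ suc n)         ∎)
    where
    open ℚᵘ.≃-Reasoning
    open ℤSolver.+-*-Solver
    eq : ∀ j d → (+ 1 ℤ.+ j) ℤ.* (d ℤ.* d) ≡ (j ℤ.* d ℤ.+ + 1 ℤ.* d) ℤ.* d
    eq = solve 2 (λ j d →
      (con (+ 1) :+ j) :* (d :* d) := (j :* d :+ con (+ 1) :* d) :* d) refl

  inv-small : ∀ ε → 0ℚ ℚ.< ε → ∃[ N ] (∀ n → n ≥ N → + 1 ℚ./ suc n ℚ.< ε)
  inv-small (mkℚ (+ zero) d _) (*<* (ℤ.+<+ ()))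
  inv-small (mkℚ (ℤ.-[1+ _ ]) d _) (*<* ())
  inv-small (mkℚ (+ suc a) d c) _ = suc d , λ n n≥ → ℚ.toℚᵘ-cancel-<
    (ℚᵘ.<-respˡ-≃ (ℚᵘ.≃-sym (ℚ.toℚᵘ-fromℚᵘ (ℚᵘ.mkℚᵘ (+ 1) n)))
    (ℚᵘ.*<* (ℤ.+<+ (cross n n≥))))
    where
    open ℕ.≤-Reasoning
    cross : ∀ n → n ≥ suc d → 1 ℕ.* suc d ℕ.< suc a ℕ.* suc n
    cross n n≥ = begin-strict
      1 ℕ.* suc d      ≡⟨ ℕ.*-identityˡ (suc d) ⟩
      suc d            <⟨ ℕ.s≤s n≥ ⟩
      suc n            ≤⟨ ℕ.m≤m+n (suc n) (a ℕ.* suc n) ⟩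
      suc a ℕ.* suc n  ∎

  root-cauchy : ∀ k .{{_ : NonZero k}} P Q .{{_ : NonZero Q}} → IsCauchy (rootSeq k P Q)
  root-cauchy k P Q ε 0<ε with inv-small ε 0<ε
  ... | N , small = N , λ m n m≥ n≥ →
    ∣∣<-intro (x m ℚ.- x n) (half m n n≥)
      (subst (ℚ._< ε) (swap (x m) (x n)) (half n m m≥))
    where
    x = rootSeq k P Q
    open ℚSolver.+-*-Solver
    swap : ∀ a b → b ℚ.- a ≡ ℚ.- (a ℚ.- b)
    swap = solve 2 (λ a b → b :- a := :- (a :- b)) refl
    half : ∀ m n → n ≥ N → x m ℚ.- x n ℚ.< ε
    half m n n≥ = begin-strict
      x m ℚ.- x n
        <⟨ ℚ.+-monoˡ-< (ℚ.- x n) (frac-< (a m) (suc (a n)) m n (rootNum-cross k P Q m n)) ⟩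
      + suc (a n) ℚ./ suc n ℚ.- x n
        ≡⟨ cong (ℚ._- x n) (frac-suc (a n) n) ⟩
      (x n ℚ.+ + 1 ℚ./ suc n) ℚ.- x n
        ≡⟨ solve 2 (λ a b → (a :+ b) :- a := b) refl (x n) (+ 1 ℚ./ suc n) ⟩
      + 1 ℚ./ suc n
        <⟨ small n n≥ ⟩
      ε ∎
      where
      open ℚ.≤-Reasoning
      a = rootNum k P Q

infix 8 root_of_over_ √_

-- root k of P over Q is the nonnegative k-th root of P / Q.
root_of_over_ : (k P Q : ℕ) .{{_ : NonZero k}} .{{_ : NonZero Q}} → ℝ
root k of P over Q = mkℝ (rootSeq k P Q) (root-cauchy k P Q)

√_ : ℕ → ℝ
√ a = root 2 of a over 1

------------------------------------------------------------------------
-- Korselt numbers with three factors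

r∸1∣pq∸1 : ∀ {n p q r} → n ≡ p ℕ.* q ℕ.* r → 1 ℕ.< p → p ℕ.< q → q ℕ.< r →
           (r ∸ 1) ∣ (n ∸ 1) → (r ∸ 1) ∣ (p ℕ.* q ∸ 1)
r∸1∣pq∸1 {p = suc p} {suc q} {suc r} refl _ _ _ d =
  ∣m+n∣m⇒∣n (subst (r ∣_) (eq (q ℕ.+ p ℕ.* suc q) r) d) (n∣m*n (suc p ℕ.* suc q))
  where
  open ℕSolver.+-*-Solver
  eq : ∀ s r → r ℕ.+ s ℕ.* suc r ≡ suc s ℕ.* r ℕ.+ s
  eq = solve 2 (λ s r → r :+ s :* (con 1 :+ r) := (con 1 :+ s) :* r :+ s) refl

-- A K₃N with product n; the factorisation is part of the data.
record K₃N (n : ℕ) : Set where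
  field
    p q r   : ℕ
    n≡pqr   : n ≡ p ℕ.* q ℕ.* r
    1<p     : 1 ℕ.< p
    p<q     : p ℕ.< q
    q<r     : q ℕ.< r
    p-odd   : p ℕ.% 2 ≡ 1
    q-odd   : q ℕ.% 2 ≡ 1
    r-odd   : r ℕ.% 2 ≡ 1
    p∸1∣n∸1 : (p ∸ 1) ∣ (n ∸ 1)
    q∸1∣n∸1 : (q ∸ 1) ∣ (n ∸ 1)
    r∸1∣n∸1 : (r ∸ 1) ∣ (n ∸ 1)

  E : ℕ
  E = quotient (r∸1∣pq∸1 n≡pqr 1<p p<q q<r r∸1∣n∸1)

  field
    2≤E : 2 ℕ.≤ E

  H : ℕ
  H = gcd (gcd (p ∸ 1) (q ∸ 1)) (r ∸ 1)

  H∣q∸1 : H ∣ (q ∸ 1)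
  H∣q∸1 = ∣-trans (gcd[m,n]∣m (gcd (p ∸ 1) (q ∸ 1)) (r ∸ 1)) (gcd[m,n]∣n (p ∸ 1) (q ∸ 1))

  B : ℕ
  B = quotient H∣q∸1

record C₃N (n : ℕ) : Set where
  field
    k₃n : K₃N n

  open K₃N k₃n public

  field
    p-prime : Prime p
    q-prime : Prime q
    r-prime : Prime r

-- Write p = A H + 1, q = B H + 1, r = C H + 1. The divisibility conditions make A and B coprime
-- and give m B = p + E and k A = m + H for some m and k. Unless m = k = 1, this forces
-- 8 n ≥ 5 B⁴, which is more than enough. If m = k = 1, put h = H, so that p = h² + h + 1, and write
-- E = p - u; then B = 2 p - u, C = 2 p + u + w and w p = u² + w u + h + 1 for some integer w ≥ 1.
-- For fixed h a larger w makes B smaller and n larger, and w ≥ w₀ yields the bound with √w₀.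
-- The equation has no solution for w = 1 and w = 2, which gives (a). For (b), w = 3 is a Pell
-- equation whose solutions modulo 7 make p or q divisible by 7 (leaving only n = 6601) or contradict
-- coprimality, w = 4 has a single solution, with q composite, w = 5 fails modulo 49, and w = 6 is a
-- Pell equation without solutions for even h.
module Submission where

open import Defs using (ℝ; seq; fromℚ; fromℕ; rootNum; rootNum-lower; rootNum-upper; rootSeq)
open import Defs using (root_of_over_; √_; K₃N; C₃N; r∸1∣pq∸1)
import Defs as ℝ
open import Algebra.Bundles using (CommutativeRing)
open import Data.Bool as Bool using (Bool; true; false; _∧_)
open import Data.Bool.Properties using (T-∧)
open import Data.Empty using (⊥; ⊥-elim)
open import Data.Integer as ℤ using (+_)
import Data.Integer.Properties as ℤ
open import Data.List using (List; []; _∷_)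
open import Data.Nat as ℕ using (ℕ; zero; suc; NonZero; _∸_)
open import Data.Nat.Coprimality as Coprimality using (Coprime; coprime-divisor)
open import Data.Nat.Divisibility using (_∣_; divides; quotient; _∣?_; ∣-trans; ∣⇒≤; ∣1⇒≡1; ∣m+n∣m⇒∣n; ∣m∣n⇒∣m+n)
open import Data.Nat.Divisibility using (m∣m*n; n∣m*n; ∣m⇒∣m*n; ∣n⇒∣m*n; *-cancelʳ-∣; *-monoˡ-∣)
open import Data.Nat.DivMod using (m≡m%n+[m/n]*n; m%n<n; m%n%n≡m%n; %-distribˡ-+; %-distribˡ-*)
open import Data.Nat.GCD using (gcd; gcd[m,n]∣m; gcd[m,n]∣n; gcd-greatest)
open import Data.Nat.Induction using (<-rec)
open import Data.Nat.Primality using (Prime; prime⇒irreducible)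
import Data.Nat.Properties as ℕ
open import Data.Nat.Tactic.RingSolver using (solve-∀)
open import Data.Product using (∃-syntax; _×_; _,_; proj₁; proj₂)
open import Data.Rational as ℚ using (ℚ; 0ℚ; 1ℚ; ½; *<*; mkℚ)
import Data.Rational.Properties as ℚ
import Data.Rational.Solver as ℚSolver
import Data.Rational.Unnormalised as ℚᵘ
import Data.Rational.Unnormalised.Properties as ℚᵘ
open import Data.Sum using (_⊎_; inj₁; inj₂; [_,_]′)
open import Function using (Equivalence)
open import Relation.Binary.PropositionalEquality
open import Relation.Nullary using (¬_; yes; no; contradiction)
open import Relation.Nullary.Decidable using (¬?; from-yes; from-no; _→-dec_; _×-dec_)
import Algebra.Properties.CommutativeSemiring.Exp
  (CommutativeRing.commutativeSemiring ℚ.+-*-commutativeRing) as ℚ^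

-- With n = 4 S⁸ the right-hand side is 2 S² + S/2 - √w₀ (S - κ) + β, where β = 1/2 + 3 w₀/8 and κ =
-- 3/8 - (w₀ - 1)/(2 w₀); this explains the constants for w₀ = 3 and w₀ = 7. In the extremal family
-- with w = w₀, S is h + 3/8 + (33 + 4 w)/(128 h) + O(1/h²), so 2 S² + S/2 + β is 2 p + w/2 + o(1),
-- while B = 2 p + w/2 - (2 u + w)/2 and (2 u + w)/2 is √w (h + (w - 1)/(2 w)) + o(1). The two sides
-- then differ by o(1) as h grows, so no loss of constant size is affordable: S is replaced by a
-- rational s₀ that keeps the expansion through order 1/h, and what remains are exact comparisons of
-- polynomials in h. The case m = k = 1 stands apart because there p is about H², whereas k ≥ 3 with
-- m = 1 makes p at most about H²/3, and m ≥ 2 gains a factor m². The reals are left behind early: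
-- it suffices to bound B, with a fixed rational margin, for all rationals S ≥ (n/4)^(1/8) and 0 ≤ ρ
-- ≤ √w₀.

ℕ^-distrib-* : ∀ a b k → (a ℕ.* b) ℕ.^ k ≡ a ℕ.^ k ℕ.* b ℕ.^ k
ℕ^-distrib-* a b zero    = refl
ℕ^-distrib-* a b (suc k) = trans (cong (a ℕ.* b ℕ.*_) (ℕ^-distrib-* a b k))
  (interchange a b (a ℕ.^ k) (b ℕ.^ k))
  where
  interchange : ∀ a b c d → a ℕ.* b ℕ.* (c ℕ.* d) ≡ a ℕ.* c ℕ.* (b ℕ.* d)
  interchange = solve-∀

-- s₀ = rootTop w h / (64 (2 h + 1)) satisfies (8 s₀ + 1)² > 16 (2 h + 1)² + 33 + 4 w.
rootTop : ℕ → ℕ → ℕ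
rootTop w h = 128 ℕ.* (h ℕ.* h) ℕ.+ 112 ℕ.* h ℕ.+ (57 ℕ.+ 4 ℕ.* w)

-- Rational bounds for the real roots

module _ where
  open import Data.Rational using (_+_; _*_; _-_; _≤_; _<_)
  open ℚ^ using (_^_)
  open ℚSolver.+-*-Solver using (solve; con; _:+_; _:*_; _:-_; _:=_)
  open ℚ.≤-Reasoning

  ι : ℕ → ℚ
  ι a = + a ℚ./ 1

  1/suc : ℕ → ℚ
  1/suc m = + 1 ℚ./ suc m

  toℚᵘ-/ : ∀ a m → ℚ.toℚᵘ (+ a ℚ./ suc m) ℚᵘ.≃ ℚᵘ.mkℚᵘ (+ a) m
  toℚᵘ-/ a m = ℚ.toℚᵘ-fromℚᵘ (ℚᵘ.mkℚᵘ (+ a) m)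

  ι-+ : ∀ a b → ι (a ℕ.+ b) ≡ ι a + ι b
  ι-+ a b = ℚ.toℚᵘ-injective
    (ℚᵘ.≃-trans (toℚᵘ-/ (a ℕ.+ b) 0)
    (ℚᵘ.≃-trans (ℚᵘ.*≡* (cong (ℤ._* + 1) (trans (ℤ.pos-+ a b)
        (cong₂ ℤ._+_ (sym (ℤ.*-identityʳ (+ a))) (sym (ℤ.*-identityʳ (+ b)))))))
    (ℚᵘ.≃-trans (ℚᵘ.+-cong (ℚᵘ.≃-sym (toℚᵘ-/ a 0)) (ℚᵘ.≃-sym (toℚᵘ-/ b 0)))
    (ℚᵘ.≃-sym (ℚ.toℚᵘ-homo-+ (ι a) (ι b))))))

  /≡ι*1/suc : ∀ a m → + a ℚ./ suc m ≡ ι a * 1/suc m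
  /≡ι*1/suc a m = ℚ.toℚᵘ-injective
    (ℚᵘ.≃-trans (toℚᵘ-/ a m)
    (ℚᵘ.≃-trans (ℚᵘ.*≡* (cong₂ ℤ._*_ (sym (ℤ.*-identityʳ (+ a))) (cong +_ (ℕ.*-identityˡ (suc m)))))
    (ℚᵘ.≃-trans (ℚᵘ.*-cong (ℚᵘ.≃-sym (toℚᵘ-/ a 0)) (ℚᵘ.≃-sym (toℚᵘ-/ 1 m)))
    (ℚᵘ.≃-sym (ℚ.toℚᵘ-homo-* (ι a) (1/suc m))))))

  ι-* : ∀ a b → ι (a ℕ.* b) ≡ ι a * ι b
  ι-* a b = ℚ.toℚᵘ-injective
    (ℚᵘ.≃-trans (toℚᵘ-/ (a ℕ.* b) 0)
    (ℚᵘ.≃-trans (ℚᵘ.*≡* (cong (ℤ._* + 1) (ℤ.pos-* a b)))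
    (ℚᵘ.≃-trans (ℚᵘ.*-cong (ℚᵘ.≃-sym (toℚᵘ-/ a 0)) (ℚᵘ.≃-sym (toℚᵘ-/ b 0)))
    (ℚᵘ.≃-sym (ℚ.toℚᵘ-homo-* (ι a) (ι b))))))

  ι-^ : ∀ a k → ι (a ℕ.^ k) ≡ ι a ^ k
  ι-^ a zero    = refl
  ι-^ a (suc k) = trans (ι-* a (a ℕ.^ k)) (cong (ι a *_) (ι-^ a k))

  ι-mono-≤ : ∀ a b → a ℕ.≤ b → ι a ≤ ι b
  ι-mono-≤ a b a≤b = ℚ.toℚᵘ-cancel-≤
    (ℚᵘ.≤-respˡ-≃ (ℚᵘ.≃-sym (toℚᵘ-/ a 0))
    (ℚᵘ.≤-respʳ-≃ (ℚᵘ.≃-sym (toℚᵘ-/ b 0))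
    (ℚᵘ.*≤* (ℤ.*-monoʳ-≤-nonNeg (+ 1) (ℤ.+≤+ a≤b)))))

  ι-mono-< : ∀ a b → a ℕ.< b → ι a < ι b
  ι-mono-< a b a<b = ℚ.toℚᵘ-cancel-<
    (ℚᵘ.<-respˡ-≃ (ℚᵘ.≃-sym (toℚᵘ-/ a 0))
    (ℚᵘ.<-respʳ-≃ (ℚᵘ.≃-sym (toℚᵘ-/ b 0))
    (ℚᵘ.*<* (ℤ.*-monoʳ-<-pos (+ 1) (ℤ.+<+ a<b)))))

  0≤ι : ∀ a → 0ℚ ≤ ι a
  0≤ι a = ι-mono-≤ 0 a ℕ.z≤n

  0<1/suc : ∀ m → 0ℚ < 1/suc m
  0<1/suc m = ℚ.toℚᵘ-cancel-< (ℚᵘ.<-respʳ-≃ (ℚᵘ.≃-sym (toℚᵘ-/ 1 m))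
    (ℚᵘ.*<* (ℤ.+<+ (ℕ.s≤s ℕ.z≤n))))

  ι*1/suc≡1 : ∀ m → ι (suc m) * 1/suc m ≡ 1ℚ
  ι*1/suc≡1 m = trans (sym (/≡ι*1/suc (suc m) m)) (ℚ.toℚᵘ-injective
    (ℚᵘ.≃-trans (toℚᵘ-/ (suc m) m) (ℚᵘ.*≡* (ℤ.*-comm (+ suc m) (+ 1)))))

  ≤-diff : ∀ {a b} c → 0ℚ ≤ c → a + c ≡ b → a ≤ b
  ≤-diff {a} c 0≤c refl = subst (_≤ a + c) (ℚ.+-identityʳ a) (ℚ.+-monoʳ-≤ a 0≤c)

  <-diff : ∀ {a b} c → 0ℚ < c → a + c ≡ b → a < b
  <-diff {a} c 0<c refl = subst (_< a + c) (ℚ.+-identityʳ a) (ℚ.+-monoʳ-< a 0<c)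

  0≤-diff : ∀ {a b} → a ≤ b → 0ℚ ≤ b - a
  0≤-diff {a} {b} a≤b = subst (_≤ b - a) (ℚ.+-inverseʳ a) (ℚ.+-monoˡ-≤ (ℚ.- a) a≤b)

  0≤+ : ∀ {a b} → 0ℚ ≤ a → 0ℚ ≤ b → 0ℚ ≤ a + b
  0≤+ = ℚ.+-mono-≤

  *-mono-≤ : ∀ {a b c d} → 0ℚ ≤ a → a ≤ b → 0ℚ ≤ c → c ≤ d → a * c ≤ b * d
  *-mono-≤ {a} {b} {c} {d} 0≤a a≤b 0≤c c≤d = begin
    a * c  ≤⟨ ℚ.*-monoʳ-≤-nonNeg c {{ℚ.nonNegative 0≤c}} a≤b ⟩
    b * c  ≤⟨ ℚ.*-monoˡ-≤-nonNeg b {{ℚ.nonNegative (ℚ.≤-trans 0≤a a≤b)}} c≤d ⟩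
    b * d  ∎

  0≤* : ∀ {a b} → 0ℚ ≤ a → 0ℚ ≤ b → 0ℚ ≤ a * b
  0≤* 0≤a 0≤b = *-mono-≤ ℚ.≤-refl 0≤a ℚ.≤-refl 0≤b

  0<* : ∀ {a b} → 0ℚ < a → 0ℚ < b → 0ℚ < a * b
  0<* {a} {b} 0<a 0<b =
    ℚ.positive⁻¹ _ {{ℚ.pos*pos⇒pos a {{ℚ.positive 0<a}} b {{ℚ.positive 0<b}}}}

  0≤^ : ∀ {a} → 0ℚ ≤ a → ∀ k → 0ℚ ≤ a ^ k
  0≤^ 0≤a zero    = 0≤ι 1
  0≤^ 0≤a (suc k) = 0≤* 0≤a (0≤^ 0≤a k)

  0≤² : ∀ a → 0ℚ ≤ a * a
  0≤² a with ℚ.≤-total 0ℚ a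
  ... | inj₁ 0≤a = 0≤* 0≤a 0≤a
  ... | inj₂ a≤0 = subst (0ℚ ≤_) (solve 1 (λ a → (con 0ℚ :- a) :* (con 0ℚ :- a) := a :* a) refl a)
    (0≤* (0≤-diff a≤0) (0≤-diff a≤0))

  ²-cancel-≤ : ∀ {a b} → 0ℚ ≤ b → a * a ≤ b * b → a ≤ b
  ²-cancel-≤ {a} {b} 0≤b a²≤b² with a ℚ.≤? b
  ... | yes a≤b = a≤b
  ... | no  a≰b = contradiction (begin-strict
    b * b  ≤⟨ *-mono-≤ 0≤b (ℚ.<⇒≤ b<a) 0≤b ℚ.≤-refl ⟩
    a * b  <⟨ ℚ.*-monoʳ-<-pos a {{ℚ.positive (ℚ.≤-<-trans 0≤b b<a)}} b<a ⟩
    a * a  ≤⟨ a²≤b² ⟩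
    b * b  ∎) (ℚ.<-irrefl refl)
    where b<a = ℚ.≰⇒> a≰b

  ^4-cancel-≤ : ∀ {a b} → 0ℚ ≤ b → a ^ 4 ≤ b ^ 4 → a ≤ b
  ^4-cancel-≤ {a} {b} 0≤b le = ²-cancel-≤ 0≤b (²-cancel-≤ (0≤² b)
    (subst₂ _≤_ (split a) (split b) le))
    where
    split : ∀ a → a ^ 4 ≡ (a * a) * (a * a)
    split = solve 1 (λ a → a :* (a :* (a :* (a :* con 1ℚ))) := (a :* a) :* (a :* a)) refl

  1^k≡1 : ∀ k → 1ℚ ^ k ≡ 1ℚ
  1^k≡1 zero    = refl
  1^k≡1 (suc k) = trans (ℚ.*-identityˡ (1ℚ ^ k)) (1^k≡1 k)

  clear-denominator : ∀ P m k → ι (P ℕ.* suc m ℕ.^ k) * 1/suc m ^ k ≡ ι P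
  clear-denominator P m k = begin-equality
    ι (P ℕ.* suc m ℕ.^ k) * e ^ k    ≡⟨ cong (_* e ^ k) (ι-* P (suc m ℕ.^ k)) ⟩
    ι P * ι (suc m ℕ.^ k) * e ^ k    ≡⟨ ℚ.*-assoc (ι P) (ι (suc m ℕ.^ k)) (e ^ k) ⟩
    ι P * (ι (suc m ℕ.^ k) * e ^ k)  ≡⟨ cong (λ z → ι P * (z * e ^ k)) (ι-^ (suc m) k) ⟩
    ι P * (ι (suc m) ^ k * e ^ k)    ≡⟨ cong (ι P *_) (ℚ^.^-distrib-* (ι (suc m)) e k) ⟨
    ι P * (ι (suc m) * e) ^ k        ≡⟨ cong (λ z → ι P * z ^ k) (ι*1/suc≡1 m) ⟩
    ι P * 1ℚ ^ k                     ≡⟨ cong (ι P *_) (1^k≡1 k) ⟩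
    ι P * 1ℚ                         ≡⟨ ℚ.*-identityʳ (ι P) ⟩
    ι P                              ∎
    where e = 1/suc m

  scaled-^ : ∀ j Q m k → (ι j * 1/suc m) ^ k * ι Q ≡ ι (j ℕ.^ k ℕ.* Q) * 1/suc m ^ k
  scaled-^ j Q m k = begin-equality
    (ι j * e) ^ k * ι Q        ≡⟨ cong (_* ι Q) (ℚ^.^-distrib-* (ι j) e k) ⟩
    ι j ^ k * e ^ k * ι Q
      ≡⟨ solve 3 (λ x y z → x :* y :* z := x :* z :* y) refl (ι j ^ k) (e ^ k) (ι Q) ⟩
    ι j ^ k * ι Q * e ^ k
      ≡⟨ cong (_* e ^ k) (trans (ι-* (j ℕ.^ k) Q) (cong (_* ι Q) (ι-^ j k))) ⟨
    ι (j ℕ.^ k ℕ.* Q) * e ^ k  ∎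
    where e = 1/suc m

  rootSeq-lower : ∀ k .{{_ : NonZero k}} P Q .{{_ : NonZero Q}} m →
                  rootSeq k P Q m ^ k * ι Q ≤ ι P
  rootSeq-lower k P Q m = begin
    rootSeq k P Q m ^ k * ι Q      ≡⟨ cong (λ z → z ^ k * ι Q) (/≡ι*1/suc j m) ⟩
    (ι j * e) ^ k * ι Q            ≡⟨ scaled-^ j Q m k ⟩
    ι (j ℕ.^ k ℕ.* Q) * e ^ k
      ≤⟨ *-mono-≤ (0≤ι (j ℕ.^ k ℕ.* Q)) (ι-mono-≤ _ _ (rootNum-lower k P Q m)) (0≤^ (ℚ.<⇒≤ (0<1/suc m)) k) ℚ.≤-refl ⟩
    ι (P ℕ.* suc m ℕ.^ k) * e ^ k  ≡⟨ clear-denominator P m k ⟩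
    ι P                            ∎
    where
    j = rootNum k P Q m
    e = 1/suc m

  rootSeq-upper : ∀ k .{{_ : NonZero k}} P Q .{{_ : NonZero Q}} m →
                  ι P ≤ (rootSeq k P Q m + 1/suc m) ^ k * ι Q
  rootSeq-upper k P Q m = begin
    ι P                                ≡⟨ clear-denominator P m k ⟨
    ι (P ℕ.* suc m ℕ.^ k) * e ^ k
      ≤⟨ *-mono-≤ (0≤ι (P ℕ.* suc m ℕ.^ k)) (ι-mono-≤ _ _ (ℕ.<⇒≤ (rootNum-upper k P Q m))) (0≤^ (ℚ.<⇒≤ (0<1/suc m)) k) ℚ.≤-refl ⟩
    ι (suc j ℕ.^ k ℕ.* Q) * e ^ k      ≡⟨ scaled-^ (suc j) Q m k ⟨
    (ι (suc j) * e) ^ k * ι Q          ≡⟨ cong (λ z → (z * e) ^ k * ι Q) (ι-+ 1 j) ⟩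
    ((1ℚ + ι j) * e) ^ k * ι Q
      ≡⟨ cong (λ z → z ^ k * ι Q) (solve 2 (λ j e → (con 1ℚ :+ j) :* e := j :* e :+ e) refl (ι j) e) ⟩
    (ι j * e + e) ^ k * ι Q            ≡⟨ cong (λ z → (z + e) ^ k * ι Q) (/≡ι*1/suc j m) ⟨
    (rootSeq k P Q m + e) ^ k * ι Q    ∎
    where
    j = rootNum k P Q m
    e = 1/suc m

  0≤rootSeq : ∀ k P Q .{{_ : NonZero Q}} m → 0ℚ ≤ rootSeq k P Q m
  0≤rootSeq k P Q m = subst (0ℚ ≤_) (sym (/≡ι*1/suc (rootNum k P Q m) m))
    (0≤* (0≤ι (rootNum k P Q m)) (ℚ.<⇒≤ (0<1/suc m)))

  -- A rough cap, needed only to bound error terms uniformly in m; it rests on P ≤ P^k for P ≥ 1.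
  rootSeq≤P : ∀ k .{{_ : NonZero k}} P Q .{{_ : NonZero P}} .{{_ : NonZero Q}} m → rootSeq k P Q m ≤ ι P
  rootSeq≤P k@(suc k-1) P Q m = begin
    rootSeq k P Q m          ≡⟨ /≡ι*1/suc j m ⟩
    ι j * e                  ≤⟨ *-mono-≤ (0≤ι j) (ι-mono-≤ j (P ℕ.* suc m) j≤PM) (ℚ.<⇒≤ (0<1/suc m)) ℚ.≤-refl ⟩
    ι (P ℕ.* suc m) * e      ≡⟨ cong (_* e) (ι-* P (suc m)) ⟩
    ι P * ι (suc m) * e      ≡⟨ ℚ.*-assoc (ι P) (ι (suc m)) e ⟩
    ι P * (ι (suc m) * e)    ≡⟨ cong (ι P *_) (ι*1/suc≡1 m) ⟩
    ι P * 1ℚ                 ≡⟨ ℚ.*-identityʳ (ι P) ⟩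
    ι P                      ∎
    where
    j = rootNum k P Q m
    e = 1/suc m
    j^k≤[PM]^k : j ℕ.^ k ℕ.≤ (P ℕ.* suc m) ℕ.^ k
    j^k≤[PM]^k = ℕ.≤-trans (ℕ.m≤m*n (j ℕ.^ k) Q) (ℕ.≤-trans (rootNum-lower k P Q m)
      (ℕ.≤-trans (ℕ.*-monoˡ-≤ (suc m ℕ.^ k) (ℕ.m≤m*n P (P ℕ.^ k-1) {{ℕ.m^n≢0 P k-1}}))
      (ℕ.≤-reflexive (sym (ℕ^-distrib-* P (suc m) k)))))
    j≤PM : j ℕ.≤ P ℕ.* suc m
    j≤PM with j ℕ.≤? P ℕ.* suc m
    ... | yes j≤ = j≤
    ... | no  j≰ = contradiction j^k≤[PM]^k (ℕ.<⇒≱ (ℕ.^-monoˡ-< k (ℕ.≰⇒> j≰)))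

  1/suc≤1 : ∀ m → 1/suc m ≤ 1ℚ
  1/suc≤1 m = begin
    1/suc m              ≡⟨ ℚ.*-identityˡ (1/suc m) ⟨
    1ℚ * 1/suc m         ≤⟨ *-mono-≤ (0≤ι 1) (ι-mono-≤ 1 (suc m) (ℕ.s≤s ℕ.z≤n)) (ℚ.<⇒≤ (0<1/suc m)) ℚ.≤-refl ⟩
    ι (suc m) * 1/suc m  ≡⟨ ι*1/suc≡1 m ⟩
    1ℚ                   ∎

  -- From rational approximants to strict inequality of reals

  archimedean : ∀ δ → 0ℚ < δ → ∃[ D ] 1ℚ ≤ ι D * δ
  archimedean (mkℚ (+ zero) d _) (*<* (ℤ.+<+ ()))
  archimedean (mkℚ (ℤ.-[1+ _ ]) d _) (*<* ())
  archimedean δ@(mkℚ (+ suc a) d _) _ = suc d , (begin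
    1ℚ                               ≤⟨ ι-mono-≤ 1 (suc a) (ℕ.s≤s ℕ.z≤n) ⟩
    ι (suc a)                        ≡⟨ ℚ.*-identityʳ (ι (suc a)) ⟨
    ι (suc a) * 1ℚ                   ≡⟨ cong (ι (suc a) *_) (ι*1/suc≡1 d) ⟨
    ι (suc a) * (ι (suc d) * 1/suc d)
      ≡⟨ solve 3 (λ a b c → a :* (b :* c) := b :* (a :* c)) refl (ι (suc a)) (ι (suc d)) (1/suc d) ⟩
    ι (suc d) * (ι (suc a) * 1/suc d) ≡⟨ cong (ι (suc d) *_) (/≡ι*1/suc (suc a) d) ⟨
    ι (suc d) * (+ suc a ℚ./ suc d)  ≡⟨ cong (ι (suc d) *_) (ℚ.fromℚᵘ-toℚᵘ δ) ⟩
    ι (suc d) * δ                    ∎)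

  -- The error K/(m + 1) falls below δ/2 once m ≥ 2 K D with D δ ≥ 1; the other half of δ is the
  -- separation that the order on the reals demands.
  <-intro : ∀ B (y : ℝ) K δ → 0ℚ < δ → (∀ m → ι B + δ ≤ seq y m + ι K * 1/suc m) →
            fromℕ B ℝ.< y
  <-intro B y K δ 0<δ bound with archimedean δ 0<δ
  ... | D , 1≤Dδ = ½ * δ , 0<* (ℚ.positive⁻¹ ½) 0<δ , 2 ℕ.* K ℕ.* D , λ m m≥N →
    <-diff (½ * δ - ι K * 1/suc m + (seq y m + ι K * 1/suc m - (ι B + δ)))
      (ℚ.+-mono-<-≤ (small m m≥N) (0≤-diff (bound m)))
      (solve 4 (λ B δ z y → B :+ con ½ :* δ :+ (con ½ :* δ :- z :+ (y :+ z :- (B :+ δ))) := y)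
        refl (ι B) δ (ι K * 1/suc m) (seq y m))
    where
    small : ∀ m → 2 ℕ.* K ℕ.* D ℕ.≤ m → 0ℚ < ½ * δ - ι K * 1/suc m
    small m m≥N = ℚ.*-cancelˡ-<-nonNeg (ι 2 * ι D) {{ℚ.nonNegative (0≤* (0≤ι 2) (0≤ι D))}}
      (subst (_< ι 2 * ι D * (½ * δ - ι K * 1/suc m)) (sym (ℚ.*-zeroʳ (ι 2 * ι D)))
        (subst (0ℚ <_)
          (solve 4 (λ d δ k e → (con 1ℚ :- con (ι 2) :* k :* d :* e) :+ (d :* δ :- con 1ℚ)
                      := con (ι 2) :* d :* (con ½ :* δ :- k :* e)) refl (ι D) δ (ι K) (1/suc m))
          (ℚ.+-mono-<-≤ N/suc<1 (0≤-diff 1≤Dδ))))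
      where
      N/suc<1 : 0ℚ < 1ℚ - ι 2 * ι K * ι D * 1/suc m
      N/suc<1 = subst (_< 1ℚ - ι 2 * ι K * ι D * 1/suc m) (ℚ.+-inverseʳ (ι 2 * ι K * ι D * 1/suc m))
        (ℚ.+-monoˡ-< (ℚ.- (ι 2 * ι K * ι D * 1/suc m)) (begin-strict
          ι 2 * ι K * ι D * 1/suc m
            ≡⟨ cong (_* 1/suc m) (trans (ι-* (2 ℕ.* K) D) (cong (_* ι D) (ι-* 2 K))) ⟨
          ι (2 ℕ.* K ℕ.* D) * 1/suc m
            <⟨ ℚ.*-monoˡ-<-pos (1/suc m) {{ℚ.positive (0<1/suc m)}} (ι-mono-< (2 ℕ.* K ℕ.* D) (suc m) (ℕ.s≤s m≥N)) ⟩
          ι (suc m) * 1/suc m        ≡⟨ ι*1/suc≡1 m ⟩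
          1ℚ                         ∎))

  -- In the bound, √2 n^(1/4) = 2 S² with S = (n / 4)^(1/8).
  boundAt : (κ β S ρ : ℚ) → ℚ
  boundAt κ β S ρ = ι 2 * (S * S) + ½ * S - ρ * (S - κ) + β

  -- Here x, t, s are lower approximants, up to e, of √2, n^(1/4) and (n/4)^(1/8). Going back from s
  -- + e to s and from 2 s² to x t costs at most e (x + t + 4 s + 3 e + 1/2), and the caps on x, t,
  -- s, e turn this into (5 n + 6) e.
  perturb : ∀ {x t s ρ e n κ β L} →
    x ≤ ι 2 → t ≤ n → s ≤ n → 0ℚ ≤ ρ → 0ℚ ≤ e → e ≤ 1ℚ →
    ι 2 * (s * s) ≤ (x + e) * (t + e) →
    L ≤ boundAt κ β (s + e) ρ →
    L ≤ x * t - (ρ - ½) * s + (β + κ * ρ) + (ι 5 * n + ι 6) * e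
  perturb {x} {t} {s} {ρ} {e} {n} {κ} {β} {L} x≤2 t≤n s≤n 0≤ρ 0≤e e≤1 roots bound =
    ℚ.≤-trans bound (≤-diff
      (((x + e) * (t + e) - ι 2 * (s * s)) +
        e * ((ι 2 - x) + (n - t) + ι 4 * (n - s) + ι 3 * (1ℚ - e) + ρ + ½))
      (0≤+ (0≤-diff roots) (0≤* 0≤e
        (0≤+ (0≤+ (0≤+ (0≤+ (0≤+ (0≤-diff x≤2) (0≤-diff t≤n)) (0≤* (0≤ι 4) (0≤-diff s≤n)))
          (0≤* (0≤ι 3) (0≤-diff e≤1))) 0≤ρ) (ℚ.<⇒≤ (ℚ.positive⁻¹ ½)))))
      (solve 8 (λ x t s ρ e n κ β →
          con (ι 2) :* ((s :+ e) :* (s :+ e)) :+ con ½ :* (s :+ e) :- ρ :* ((s :+ e) :- κ) :+ β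
          :+ (((x :+ e) :* (t :+ e) :- con (ι 2) :* (s :* s)) :+
             e :* ((con (ι 2) :- x) :+ (n :- t) :+ con (ι 4) :* (n :- s) :+ con (ι 3) :* (con 1ℚ :- e) :+ ρ :+ con ½))
          := x :* t :- (ρ :- con ½) :* s :+ (β :+ κ :* ρ) :+ (con (ι 5) :* n :+ con (ι 6)) :* e)
        refl x t s ρ e n κ β))

  -- Each approximant is at most its root and within 1/(m + 1) of it. So s + e is at least
  -- (n/4)^(1/8) and ρ is at most √w, and the last hypothesis applies to them at every index m.
  bound-criterion : ∀ n .{{_ : NonZero n}} w .{{_ : NonZero w}} κ β B (y : ℝ) →
    (∀ m → seq y m ≡ rootSeq 2 2 1 m * rootSeq 4 n 1 m
                     - (rootSeq 2 w 1 m - ½) * rootSeq 8 n 4 m + (β + κ * rootSeq 2 w 1 m)) →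
    ∀ δ → 0ℚ < δ →
    (∀ S ρ → 0ℚ ≤ S → 0ℚ ≤ ρ → ρ * ρ ≤ ι w → ι n ≤ S ^ 8 * ι 4 → ι B + δ ≤ boundAt κ β S ρ) →
    fromℕ B ℝ.< y
  bound-criterion n w κ β B y y≡ δ 0<δ bound = <-intro B y (5 ℕ.* n ℕ.+ 6) δ 0<δ λ m →
    let
      x = rootSeq 2 2 1 m
      t = rootSeq 4 n 1 m
      s = rootSeq 8 n 4 m
      ρ = rootSeq 2 w 1 m
      e = 1/suc m
      0≤e = ℚ.<⇒≤ (0<1/suc m)
      0≤x = 0≤rootSeq 2 2 1 m
      0≤t = 0≤rootSeq 4 n 1 m
      0≤s = 0≤rootSeq 8 n 4 m
    in subst (ι B + δ ≤_)
      (cong₂ _+_ (sym (y≡ m)) (cong (_* e) (sym (trans (ι-+ (5 ℕ.* n) 6) (cong (_+ ι 6) (ι-* 5 n))))))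
      (perturb {x} {t} {s} {ρ} {e} {ι n} {κ} {β}
        (rootSeq≤P 2 2 1 m) (rootSeq≤P 4 n 1 m) (rootSeq≤P 8 n 4 m) (0≤rootSeq 2 w 1 m) 0≤e (1/suc≤1 m)
        -- In fourth powers the claim follows from 4 (4 s⁸) ≤ 4 n ≤ (x + e)⁴ (t + e)⁴.
        (^4-cancel-≤ (0≤* (0≤+ 0≤x 0≤e) (0≤+ 0≤t 0≤e)) (begin
          (ι 2 * (s * s)) ^ 4
            ≡⟨ solve 1 (λ s → (con (ι 2) :* (s :* s)) :* ((con (ι 2) :* (s :* s)) :* ((con (ι 2) :* (s :* s)) :* ((con (ι 2) :* (s :* s)) :* con 1ℚ))) :=
                 con (ι 4) :* (s :* (s :* (s :* (s :* (s :* (s :* (s :* (s :* con 1ℚ))))))) :* con (ι 4))) refl s ⟩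
          ι 4 * (s ^ 8 * ι 4)  ≤⟨ *-mono-≤ (0≤ι 4) (four≤ m) (0≤* (0≤^ 0≤s 8) (0≤ι 4)) (ℚ.≤-trans (rootSeq-lower 8 n 4 m) (rootSeq-upper 4 n 1 m)) ⟩
          ((x + e) ^ 2 * (x + e) ^ 2) * ((t + e) ^ 4 * 1ℚ)
            ≡⟨ solve 2 (λ x t → ((x :* (x :* con 1ℚ)) :* (x :* (x :* con 1ℚ))) :* (t :* (t :* (t :* (t :* con 1ℚ))) :* con 1ℚ)
                 := (x :* t) :* ((x :* t) :* ((x :* t) :* ((x :* t) :* con 1ℚ)))) refl (x + e) (t + e) ⟩
          ((x + e) * (t + e)) ^ 4 ∎))
        (bound (s + e) ρ (0≤+ 0≤s 0≤e) (0≤rootSeq 2 w 1 m)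
          (subst (_≤ ι w) (solve 1 (λ ρ → ρ :* (ρ :* con 1ℚ) :* con 1ℚ := ρ :* ρ) refl ρ) (rootSeq-lower 2 w 1 m))
          (rootSeq-upper 8 n 4 m)))
    where
    four≤ : ∀ m → ι 4 ≤ (rootSeq 2 2 1 m + 1/suc m) ^ 2 * (rootSeq 2 2 1 m + 1/suc m) ^ 2
    four≤ m = *-mono-≤ (0≤ι 2) two≤ (0≤ι 2) two≤
      where
      two≤ : ι 2 ≤ (rootSeq 2 2 1 m + 1/suc m) ^ 2
      two≤ = subst (ι 2 ≤_) (ℚ.*-identityʳ _) (rootSeq-upper 2 2 1 m)

  -- The crude estimate, for 5 B⁴ ≤ 8 n

  ^8-cancel-≤ : ∀ {a b} → 0ℚ ≤ b → a ^ 8 ≤ b ^ 8 → a ≤ b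
  ^8-cancel-≤ {a} {b} 0≤b le = ²-cancel-≤ 0≤b (^4-cancel-≤ (0≤² b) (subst₂ _≤_ (split a) (split b) le))
    where
    split : ∀ a → a ^ 8 ≡ (a * a) ^ 4
    split = solve 1 (λ a → a :* (a :* (a :* (a :* (a :* (a :* (a :* (a :* con 1ℚ)))))))
      := (a :* a) :* ((a :* a) :* ((a :* a) :* ((a :* a) :* con 1ℚ)))) refl

  -- R is chosen so that 2 S² + ½ S - R S is (35/22) S² + (9/22) (S - v)² up to a constant.
  boundAt-crude : ∀ w κ β v c → let R = ½ + + 9 ℚ./ 11 * v in
    0ℚ ≤ v → ι w ≤ R * R → (∀ ρ → 0ℚ ≤ ρ → ρ ≤ R → c ≤ ρ * κ) →
    ∀ n B → 5 ℕ.* B ℕ.^ 4 ℕ.≤ 8 ℕ.* n →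
    ∀ S ρ → 0ℚ ≤ S → 0ℚ ≤ ρ → ρ * ρ ≤ ι w → ι n ≤ S ^ 8 * ι 4 →
    ι B + (c + β - + 9 ℚ./ 22 * (v * v)) ≤ boundAt κ β S ρ
  boundAt-crude w κ β v c 0≤v w≤R² c≤ n B 5B⁴≤8n S ρ 0≤S 0≤ρ ρ²≤w n≤4S⁸ =
    ≤-diff (+ 1 ℚ./ 22 * (ι 35 * (S * S) - ι 22 * ι B) + (R - ρ) * S + (ρ * κ - c)
              + + 9 ℚ./ 22 * ((S - v) * (S - v)))
      (0≤+ (0≤+ (0≤+ (0≤* (ℚ.nonNegative⁻¹ (+ 1 ℚ./ 22)) (0≤-diff 22B≤35S²))
        (0≤* (0≤-diff ρ≤R) 0≤S)) (0≤-diff (c≤ ρ 0≤ρ ρ≤R)))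
        (0≤* (ℚ.nonNegative⁻¹ (+ 9 ℚ./ 22)) (0≤² (S - v))))
      (solve 7 (λ b c β v S ρ κ →
        b :+ (c :+ β :- con (+ 9 ℚ./ 22) :* (v :* v)) :+
        (con (+ 1 ℚ./ 22) :* (con (ι 35) :* (S :* S) :- con (ι 22) :* b) :+ (con ½ :+ con (+ 9 ℚ./ 11) :* v :- ρ) :* S
          :+ (ρ :* κ :- c) :+ con (+ 9 ℚ./ 22) :* ((S :- v) :* (S :- v)))
        := con (ι 2) :* (S :* S) :+ con ½ :* S :- ρ :* (S :- κ) :+ β)
        refl (ι B) c β v S ρ κ)
    where
    R = ½ + + 9 ℚ./ 11 * v
    0≤R : 0ℚ ≤ R
    0≤R = 0≤+ (ℚ.nonNegative⁻¹ ½) (0≤* (ℚ.nonNegative⁻¹ (+ 9 ℚ./ 11)) 0≤v)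
    ρ≤R : ρ ≤ R
    ρ≤R = ²-cancel-≤ 0≤R (ℚ.≤-trans ρ²≤w w≤R²)
    5B⁴≤32S⁸ : ι 5 * ι B ^ 4 ≤ ι 8 * (S ^ 8 * ι 4)
    5B⁴≤32S⁸ = begin
      ι 5 * ι B ^ 4          ≡⟨ cong (ι 5 *_) (ι-^ B 4) ⟨
      ι 5 * ι (B ℕ.^ 4)      ≡⟨ ι-* 5 (B ℕ.^ 4) ⟨
      ι (5 ℕ.* B ℕ.^ 4)      ≤⟨ ι-mono-≤ (5 ℕ.* B ℕ.^ 4) (8 ℕ.* n) 5B⁴≤8n ⟩
      ι (8 ℕ.* n)            ≡⟨ ι-* 8 n ⟩
      ι 8 * ι n              ≤⟨ ℚ.*-monoˡ-≤-nonNeg (ι 8) n≤4S⁸ ⟩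
      ι 8 * (S ^ 8 * ι 4)    ∎
    -- 35/22 is a rational just above (32/5)^(1/4). The coefficients come from 5 · 46852 = 22⁴ + 4
    -- and 32 · 46852 + 1361 = 35⁴.
    22B≤35S² : ι 22 * ι B ≤ ι 35 * (S * S)
    22B≤35S² = ^4-cancel-≤ (0≤* (0≤ι 35) (0≤² S))
      (≤-diff (ι 46852 * (ι 8 * (S ^ 8 * ι 4) - ι 5 * ι B ^ 4) + ι 1361 * S ^ 8 + ι 4 * ι B ^ 4)
        (0≤+ (0≤+ (0≤* (0≤ι 46852) (0≤-diff 5B⁴≤32S⁸)) (0≤* (0≤ι 1361) (0≤^ 0≤S 8)))
          (0≤* (0≤ι 4) (0≤^ (0≤ι B) 4)))
        (solve 2 (λ S b →
          let S⁸ = S :* (S :* (S :* (S :* (S :* (S :* (S :* (S :* con 1ℚ)))))))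
              b⁴ = b :* (b :* (b :* (b :* con 1ℚ)))
              b′ = con (ι 22) :* b
              S′ = con (ι 35) :* (S :* S)
          in b′ :* (b′ :* (b′ :* (b′ :* con 1ℚ))) :+
             (con (ι 46852) :* (con (ι 8) :* (S⁸ :* con (ι 4)) :- con (ι 5) :* b⁴) :+ con (ι 1361) :* S⁸ :+ con (ι 4) :* b⁴)
             := S′ :* (S′ :* (S′ :* (S′ :* con 1ℚ)))) refl S (ι B)))

  bound₃ : ℕ → ℝ
  bound₃ n = √ 2 ℝ.* root 4 of n over 1
          ℝ.- (√ 3 ℝ.- fromℚ ½) ℝ.* root 8 of n over 4
          ℝ.+ (fromℕ 39 ℝ.+ √ 3) ℝ./ 24

  bound₇ : ℕ → ℝ
  bound₇ n = √ 2 ℝ.* root 4 of n over 1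
          ℝ.- (√ 7 ℝ.- fromℚ ½) ℝ.* root 8 of n over 4
          ℝ.+ (fromℕ 175 ℝ.- fromℕ 3 ℝ.* √ 7) ℝ./ 56

  bound₃-criterion : ∀ n .{{_ : NonZero n}} B δ → 0ℚ < δ →
    (∀ S ρ → 0ℚ ≤ S → 0ℚ ≤ ρ → ρ * ρ ≤ ι 3 → ι n ≤ S ^ 8 * ι 4 →
      ι B + δ ≤ boundAt (+ 1 ℚ./ 24) (+ 13 ℚ./ 8) S ρ) →
    fromℕ B ℝ.< bound₃ n
  bound₃-criterion n B = bound-criterion n 3 (+ 1 ℚ./ 24) (+ 13 ℚ./ 8) B (bound₃ n) λ m →
    solve 4 (λ x t s ρ → x :* t :- (ρ :- con ½) :* s :+ (con (ι 39) :+ ρ) :* con (+ 1 ℚ./ 24)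
      := x :* t :- (ρ :- con ½) :* s :+ (con (+ 13 ℚ./ 8) :+ con (+ 1 ℚ./ 24) :* ρ))
      refl (rootSeq 2 2 1 m) (rootSeq 4 n 1 m) (rootSeq 8 n 4 m) (rootSeq 2 3 1 m)

  bound₇-criterion : ∀ n .{{_ : NonZero n}} B δ → 0ℚ < δ →
    (∀ S ρ → 0ℚ ≤ S → 0ℚ ≤ ρ → ρ * ρ ≤ ι 7 → ι n ≤ S ^ 8 * ι 4 →
      ι B + δ ≤ boundAt (ℤ.-[1+ 2 ] ℚ./ 56) (+ 25 ℚ./ 8) S ρ) →
    fromℕ B ℝ.< bound₇ n
  bound₇-criterion n B = bound-criterion n 7 (ℤ.-[1+ 2 ] ℚ./ 56) (+ 25 ℚ./ 8) B (bound₇ n) λ m →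
    solve 4 (λ x t s ρ → x :* t :- (ρ :- con ½) :* s :+ (con (ι 175) :- con (ι 3) :* ρ) :* con (+ 1 ℚ./ 56)
      := x :* t :- (ρ :- con ½) :* s :+ (con (+ 25 ℚ./ 8) :+ con (ℤ.-[1+ 2 ] ℚ./ 56) :* ρ))
      refl (rootSeq 2 2 1 m) (rootSeq 4 n 1 m) (rootSeq 8 n 4 m) (rootSeq 2 7 1 m)

  crude₃ : ∀ n .{{_ : NonZero n}} B → 5 ℕ.* B ℕ.^ 4 ℕ.≤ 8 ℕ.* n → fromℕ B ℝ.< bound₃ n
  crude₃ n B 5B⁴≤8n = bound₃-criterion n B _ (from-yes (0ℚ ℚ.<? δ))
    (boundAt-crude 3 (+ 1 ℚ./ 24) (+ 13 ℚ./ 8) v 0ℚ (ℚ.nonNegative⁻¹ v) (from-yes (ι 3 ℚ.≤? R * R))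
      (λ _ 0≤ρ _ → 0≤* 0≤ρ (ℚ.nonNegative⁻¹ (+ 1 ℚ./ 24))) n B 5B⁴≤8n)
    where
    -- This v makes R = 7/4, slightly above √3. As κ is positive, 0 is a lower bound for ρ κ.
    v = + 55 ℚ./ 36
    R = ½ + + 9 ℚ./ 11 * v
    δ = 0ℚ + + 13 ℚ./ 8 - + 9 ℚ./ 22 * (v * v)

  crude₇ : ∀ n .{{_ : NonZero n}} B → 5 ℕ.* B ℕ.^ 4 ℕ.≤ 8 ℕ.* n → fromℕ B ℝ.< bound₇ n
  crude₇ n B 5B⁴≤8n = bound₇-criterion n B _ (from-yes (0ℚ ℚ.<? δ))
    (boundAt-crude 7 κ (+ 25 ℚ./ 8) v (R * κ) (ℚ.nonNegative⁻¹ v) (from-yes (ι 7 ℚ.≤? R * R))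
      (λ _ _ ρ≤R → ℚ.*-monoʳ-≤-nonPos κ ρ≤R) n B 5B⁴≤8n)
    where
    κ = ℤ.-[1+ 2 ] ℚ./ 56
    -- This v makes R = 53/20, slightly above √7. As κ is negative, ρ κ is bounded below by R κ.
    v = + 473 ℚ./ 180
    R = ½ + + 9 ℚ./ 11 * v
    δ = R * κ + + 25 ℚ./ 8 - + 9 ℚ./ 22 * (v * v)

  -- The tight estimate, for the extremal family

  s₀ : ℕ → ℕ → ℚ
  s₀ w h = + 1 ℚ./ 64 * (ι (rootTop w h) * 1/suc (2 ℕ.* h))

  -- The excess of (8 s₀ + 1)² over 16 (2 h + 1)² + 33 + 4 w, divided by 32. It is the strict margin
  -- of the tight estimate.
  slack : ℕ → ℕ → ℚ
  slack w h = + 1 ℚ./ 2048 * ((ι (33 ℕ.+ 4 ℕ.* w) * 1/suc (2 ℕ.* h)) * (ι (33 ℕ.+ 4 ℕ.* w) * 1/suc (2 ℕ.* h)))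

  0<slack : ∀ w h → 0ℚ < slack w h
  0<slack w h = 0<* (ℚ.positive⁻¹ (+ 1 ℚ./ 2048)) (0<* 0<Ni 0<Ni)
    where
    0<Ni : 0ℚ < ι (33 ℕ.+ 4 ℕ.* w) * 1/suc (2 ℕ.* h)
    0<Ni = 0<* (ι-mono-< 0 (33 ℕ.+ 4 ℕ.* w) (ℕ.s≤s ℕ.z≤n)) (0<1/suc (2 ℕ.* h))

  -- By the choice of s₀ and β, the bound at S = s₀ exceeds B + `slack` by exactly (2 u + w)/2 - ρ
  -- (s₀ - κ), and the condition on V makes this nonnegative. The size of n gives S ≥ s₀, and from
  -- s₀ on the bound increases: its difference quotient 2 (S + s₀) + 1/2 - ρ is positive.
  boundAt-tight : ∀ w κ β h u B n V d .{{_ : NonZero d}} →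
    w ℕ.≤ 9 → 1 ℕ.≤ h →
    β ≡ ½ + + 3 ℚ./ 8 * ι w →
    B ℕ.+ u ≡ 2 ℕ.* (h ℕ.* h ℕ.+ h ℕ.+ 1) →
    4 ℕ.* rootTop w h ℕ.^ 8 ℕ.≤ n ℕ.* (64 ℕ.* suc (2 ℕ.* h)) ℕ.^ 8 →
    ι d * (s₀ w h - κ) ≡ ι V * 1/suc (2 ℕ.* h) →
    4 ℕ.* w ℕ.* (V ℕ.* V) ℕ.≤ (2 ℕ.* u ℕ.+ w) ℕ.* (2 ℕ.* u ℕ.+ w) ℕ.* ((d ℕ.* suc (2 ℕ.* h)) ℕ.* (d ℕ.* suc (2 ℕ.* h))) →
    ∀ S ρ → 0ℚ ≤ S → 0ℚ ≤ ρ → ρ * ρ ≤ ι w → ι n ≤ S ^ 8 * ι 4 →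
    ι B + slack w h ≤ boundAt κ β S ρ
  boundAt-tight w κ β h u B n V d w≤9 1≤h β≡ B+u≡2p n-large V≡ V-small S ρ 0≤S 0≤ρ ρ²≤w n≤4S⁸ =
    ≤-diff ((S - s₀ w h) * (ι 2 * (S - s₀ w h) + (ι 4 * s₀ w h - ρ) + ½) + (½ * Y - ρ * (s₀ w h - κ)))
      (0≤+ (0≤* (0≤-diff s₀≤S) (0≤+ (0≤+ (0≤* (0≤ι 2) (0≤-diff s₀≤S)) (0≤-diff ρ≤4s₀)) (ℚ.nonNegative⁻¹ ½)))
           (0≤-diff ρ[s₀-κ]≤Y/2))
      identity
    where
    g = suc (2 ℕ.* h)
    T = rootTop w h
    i = 1/suc (2 ℕ.* h)
    Y = ι (2 ℕ.* u ℕ.+ w)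
    0≤i = ℚ.<⇒≤ (0<1/suc (2 ℕ.* h))

    gi≡1 : ι g * i ≡ 1ℚ
    gi≡1 = ι*1/suc≡1 (2 ℕ.* h)

    g≡ : ι g ≡ 1ℚ + ι 2 * ι h
    g≡ = trans (ι-+ 1 (2 ℕ.* h)) (cong (λ z → 1ℚ + z) (ι-* 2 h))

    N≡ : ι (33 ℕ.+ 4 ℕ.* w) ≡ ι 33 + ι 4 * ι w
    N≡ = trans (ι-+ 33 (4 ℕ.* w)) (cong (λ z → ι 33 + z) (ι-* 4 w))

    T≡ : T ≡ (32 ℕ.* (2 ℕ.* h) ℕ.+ 24) ℕ.* g ℕ.+ (33 ℕ.+ 4 ℕ.* w)
    T≡ = expand h w
      where
      expand : ∀ h w → 128 ℕ.* (h ℕ.* h) ℕ.+ 112 ℕ.* h ℕ.+ (57 ℕ.+ 4 ℕ.* w)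
               ≡ (32 ℕ.* (2 ℕ.* h) ℕ.+ 24) ℕ.* (1 ℕ.+ 2 ℕ.* h) ℕ.+ (33 ℕ.+ 4 ℕ.* w)
      expand = solve-∀

    s₀≡ : s₀ w h ≡ + 1 ℚ./ 64 * (ι 64 * ι h + ι 24 + (ι 33 + ι 4 * ι w) * i)
    s₀≡ = cong (+ 1 ℚ./ 64 *_) (begin-equality
      ι T * i                                       ≡⟨ cong (λ z → ι z * i) T≡ ⟩
      ι (q ℕ.* g ℕ.+ (33 ℕ.+ 4 ℕ.* w)) * i          ≡⟨ cong (_* i) (ι-+ (q ℕ.* g) (33 ℕ.+ 4 ℕ.* w)) ⟩
      (ι (q ℕ.* g) + ι (33 ℕ.+ 4 ℕ.* w)) * i        ≡⟨ cong₂ (λ y z → (y + z) * i) (ι-* q g) N≡ ⟩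
      (ι q * ι g + (ι 33 + ι 4 * ι w)) * i
        ≡⟨ solve 4 (λ q g z i → (q :* g :+ z) :* i := q :* (g :* i) :+ z :* i) refl (ι q) (ι g) (ι 33 + ι 4 * ι w) i ⟩
      ι q * (ι g * i) + (ι 33 + ι 4 * ι w) * i      ≡⟨ cong (λ z → ι q * z + (ι 33 + ι 4 * ι w) * i) gi≡1 ⟩
      ι q * 1ℚ + (ι 33 + ι 4 * ι w) * i             ≡⟨ cong (_+ (ι 33 + ι 4 * ι w) * i) (ℚ.*-identityʳ (ι q)) ⟩
      ι q + (ι 33 + ι 4 * ι w) * i                  ≡⟨ cong (_+ (ι 33 + ι 4 * ι w) * i) q≡ ⟩
      ι 64 * ι h + ι 24 + (ι 33 + ι 4 * ι w) * i    ∎)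
      where
      q = 32 ℕ.* (2 ℕ.* h) ℕ.+ 24
      q≡ : ι q ≡ ι 64 * ι h + ι 24
      q≡ = trans (ι-+ (32 ℕ.* (2 ℕ.* h)) 24) (cong (_+ ι 24)
        (trans (cong ι (sym (ℕ.*-assoc 32 2 h))) (ι-* 64 h)))

    T≤64gS : ι T ≤ ι (64 ℕ.* g) * S
    T≤64gS = ^8-cancel-≤ (0≤* (0≤ι (64 ℕ.* g)) 0≤S) (ℚ.*-cancelˡ-≤-pos (ι 4) (begin
      ι 4 * ι T ^ 8                     ≡⟨ trans (ι-* 4 (T ℕ.^ 8)) (cong (ι 4 *_) (ι-^ T 8)) ⟨
      ι (4 ℕ.* T ℕ.^ 8)                 ≤⟨ ι-mono-≤ _ _ n-large ⟩
      ι (n ℕ.* (64 ℕ.* g) ℕ.^ 8)        ≡⟨ trans (ι-* n _) (cong (ι n *_) (ι-^ (64 ℕ.* g) 8)) ⟩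
      ι n * ι (64 ℕ.* g) ^ 8            ≤⟨ *-mono-≤ (0≤ι n) n≤4S⁸ (0≤^ (0≤ι (64 ℕ.* g)) 8) ℚ.≤-refl ⟩
      S ^ 8 * ι 4 * ι (64 ℕ.* g) ^ 8
        ≡⟨ solve 3 (λ x y z → x :* y :* z := y :* (z :* x)) refl (S ^ 8) (ι 4) (ι (64 ℕ.* g) ^ 8) ⟩
      ι 4 * (ι (64 ℕ.* g) ^ 8 * S ^ 8)  ≡⟨ cong (ι 4 *_) (ℚ^.^-distrib-* (ι (64 ℕ.* g)) S 8) ⟨
      ι 4 * (ι (64 ℕ.* g) * S) ^ 8      ∎))

    s₀≤S : s₀ w h ≤ S
    s₀≤S = begin
      + 1 ℚ./ 64 * (ι T * i)                    ≤⟨ ℚ.*-monoˡ-≤-nonNeg (+ 1 ℚ./ 64) (*-mono-≤ (0≤ι T) T≤64gS 0≤i ℚ.≤-refl) ⟩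
      + 1 ℚ./ 64 * (ι (64 ℕ.* g) * S * i)       ≡⟨ cong (λ z → + 1 ℚ./ 64 * (z * S * i)) (ι-* 64 g) ⟩
      + 1 ℚ./ 64 * (ι 64 * ι g * S * i)
        ≡⟨ solve 3 (λ g S i → con (+ 1 ℚ./ 64) :* (con (ι 64) :* g :* S :* i) := (g :* i) :* S) refl (ι g) S i ⟩
      ι g * i * S                               ≡⟨ cong (_* S) gi≡1 ⟩
      1ℚ * S                                    ≡⟨ ℚ.*-identityˡ S ⟩
      S                                         ∎

    1≤s₀ : 1ℚ ≤ s₀ w h
    1≤s₀ = begin
      1ℚ                                   ≡⟨⟩
      + 1 ℚ./ 64 * (ι 64 * 1ℚ + ι 0)       ≤⟨ ℚ.*-monoˡ-≤-nonNeg (+ 1 ℚ./ 64) (ℚ.+-mono-≤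
                                               (ℚ.≤-trans (ℚ.*-monoˡ-≤-nonNeg (ι 64) (ι-mono-≤ 1 h 1≤h))
                                                 (≤-diff (ι 24) (0≤ι 24) refl))
                                               (0≤* (0≤+ (0≤ι 33) (0≤* (0≤ι 4) (0≤ι w))) 0≤i)) ⟩
      + 1 ℚ./ 64 * (ι 64 * ι h + ι 24 + (ι 33 + ι 4 * ι w) * i) ≡⟨ s₀≡ ⟨
      s₀ w h                               ∎

    ρ≤4s₀ : ρ ≤ ι 4 * s₀ w h
    ρ≤4s₀ = begin
      ρ             ≤⟨ ²-cancel-≤ {b = ι 3} (0≤ι 3) (ℚ.≤-trans ρ²≤w (ι-mono-≤ w 9 w≤9)) ⟩
      ι 3           ≤⟨ ι-mono-≤ 3 4 (ℕ.n≤1+n 3) ⟩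
      ι 4 * 1ℚ      ≤⟨ ℚ.*-monoˡ-≤-nonNeg (ι 4) 1≤s₀ ⟩
      ι 4 * s₀ w h  ∎

    2ρVi≤Yd : ι 2 * ρ * (ι V * i) ≤ Y * ι d
    2ρVi≤Yd = ²-cancel-≤ (0≤* (0≤ι (2 ℕ.* u ℕ.+ w)) (0≤ι d)) (begin
      ι 2 * ρ * (ι V * i) * (ι 2 * ρ * (ι V * i))
        ≡⟨ solve 3 (λ ρ V i → con (ι 2) :* ρ :* (V :* i) :* (con (ι 2) :* ρ :* (V :* i))
             := (ρ :* ρ) :* (con (ι 4) :* (V :* V) :* (i :* i))) refl ρ (ι V) i ⟩
      ρ * ρ * (ι 4 * (ι V * ι V) * (i * i))
        ≤⟨ *-mono-≤ (0≤² ρ) ρ²≤w (0≤* (0≤* (0≤ι 4) (0≤² (ι V))) (0≤² i)) ℚ.≤-refl ⟩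
      ι w * (ι 4 * (ι V * ι V) * (i * i))
        ≡⟨ solve 3 (λ w V i → w :* (con (ι 4) :* V :* i) := con (ι 4) :* w :* V :* i) refl (ι w) (ι V * ι V) (i * i) ⟩
      ι 4 * ι w * (ι V * ι V) * (i * i)
        ≡⟨ cong (_* (i * i)) (trans (ι-* (4 ℕ.* w) (V ℕ.* V)) (cong₂ _*_ (ι-* 4 w) (ι-* V V))) ⟨
      ι (4 ℕ.* w ℕ.* (V ℕ.* V)) * (i * i)
        ≤⟨ *-mono-≤ (0≤ι (4 ℕ.* w ℕ.* (V ℕ.* V))) (ι-mono-≤ _ _ V-small) (0≤² i) ℚ.≤-refl ⟩
      ι (y ℕ.* y ℕ.* ((d ℕ.* g) ℕ.* (d ℕ.* g))) * (i * i)
        ≡⟨ cong (_* (i * i)) (trans (ι-* (y ℕ.* y) ((d ℕ.* g) ℕ.* (d ℕ.* g)))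
             (cong₂ _*_ (ι-* y y) (trans (ι-* (d ℕ.* g) (d ℕ.* g)) (cong₂ _*_ (ι-* d g) (ι-* d g))))) ⟩
      Y * Y * ((ι d * ι g) * (ι d * ι g)) * (i * i)
        ≡⟨ solve 4 (λ Y d g i → Y :* Y :* ((d :* g) :* (d :* g)) :* (i :* i)
             := (Y :* d :* (g :* i)) :* (Y :* d :* (g :* i))) refl Y (ι d) (ι g) i ⟩
      (Y * ι d * (ι g * i)) * (Y * ι d * (ι g * i))
        ≡⟨ cong (λ z → z * z) (trans (cong (Y * ι d *_) gi≡1) (ℚ.*-identityʳ (Y * ι d))) ⟩
      (Y * ι d) * (Y * ι d) ∎)
      where y = 2 ℕ.* u ℕ.+ w

    ρ[s₀-κ]≤Y/2 : ρ * (s₀ w h - κ) ≤ ½ * Y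
    ρ[s₀-κ]≤Y/2 = ℚ.*-cancelˡ-≤-pos (ι 2 * ι d)
      {{ℚ.positive (0<* (ℚ.positive⁻¹ (ι 2)) (ι-mono-< 0 d (ℕ.>-nonZero⁻¹ d)))}} (begin
        ι 2 * ι d * (ρ * (s₀ w h - κ))
          ≡⟨ solve 3 (λ d ρ z → con (ι 2) :* d :* (ρ :* z) := con (ι 2) :* ρ :* (d :* z)) refl (ι d) ρ (s₀ w h - κ) ⟩
        ι 2 * ρ * (ι d * (s₀ w h - κ))  ≡⟨ cong (ι 2 * ρ *_) V≡ ⟩
        ι 2 * ρ * (ι V * i)             ≤⟨ 2ρVi≤Yd ⟩
        Y * ι d                         ≡⟨ solve 2 (λ Y d → Y :* d := con (ι 2) :* d :* (con ½ :* Y)) refl Y (ι d) ⟩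
        ι 2 * ι d * (½ * Y)             ∎)

    B≡ : ι B ≡ ι 2 * (ι h * ι h + ι h + 1ℚ) - ι u
    B≡ = begin-equality
      ι B                ≡⟨ solve 2 (λ b u → b := b :+ u :- u) refl (ι B) (ι u) ⟩
      ι B + ι u - ι u    ≡⟨ cong (_- ι u) (ι-+ B u) ⟨
      ι (B ℕ.+ u) - ι u  ≡⟨ cong (λ z → ι z - ι u) B+u≡2p ⟩
      ι (2 ℕ.* (h ℕ.* h ℕ.+ h ℕ.+ 1)) - ι u
        ≡⟨ cong (_- ι u) (trans (ι-* 2 (h ℕ.* h ℕ.+ h ℕ.+ 1)) (cong (ι 2 *_)
             (trans (ι-+ (h ℕ.* h ℕ.+ h) 1) (cong (_+ 1ℚ) (trans (ι-+ (h ℕ.* h) h) (cong (_+ ι h) (ι-* h h))))))) ⟩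
      ι 2 * (ι h * ι h + ι h + 1ℚ) - ι u ∎

    Y≡ : Y ≡ ι 2 * ι u + ι w
    Y≡ = trans (ι-+ (2 ℕ.* u) w) (cong (_+ ι w) (ι-* 2 u))

    -- The expansion uses (2 h + 1) i = 1 once, in the cross term of (8 s₀ + 1)².
    expansion : ∀ S ρ κ H U W i → (1ℚ + ι 2 * H) * i ≡ 1ℚ →
      let s = + 1 ℚ./ 64 * (ι 64 * H + ι 24 + (ι 33 + ι 4 * W) * i)
          Ni = (ι 33 + ι 4 * W) * i
      in ι 2 * (H * H + H + 1ℚ) - U + + 1 ℚ./ 2048 * (Ni * Ni)
         + ((S - s) * (ι 2 * (S - s) + (ι 4 * s - ρ) + ½) + (½ * (ι 2 * U + W) - ρ * (s - κ)))
         ≡ boundAt κ (½ + + 3 ℚ./ 8 * W) S ρ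
    expansion S ρ κ H U W i gi≡1 = trans
      (solve 7 (λ S ρ κ H U W i →
        let N  = con (ι 33) :+ con (ι 4) :* W
            s  = con (+ 1 ℚ./ 64) :* (con (ι 64) :* H :+ con (ι 24) :+ N :* i)
        in con (ι 2) :* (H :* H :+ H :+ con 1ℚ) :- U :+ con (+ 1 ℚ./ 2048) :* ((N :* i) :* (N :* i))
           :+ ((S :- s) :* (con (ι 2) :* (S :- s) :+ (con (ι 4) :* s :- ρ) :+ con ½)
               :+ (con ½ :* (con (ι 2) :* U :+ W) :- ρ :* (s :- κ)))
           := con (ι 2) :* (S :* S) :+ con ½ :* S :- ρ :* (S :- κ) :+ (con ½ :+ con (+ 3 ℚ./ 8) :* W)
              :+ con (+ 1 ℚ./ 32) :* N :* (con 1ℚ :- (con 1ℚ :+ con (ι 2) :* H) :* i))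
        refl S ρ κ H U W i)
      (trans (cong (λ z → boundAt κ (½ + + 3 ℚ./ 8 * W) S ρ + + 1 ℚ./ 32 * (ι 33 + ι 4 * W) * (1ℚ - z)) gi≡1)
        (solve 2 (λ x y → x :+ y :* (con 1ℚ :- con 1ℚ) := x) refl
          (boundAt κ (½ + + 3 ℚ./ 8 * W) S ρ) (+ 1 ℚ./ 32 * (ι 33 + ι 4 * W))))

    identity : ι B + slack w h
      + ((S - s₀ w h) * (ι 2 * (S - s₀ w h) + (ι 4 * s₀ w h - ρ) + ½) + (½ * Y - ρ * (s₀ w h - κ)))
      ≡ boundAt κ β S ρ
    identity = trans
      (cong₂ _+_ (cong₂ (λ b z → b + + 1 ℚ./ 2048 * ((z * i) * (z * i))) B≡ N≡)
        (cong₂ (λ s y → (S - s) * (ι 2 * (S - s) + (ι 4 * s - ρ) + ½) + (½ * y - ρ * (s - κ))) s₀≡ Y≡))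
      (trans (expansion S ρ κ (ι h) (ι u) (ι w) i (trans (cong (_* i) (sym g≡)) gi≡1))
        (cong (λ z → boundAt κ z S ρ) (sym β≡)))

  -- 192 is the least common multiple of the denominators 64 and 24. With κ = 3/8 - 1/3, s₀ - κ
  -- begins with h + 1/3, as does (2 u + 3)/(2 √3) when w = 3.
  s₀-κ₃ : ∀ h → ι 192 * (s₀ 3 h - + 1 ℚ./ 24) ≡ ι (384 ℕ.* (h ℕ.* h) ℕ.+ 320 ℕ.* h ℕ.+ 199) * 1/suc (2 ℕ.* h)
  s₀-κ₃ h = begin-equality
    ι 192 * (+ 1 ℚ./ 64 * (ι T * i) - + 1 ℚ./ 24)
      ≡⟨ solve 2 (λ T i → con (ι 192) :* (con (+ 1 ℚ./ 64) :* (T :* i) :- con (+ 1 ℚ./ 24))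
           := con (ι 3) :* T :* i :- con (ι 8) :* con 1ℚ) refl (ι T) i ⟩
    ι 3 * ι T * i - ι 8 * 1ℚ
      ≡⟨ cong₂ (λ y z → y * i - ι 8 * z) (trans (sym (ι-* 3 T)) (trans (cong ι (expand h))
           (trans (ι-+ V (8 ℕ.* g)) (cong (λ z → ι V + z) (ι-* 8 g))))) (sym (ι*1/suc≡1 (2 ℕ.* h))) ⟩
    (ι V + ι 8 * ι g) * i - ι 8 * (ι g * i)
      ≡⟨ solve 3 (λ V g i → (V :+ con (ι 8) :* g) :* i :- con (ι 8) :* (g :* i) := V :* i) refl (ι V) (ι g) i ⟩
    ι V * i ∎
    where
    i = 1/suc (2 ℕ.* h)
    g = suc (2 ℕ.* h)
    T = rootTop 3 h
    V = 384 ℕ.* (h ℕ.* h) ℕ.+ 320 ℕ.* h ℕ.+ 199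
    expand : ∀ h → 3 ℕ.* (128 ℕ.* (h ℕ.* h) ℕ.+ 112 ℕ.* h ℕ.+ 69) ≡ 384 ℕ.* (h ℕ.* h) ℕ.+ 320 ℕ.* h ℕ.+ 199 ℕ.+ 8 ℕ.* (1 ℕ.+ 2 ℕ.* h)
    expand = solve-∀

  -- 448 is the least common multiple of 64 and 56. With κ = 3/8 - 3/7, s₀ - κ begins with h + 3/7,
  -- as does (2 u + 7)/(2 √7) when w = 7.
  s₀-κ₇ : ∀ h → ι 448 * (s₀ 7 h - ℤ.-[1+ 2 ] ℚ./ 56) ≡ ι (896 ℕ.* (h ℕ.* h) ℕ.+ 832 ℕ.* h ℕ.+ 619) * 1/suc (2 ℕ.* h)
  s₀-κ₇ h = begin-equality
    ι 448 * (+ 1 ℚ./ 64 * (ι T * i) - ℤ.-[1+ 2 ] ℚ./ 56)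
      ≡⟨ solve 2 (λ T i → con (ι 448) :* (con (+ 1 ℚ./ 64) :* (T :* i) :- con (ℤ.-[1+ 2 ] ℚ./ 56))
           := con (ι 7) :* T :* i :+ con (ι 24) :* con 1ℚ) refl (ι T) i ⟩
    ι 7 * ι T * i + ι 24 * 1ℚ
      ≡⟨ cong (λ z → ι 7 * ι T * i + ι 24 * z) (sym (ι*1/suc≡1 (2 ℕ.* h))) ⟩
    ι 7 * ι T * i + ι 24 * (ι g * i)
      ≡⟨ solve 3 (λ T g i → con (ι 7) :* T :* i :+ con (ι 24) :* (g :* i) := (con (ι 7) :* T :+ con (ι 24) :* g) :* i) refl (ι T) (ι g) i ⟩
    (ι 7 * ι T + ι 24 * ι g) * i
      ≡⟨ cong (_* i) (trans (cong₂ _+_ (sym (ι-* 7 T)) (sym (ι-* 24 g)))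
           (trans (sym (ι-+ (7 ℕ.* T) (24 ℕ.* g))) (cong ι (expand h)))) ⟩
    ι V * i ∎
    where
    i = 1/suc (2 ℕ.* h)
    g = suc (2 ℕ.* h)
    T = rootTop 7 h
    V = 896 ℕ.* (h ℕ.* h) ℕ.+ 832 ℕ.* h ℕ.+ 619
    expand : ∀ h → 7 ℕ.* (128 ℕ.* (h ℕ.* h) ℕ.+ 112 ℕ.* h ℕ.+ 85) ℕ.+ 24 ℕ.* (1 ℕ.+ 2 ℕ.* h) ≡ 896 ℕ.* (h ℕ.* h) ℕ.+ 832 ℕ.* h ℕ.+ 619
    expand = solve-∀

module _ where
  open import Data.Nat using (_+_; _*_; _^_; _≤_; _<_; _≤ᵇ_; _%_)

  -- Comparison of polynomials by coefficients

  infixl 6 _⊕_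
  infixl 7 _⊗_
  infixr 8 _⊛_

  -- A syntax makes the coefficients computable, so that an inequality of high degree becomes a
  -- Boolean check on two lists of numerals. The same syntax later serves for congruences.
  data Poly : Set where
    X   : Poly
    const : ℕ → Poly
    _⊕_ : Poly → Poly → Poly
    _⊗_ : Poly → Poly → Poly
    _⊛_ : Poly → ℕ → Poly

  ⟦_⟧ : Poly → ℕ → ℕ
  ⟦ X     ⟧ x = x
  ⟦ const a   ⟧ x = a
  ⟦ p ⊕ q ⟧ x = ⟦ p ⟧ x + ⟦ q ⟧ x
  ⟦ p ⊗ q ⟧ x = ⟦ p ⟧ x * ⟦ q ⟧ x
  ⟦ p ⊛ k ⟧ x = ⟦ p ⟧ x ^ k

  -- Coefficient lists start with the constant term.
  eval : List ℕ → ℕ → ℕ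
  eval []       x = 0
  eval (a ∷ as) x = a + x * eval as x

  _+ₗ_ : List ℕ → List ℕ → List ℕ
  []       +ₗ bs       = bs
  as       +ₗ []       = as
  (a ∷ as) +ₗ (b ∷ bs) = a + b ∷ as +ₗ bs

  _·ₗ_ : ℕ → List ℕ → List ℕ
  a ·ₗ []       = []
  a ·ₗ (b ∷ bs) = a * b ∷ a ·ₗ bs

  _*ₗ_ : List ℕ → List ℕ → List ℕ
  []       *ₗ bs = []
  (a ∷ as) *ₗ bs = (a ·ₗ bs) +ₗ (0 ∷ as *ₗ bs)

  _^ₗ_ : List ℕ → ℕ → List ℕ
  as ^ₗ zero  = 1 ∷ []
  as ^ₗ suc k = as *ₗ (as ^ₗ k)

  coeffs : Poly → List ℕ
  coeffs X       = 0 ∷ 1 ∷ []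
  coeffs (const a)   = a ∷ []
  coeffs (p ⊕ q) = coeffs p +ₗ coeffs q
  coeffs (p ⊗ q) = coeffs p *ₗ coeffs q
  coeffs (p ⊛ k) = coeffs p ^ₗ k

  eval-+ₗ : ∀ as bs x → eval (as +ₗ bs) x ≡ eval as x + eval bs x
  eval-+ₗ []       bs       x = refl
  eval-+ₗ (a ∷ as) []       x = sym (ℕ.+-identityʳ _)
  eval-+ₗ (a ∷ as) (b ∷ bs) x = trans (cong (λ z → a + b + x * z) (eval-+ₗ as bs x))
    (distribute a b x (eval as x) (eval bs x))
    where
    distribute : ∀ a b x y z → a + b + x * (y + z) ≡ a + x * y + (b + x * z)
    distribute = solve-∀

  eval-·ₗ : ∀ a bs x → eval (a ·ₗ bs) x ≡ a * eval bs x
  eval-·ₗ a []       x = sym (ℕ.*-zeroʳ a)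
  eval-·ₗ a (b ∷ bs) x = trans (cong (λ z → a * b + x * z) (eval-·ₗ a bs x))
    (distribute a b x (eval bs x))
    where
    distribute : ∀ a b x y → a * b + x * (a * y) ≡ a * (b + x * y)
    distribute = solve-∀

  eval-*ₗ : ∀ as bs x → eval (as *ₗ bs) x ≡ eval as x * eval bs x
  eval-*ₗ []       bs x = refl
  eval-*ₗ (a ∷ as) bs x = trans (eval-+ₗ (a ·ₗ bs) (0 ∷ as *ₗ bs) x)
    (trans (cong₂ (λ y z → y + x * z) (eval-·ₗ a bs x) (eval-*ₗ as bs x))
      (distribute a x (eval as x) (eval bs x)))
    where
    distribute : ∀ a x y z → a * z + x * (y * z) ≡ (a + x * y) * z
    distribute = solve-∀

  eval-^ₗ : ∀ as k x → eval (as ^ₗ k) x ≡ eval as x ^ k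
  eval-^ₗ as zero    x = cong suc (ℕ.*-zeroʳ x)
  eval-^ₗ as (suc k) x = trans (eval-*ₗ as (as ^ₗ k) x) (cong (eval as x *_) (eval-^ₗ as k x))

  eval-coeffs : ∀ p x → eval (coeffs p) x ≡ ⟦ p ⟧ x
  eval-coeffs X       x = ident x
    where
    ident : ∀ x → x * (1 + x * 0) ≡ x
    ident = solve-∀
  eval-coeffs (const a)   x = trans (cong (λ z → a + z) (ℕ.*-zeroʳ x)) (ℕ.+-identityʳ a)
  eval-coeffs (p ⊕ q) x = trans (eval-+ₗ (coeffs p) (coeffs q) x)
    (cong₂ _+_ (eval-coeffs p x) (eval-coeffs q x))
  eval-coeffs (p ⊗ q) x = trans (eval-*ₗ (coeffs p) (coeffs q) x)
    (cong₂ _*_ (eval-coeffs p x) (eval-coeffs q x))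
  eval-coeffs (p ⊛ k) x = trans (eval-^ₗ (coeffs p) k x) (cong (_^ k) (eval-coeffs p x))

  _≤ₗ_ : List ℕ → List ℕ → Bool
  []       ≤ₗ bs       = true
  (a ∷ as) ≤ₗ []       = false
  (a ∷ as) ≤ₗ (b ∷ bs) = (a ≤ᵇ b) ∧ (as ≤ₗ bs)

  eval-mono : ∀ as bs → Bool.T (as ≤ₗ bs) → ∀ x → eval as x ≤ eval bs x
  eval-mono []       bs       _  x = ℕ.z≤n
  eval-mono (a ∷ as) (b ∷ bs) le x with Equivalence.to T-∧ le
  ... | a≤b , as≤bs = ℕ.+-mono-≤ (ℕ.≤ᵇ⇒≤ a b a≤b) (ℕ.*-monoʳ-≤ x (eval-mono as bs as≤bs x))

  -- For closed polynomials the hidden argument reduces to the unit type, so evaluation alone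
  -- supplies it.
  poly-≤ : ∀ p q {_ : Bool.T (coeffs p ≤ₗ coeffs q)} x → ⟦ p ⟧ x ≤ ⟦ q ⟧ x
  poly-≤ p q {le} x = subst₂ _≤_ (eval-coeffs p x) (eval-coeffs q x) (eval-mono (coeffs p) (coeffs q) le x)

  -- Polynomial inequalities at the thresholds w = 3 and w = 7

  -- The product p q r when p = h² + h + 1 and B C = 4 p² + w p + h + 1, B + C = 4 p + w, H = h.
  pqr : ℕ → ℕ → ℕ
  pqr w h = let p = h * h + h + 1 in p * (h * h * (4 * (p * p) + w * p + (h + 1)) + h * (4 * p + w) + 1)

  rootTop-poly pqr-poly : ℕ → Poly → Poly
  rootTop-poly w h = const 128 ⊗ (h ⊗ h) ⊕ const 112 ⊗ h ⊕ (const 57 ⊕ const 4 ⊗ const w)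
  pqr-poly w h = p ⊗ (h ⊗ h ⊗ (const 4 ⊗ (p ⊗ p) ⊕ const w ⊗ p ⊕ (h ⊕ const 1)) ⊕ h ⊗ (const 4 ⊗ p ⊕ const w) ⊕ const 1)
    where p = h ⊗ h ⊕ h ⊕ const 1

  -- This is 4 s₀⁸ ≤ p q r without denominators. Both sides have the leading term 4 · 128⁸ h¹⁶, so
  -- the lower coefficients decide; `H` expresses h as a shift of the variable, after which they can
  -- be compared one by one.
  rootTop-small : ∀ w H {_ : Bool.T (coeffs (const 4 ⊗ rootTop-poly w H ⊛ 8) ≤ₗ
                                coeffs (pqr-poly w H ⊗ (const 64 ⊗ (const 1 ⊕ const 2 ⊗ H)) ⊛ 8))} x {h} →
    ⟦ H ⟧ x ≡ h → 4 * rootTop w h ^ 8 ≤ pqr w h * (64 * suc (2 * h)) ^ 8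
  rootTop-small w H {le} x refl = poly-≤
    (const 4 ⊗ rootTop-poly w H ⊛ 8) (pqr-poly w H ⊗ (const 64 ⊗ (const 1 ⊕ const 2 ⊗ H)) ⊛ 8) {le} x

  rootTop-small₃ : ∀ h → 2 ≤ h → 4 * rootTop 3 h ^ 8 ≤ pqr 3 h * (64 * suc (2 * h)) ^ 8
  rootTop-small₃ h 2≤h = rootTop-small 3 (const 2 ⊕ X) (h ℕ.∸ 2) (ℕ.m+[n∸m]≡n 2≤h)

  -- The inequality is false at h = 2; the range h < 4 is left to `extremal-small-crude`.
  rootTop-small₇ : ∀ h → 4 ≤ h → 4 * rootTop 7 h ^ 8 ≤ pqr 7 h * (64 * suc (2 * h)) ^ 8
  rootTop-small₇ h 4≤h = rootTop-small 7 (const 4 ⊕ X) (h ℕ.∸ 4) (ℕ.m+[n∸m]≡n 4≤h)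

  -- The hypothesis says (2 u + 3)² ≥ 12 h² + 8 h + 17, and the goal replaces the right side by 12
  -- (s₀ - κ)². Since 12 (h + 1/3)² = 12 h² + 8 h + 4/3, κ is just the shift for which the terms in
  -- h² and h agree.
  V-small₃ : ∀ h u → 3 * (h * h + h + 1) ≤ u * u + 3 * u + (h + 1) →
    let V = 384 * (h * h) + 320 * h + 199 ; y = 2 * u + 3 ; dg = 192 * suc (2 * h) in
    4 * 3 * (V * V) ≤ y * y * (dg * dg)
  V-small₃ h u le = ℕ.≤-trans
    (poly-≤ (const 12 ⊗ (V ⊗ V)) ((const 12 ⊗ (X ⊗ X) ⊕ const 8 ⊗ X ⊕ const 17) ⊗ (dg ⊗ dg)) h)
    (ℕ.*-monoˡ-≤ (192 * suc (2 * h) * (192 * suc (2 * h))) y²-large)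
    where
    V dg : Poly
    V = const 384 ⊗ (X ⊗ X) ⊕ const 320 ⊗ X ⊕ const 199
    dg = const 192 ⊗ (const 1 ⊕ const 2 ⊗ X)
    lhs : ∀ h → 4 * (3 * (h * h + h + 1)) + 9 ≡ 12 * (h * h) + 8 * h + 17 + 4 * (h + 1)
    lhs = solve-∀
    rhs : ∀ h u → 4 * (u * u + 3 * u + (h + 1)) + 9 ≡ (2 * u + 3) * (2 * u + 3) + 4 * (h + 1)
    rhs = solve-∀
    y²-large : 12 * (h * h) + 8 * h + 17 ≤ (2 * u + 3) * (2 * u + 3)
    y²-large = ℕ.+-cancelʳ-≤ (4 * (h + 1)) _ _
      (subst₂ _≤_ (lhs h) (rhs h u) (ℕ.+-monoˡ-≤ 9 (ℕ.*-monoʳ-≤ 4 le)))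

  V-small₇ : ∀ h u → 7 * (h * h + h + 1) ≤ u * u + 7 * u + (h + 1) →
    let V = 896 * (h * h) + 832 * h + 619 ; y = 2 * u + 7 ; dg = 448 * suc (2 * h) in
    4 * 7 * (V * V) ≤ y * y * (dg * dg)
  V-small₇ h u le = ℕ.≤-trans
    (poly-≤ (const 28 ⊗ (V ⊗ V)) ((const 28 ⊗ (X ⊗ X) ⊕ const 24 ⊗ X ⊕ const 73) ⊗ (dg ⊗ dg)) h)
    (ℕ.*-monoˡ-≤ (448 * suc (2 * h) * (448 * suc (2 * h))) y²-large)
    where
    V dg : Poly
    V = const 896 ⊗ (X ⊗ X) ⊕ const 832 ⊗ X ⊕ const 619
    dg = const 448 ⊗ (const 1 ⊕ const 2 ⊗ X)
    lhs : ∀ h → 4 * (7 * (h * h + h + 1)) + 49 ≡ 28 * (h * h) + 24 * h + 73 + 4 * (h + 1)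
    lhs = solve-∀
    rhs : ∀ h u → 4 * (u * u + 7 * u + (h + 1)) + 49 ≡ (2 * u + 7) * (2 * u + 7) + 4 * (h + 1)
    rhs = solve-∀
    y²-large : 28 * (h * h) + 24 * h + 73 ≤ (2 * u + 7) * (2 * u + 7)
    y²-large = ℕ.+-cancelʳ-≤ (4 * (h + 1)) _ _
      (subst₂ _≤_ (lhs h) (rhs h u) (ℕ.+-monoˡ-≤ 49 (ℕ.*-monoʳ-≤ 4 le)))

  tight₃ : ∀ n .{{_ : NonZero n}} h u B → 2 ≤ h → B + u ≡ 2 * (h * h + h + 1) →
    3 * (h * h + h + 1) ≤ u * u + 3 * u + (h + 1) → pqr 3 h ≤ n → fromℕ B ℝ.< bound₃ n
  tight₃ n h u B 2≤h B+u≡2p u-large n-large = bound₃-criterion n B (slack 3 h) (0<slack 3 h)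
    (boundAt-tight 3 (+ 1 ℚ./ 24) (+ 13 ℚ./ 8) h u B n (384 * (h * h) + 320 * h + 199) 192
      (ℕ.m≤m+n 3 6) (ℕ.≤-trans (ℕ.n≤1+n 1) 2≤h) refl B+u≡2p
      (ℕ.≤-trans (rootTop-small₃ h 2≤h) (ℕ.*-monoˡ-≤ ((64 * suc (2 * h)) ℕ.^ 8) n-large))
      (s₀-κ₃ h) (V-small₃ h u u-large))

  tight₇ : ∀ n .{{_ : NonZero n}} h u B → 4 ≤ h → B + u ≡ 2 * (h * h + h + 1) →
    7 * (h * h + h + 1) ≤ u * u + 7 * u + (h + 1) → pqr 7 h ≤ n → fromℕ B ℝ.< bound₇ n
  tight₇ n h u B 4≤h B+u≡2p u-large n-large = bound₇-criterion n B (slack 7 h) (0<slack 7 h)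
    (boundAt-tight 7 (ℤ.-[1+ 2 ] ℚ./ 56) (+ 25 ℚ./ 8) h u B n (896 * (h * h) + 832 * h + 619) 448
      (ℕ.m≤m+n 7 2) (ℕ.≤-trans (ℕ.m≤m+n 1 3) 4≤h) refl B+u≡2p
      (ℕ.≤-trans (rootTop-small₇ h 4≤h) (ℕ.*-monoˡ-≤ ((64 * suc (2 * h)) ℕ.^ 8) n-large))
      (s₀-κ₇ h) (V-small₇ h u u-large))

  -- Arithmetic of the parameters A, B, C, E

  record Parameters (n p q r H B : ℕ) : Set where
    field
      {A C E m k} : ℕ
      n≡      : n ≡ p * q * r
      p≡      : p ≡ suc (A * H)
      q≡      : q ≡ suc (B * H)
      r≡      : r ≡ suc (C * H)
      p<q     : p < q
      q<r     : q < r
      2∣H     : 2 ∣ H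
      0<AH    : 0 < A * H
      E*C≡    : E * C ≡ A * B * H + A + B
      m*B≡    : m * B ≡ p + E
      k*A≡    : k * A ≡ m + H
      2≤E     : 2 ≤ E
      E<p     : E < p
      coprime : Coprime A B

  -- Modulo p - 1, n - 1 is q r - 1 = (B C H + B + C) H, so A divides B C H + B + C. Multiplying by
  -- E and substituting for E C leaves B (B H + 1 + E) modulo A, and coprimality removes the factor
  -- B. The roles of A and B are then exchanged.
  reduce : ∀ {n p q r H A B C E} →
    n ≡ p * q * r → 1 < p → p < q → q < r →
    p ∸ 1 ≡ A * H → q ∸ 1 ≡ B * H → r ∸ 1 ≡ C * H →
    (p ∸ 1) ∣ (n ∸ 1) → (q ∸ 1) ∣ (n ∸ 1) → p * q ∸ 1 ≡ E * (r ∸ 1) → 2 ≤ E → 2 ∣ H →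
    (∀ {d} → d ∣ (p ∸ 1) → d ∣ (q ∸ 1) → d ∣ (r ∸ 1) → d ∣ H) →
    Parameters n p q r H B
  reduce {n} {suc p} {suc q} {suc r} {H} {A} {B} {C} {E} refl 1<p p<q q<r refl refl refl p∣ q∣ pq≡ 2≤E 2∣H greatest = record
    { A = A ; C = C ; E = E ; m = m ; k = quotient A∣m+H
    ; n≡ = refl ; p≡ = refl ; q≡ = refl ; r≡ = refl ; p<q = p<q ; q<r = q<r ; 2∣H = 2∣H
    ; 0<AH = ℕ.s<s⁻¹ 1<p ; E*C≡ = E*C≡
    ; m*B≡ = sym (_∣_.equality B∣) ; k*A≡ = sym (_∣_.equality A∣m+H)
    ; 2≤E = 2≤E ; E<p = E<p ; coprime = coprime }
    where
    instance
      H≢0 : NonZero H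
      H≢0 = ℕ.≢-nonZero λ { refl → contradiction (subst (0 <_) (ℕ.*-zeroʳ A) (ℕ.s<s⁻¹ 1<p)) (ℕ.<-irrefl refl) }

    A∣BCH+B+C : A ∣ B * C * H + B + C
    A∣BCH+B+C = *-cancelʳ-∣ H (subst (A * H ∣_) (factor B C H)
      (∣m+n∣m⇒∣n (subst (A * H ∣_) (split (A * H) (B * H) (C * H)) p∣) (m∣m*n (suc (B * H) * suc (C * H)))))
      where
      split : ∀ a b c → c + (b + a * (1 + b)) * (1 + c) ≡ a * ((1 + b) * (1 + c)) + (b * c + b + c)
      split = solve-∀
      factor : ∀ B C H → B * H * (C * H) + B * H + C * H ≡ (B * C * H + B + C) * H
      factor = solve-∀

    B∣ACH+A+C : B ∣ A * C * H + A + C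
    B∣ACH+A+C = *-cancelʳ-∣ H (subst (B * H ∣_) (factor A C H)
      (∣m+n∣m⇒∣n (subst (B * H ∣_) (split (A * H) (B * H) (C * H)) q∣) (m∣m*n (suc (A * H) * suc (C * H)))))
      where
      split : ∀ a b c → c + (b + a * (1 + b)) * (1 + c) ≡ b * ((1 + a) * (1 + c)) + (a * c + a + c)
      split = solve-∀
      factor : ∀ A C H → A * H * (C * H) + A * H + C * H ≡ (A * C * H + A + C) * H
      factor = solve-∀

    E*C≡ : E * C ≡ A * B * H + A + B
    E*C≡ = ℕ.*-cancelʳ-≡ (E * C) (A * B * H + A + B) H
      (trans (ℕ.*-assoc E C H) (trans (sym pq≡) (factor A B H)))
      where
      factor : ∀ A B H → B * H + A * H * (1 + B * H) ≡ (A * B * H + A + B) * H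
      factor = solve-∀

    -- A common divisor d of A and B also divides C, so d H divides the greatest common divisor H.
    coprime : Coprime A B
    coprime {d} (d∣A , d∣B) = ∣1⇒≡1 (*-cancelʳ-∣ H (subst (d * H ∣_) (sym (ℕ.*-identityˡ H))
      (greatest (*-monoˡ-∣ H d∣A) (*-monoˡ-∣ H d∣B) (*-monoˡ-∣ H d∣C))))
      where
      d∣C : d ∣ C
      d∣C = ∣m+n∣m⇒∣n (∣-trans d∣A A∣BCH+B+C) (∣m∣n⇒∣m+n (∣m⇒∣m*n H (∣m⇒∣m*n C d∣B)) d∣B)

    A∣BH+1+E : A ∣ B * H + 1 + E
    A∣BH+1+E = coprime-divisor coprime (∣m+n∣m⇒∣n
      (subst (A ∣_) (trans (regroup B C E H) (trans (cong (λ z → (B * H + 1) * z + E * B) E*C≡) (expand A B E H)))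
        (∣n⇒∣m*n E A∣BCH+B+C))
      (m∣m*n ((B * H + 1) * (B * H + 1))))
      where
      regroup : ∀ B C E H → E * (B * C * H + B + C) ≡ (B * H + 1) * (E * C) + E * B
      regroup = solve-∀
      expand : ∀ A B E H → (B * H + 1) * (A * B * H + A + B) + E * B ≡ A * ((B * H + 1) * (B * H + 1)) + B * (B * H + 1 + E)
      expand = solve-∀

    B∣ : B ∣ suc (A * H) + E
    B∣ = coprime-divisor (Coprimality.sym coprime) (∣m+n∣m⇒∣n
      (subst (B ∣_) (trans (regroup A C E H) (trans (cong (λ z → (A * H + 1) * z + E * A) E*C≡) (expand A B E H)))
        (∣n⇒∣m*n E B∣ACH+A+C))
      (m∣m*n ((A * H + 1) * (A * H + 1))))
      where
      regroup : ∀ A C E H → E * (A * C * H + A + C) ≡ (A * H + 1) * (E * C) + E * A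
      regroup = solve-∀
      expand : ∀ A B E H → (A * H + 1) * (A * B * H + A + B) + E * A ≡ B * ((A * H + 1) * (A * H + 1)) + A * (1 + A * H + E)
      expand = solve-∀

    m : ℕ
    m = quotient B∣

    A∣m+H : A ∣ m + H
    A∣m+H = coprime-divisor coprime (subst (A ∣_) eq (∣m∣n⇒∣m+n (m∣m*n H) A∣BH+1+E))
      where
      regroup : ∀ A B E H → A * H + (B * H + 1 + E) ≡ (1 + A * H + E) + B * H
      regroup = solve-∀
      eq : A * H + (B * H + 1 + E) ≡ B * (m + H)
      eq = trans (regroup A B E H) (trans (cong (_+ B * H) (_∣_.equality B∣))
        (trans (cong (_+ B * H) (ℕ.*-comm m B)) (sym (ℕ.*-distribˡ-+ B m H))))

    -- E q ≤ E (r - 1) = p q - 1 < p q.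
    E<p : E < suc (A * H)
    E<p = ℕ.*-cancelʳ-< (suc (B * H)) E (suc (A * H)) (ℕ.≤-<-trans
      (ℕ.≤-trans (ℕ.*-monoʳ-≤ E (ℕ.s≤s⁻¹ q<r)) (ℕ.≤-reflexive (sym pq≡)))
      (ℕ.n<1+n (B * H + A * H * suc (B * H))))

  2∣p∸1 : ∀ p → p ℕ.% 2 ≡ 1 → 2 ∣ (p ∸ 1)
  2∣p∸1 p p-odd = divides (p ℕ./ 2) (cong (_∸ 1) (trans (m≡m%n+[m/n]*n p 2) (cong (_+ p ℕ./ 2 * 2) p-odd)))

  parameters : ∀ {n} (k : K₃N n) → let open K₃N k in Parameters n p q r H B
  parameters {n} k = reduce {n} {p} {q} {r} {H} {quotient H∣p∸1} {B} {quotient H∣r∸1} {E} n≡pqr 1<p p<q q<r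
    (_∣_.equality H∣p∸1) (_∣_.equality H∣q∸1) (_∣_.equality H∣r∸1)
    p∸1∣n∸1 q∸1∣n∸1 (_∣_.equality (r∸1∣pq∸1 n≡pqr 1<p p<q q<r r∸1∣n∸1)) 2≤E
    (greatest (2∣p∸1 p p-odd) (2∣p∸1 q q-odd) (2∣p∸1 r r-odd)) greatest
    where
    open K₃N k
    H∣p∸1 : H ∣ (p ∸ 1)
    H∣p∸1 = ∣-trans (gcd[m,n]∣m (gcd (p ∸ 1) (q ∸ 1)) (r ∸ 1)) (gcd[m,n]∣m (p ∸ 1) (q ∸ 1))
    H∣r∸1 : H ∣ (r ∸ 1)
    H∣r∸1 = gcd[m,n]∣n (gcd (p ∸ 1) (q ∸ 1)) (r ∸ 1)
    greatest : ∀ {d} → d ∣ (p ∸ 1) → d ∣ (q ∸ 1) → d ∣ (r ∸ 1) → d ∣ H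
    greatest d∣p d∣q d∣r = gcd-greatest (gcd-greatest d∣p d∣q) d∣r

  -- The equation w (h² + h + 1) = u² + w u + h + 1 for small w

  poly-mod : ∀ M .{{_ : NonZero M}} P x → ⟦ P ⟧ x % M ≡ ⟦ P ⟧ (x % M) % M
  poly-mod M X       x = sym (m%n%n≡m%n x M)
  poly-mod M (const a)   x = refl
  poly-mod M (P ⊕ Q) x = trans (%-distribˡ-+ (⟦ P ⟧ x) (⟦ Q ⟧ x) M)
    (trans (cong₂ (λ y z → (y + z) % M) (poly-mod M P x) (poly-mod M Q x))
      (sym (%-distribˡ-+ (⟦ P ⟧ (x % M)) (⟦ Q ⟧ (x % M)) M)))
  poly-mod M (P ⊗ Q) x = trans (%-distribˡ-* (⟦ P ⟧ x) (⟦ Q ⟧ x) M)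
    (trans (cong₂ (λ y z → (y * z) % M) (poly-mod M P x) (poly-mod M Q x))
      (sym (%-distribˡ-* (⟦ P ⟧ (x % M)) (⟦ Q ⟧ (x % M)) M)))
  poly-mod M (P ⊛ k) x = power k
    where
    power : ∀ k → ⟦ P ⟧ x ^ k % M ≡ ⟦ P ⟧ (x % M) ^ k % M
    power zero    = refl
    power (suc k) = trans (%-distribˡ-* (⟦ P ⟧ x) (⟦ P ⟧ x ^ k) M)
      (trans (cong₂ (λ y z → (y * z) % M) (poly-mod M P x) (power k))
        (sym (%-distribˡ-* (⟦ P ⟧ (x % M)) (⟦ P ⟧ (x % M) ^ k) M)))

  -- Reduces an equation in two unknowns to finitely many residue pairs: R is empty when none
  -- survives, and otherwise records the survivors.
  residues-of-solution : ∀ M .{{_ : NonZero M}} P Q {R : ℕ → ℕ → Set} →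
    (∀ {i} → i < M → ∀ {j} → j < M → ⟦ P ⟧ i % M ≡ ⟦ Q ⟧ j % M → R i j) →
    ∀ x y → ⟦ P ⟧ x ≡ ⟦ Q ⟧ y → R (x % M) (y % M)
  residues-of-solution M P Q check x y eq = check (m%n<n x M) (m%n<n y M)
    (trans (sym (poly-mod M P x)) (trans (cong (_% M) eq) (poly-mod M Q y)))

  2mn≤m²+n² : ∀ m n → 2 * (m * n) ≤ m * m + n * n
  2mn≤m²+n² m n with ℕ.≤-total m n
  2mn≤m²+n² m n | inj₁ m≤n with ℕ.m≤n⇒∃[o]m+o≡n m≤n
  ... | o , refl = subst (2 * (m * (m + o)) ≤_) (expand m o) (ℕ.m≤m+n _ (o * o))
    where
    expand : ∀ m o → 2 * (m * (m + o)) + o * o ≡ m * m + (m + o) * (m + o)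
    expand = solve-∀
  2mn≤m²+n² m n | inj₂ n≤m with ℕ.m≤n⇒∃[o]m+o≡n n≤m
  ... | o , refl = subst (2 * ((n + o) * n) ≤_) (expand n o) (ℕ.m≤m+n _ (o * o))
    where
    expand : ∀ m o → 2 * ((m + o) * m) + o * o ≡ (m + o) * (m + o) + m * m
    expand = solve-∀

  ²-cancel-< : ∀ {m n} → m * m < n * n → m < n
  ²-cancel-< {m} {n} m²<n² with m ℕ.<? n
  ... | yes m<n = m<n
  ... | no  m≮n = contradiction m²<n² (ℕ.≤⇒≯ (ℕ.*-mono-≤ (ℕ.≮⇒≥ m≮n) (ℕ.≮⇒≥ m≮n)))

  -- For u > 0, u² + u lies strictly between u² and (u + 1)².
  no-solution-1 : ∀ h u → 0 < h → h * h ≢ u * u + u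
  no-solution-1 h u 0<h eq with h ℕ.≤? u
  ... | yes h≤u = contradiction eq (ℕ.<⇒≢ (begin-strict
    h * h      ≤⟨ ℕ.*-mono-≤ h≤u h≤u ⟩
    u * u      <⟨ ℕ.m<m+n (u * u) (ℕ.<-≤-trans 0<h h≤u) ⟩
    u * u + u  ∎))
    where open ℕ.≤-Reasoning
  ... | no  h≰u = contradiction (sym eq) (ℕ.<⇒≢ (begin-strict
    u * u + u        ≡⟨ ℕ.+-comm (u * u) u ⟩
    suc u * u        <⟨ ℕ.*-monoʳ-< (suc u) (ℕ.n<1+n u) ⟩
    suc u * suc u    ≤⟨ ℕ.*-mono-≤ (ℕ.≰⇒> h≰u) (ℕ.≰⇒> h≰u) ⟩
    h * h            ∎))
    where open ℕ.≤-Reasoning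

  -- Multiplied by 8, the equation reads (4 h + 1)² + 15 = 8 (u + 1)², so the squares of 4 h + 1 and
  -- u + 1 add up to 3 modulo 9. As -1 is not a square modulo 3, both numbers would be divisible by
  -- 3 and the sum would be 0.
  no-solution-2 : ∀ h u → 2 * (h * h) + h + 1 ≢ u * u + 2 * u
  no-solution-2 = residues-of-solution 9 P Q
    (from-yes (ℕ.allUpTo? (λ i → ℕ.allUpTo? (λ j → ¬? (⟦ P ⟧ i % 9 ℕ.≟ ⟦ Q ⟧ j % 9)) 9) 9))
    where
    P Q : Poly
    P = const 2 ⊗ (X ⊗ X) ⊕ X ⊕ const 1
    Q = X ⊗ X ⊕ const 2 ⊗ X

  -- (u + 2)² = 4 h² + 3 h + 7 lies strictly between (2 h)² and (2 h + 2)², hence equals (2 h + 1)²,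
  -- which is linear in h.
  solution-4 : ∀ h u → 0 < h → 4 * (h * h) + 3 * h + 3 ≡ u * u + 4 * u → h ≡ 6 × u ≡ 11
  solution-4 h u 0<h eq = h≡6 , ℕ.+-cancelʳ-≡ 2 u 11 (trans u+2≡2h+1 (cong (λ z → 2 * z + 1) h≡6))
    where
    square : (u + 2) * (u + 2) ≡ 4 * (h * h) + 3 * h + 7
    square = trans (complete u) (trans (cong (_+ 4) (sym eq)) (ℕ.+-assoc (4 * (h * h) + 3 * h) 3 4))
      where
      complete : ∀ u → (u + 2) * (u + 2) ≡ u * u + 4 * u + 4
      complete = solve-∀
    2h<u+2 : 2 * h < u + 2
    2h<u+2 = ²-cancel-< (subst ((2 * h) * (2 * h) <_) (trans (expand h) (sym square)) (ℕ.m<m+n _ (ℕ.s≤s ℕ.z≤n)))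
      where
      expand : ∀ h → (2 * h) * (2 * h) + (1 + (3 * h + 6)) ≡ 4 * (h * h) + 3 * h + 7
      expand = solve-∀
    u+2<2h+2 : u + 2 < 2 * h + 2
    u+2<2h+2 with ℕ.m≤n⇒∃[o]m+o≡n 0<h
    ... | k , refl = ²-cancel-< (subst₂ _<_ (sym square) (expand k) (ℕ.m<m+n _ (ℕ.s≤s ℕ.z≤n)))
      where
      expand : ∀ k → 4 * ((1 + k) * (1 + k)) + 3 * (1 + k) + 7 + (1 + (5 * k + 1)) ≡ (2 * (1 + k) + 2) * (2 * (1 + k) + 2)
      expand = solve-∀
    u+2≡2h+1 : u + 2 ≡ 2 * h + 1
    u+2≡2h+1 = ℕ.≤-antisym (ℕ.s≤s⁻¹ (subst (u + 2 <_) (ℕ.+-suc (2 * h) 1) u+2<2h+2))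
      (subst (_≤ u + 2) (ℕ.+-comm 1 (2 * h)) 2h<u+2)
    h≡6 : h ≡ 6
    h≡6 = ℕ.+-cancelˡ-≡ (4 * (h * h) + 3 * h + 1) h 6 (trans (expand h)
      (trans (cong (λ z → z * z) (sym u+2≡2h+1)) (trans square (sym (ℕ.+-assoc (4 * (h * h) + 3 * h) 1 6)))))
      where
      expand : ∀ h → 4 * (h * h) + 3 * h + 1 + h ≡ (2 * h + 1) * (2 * h + 1)
      expand = solve-∀

  -- Modulo 7 a solution has h ≡ u ≡ 1, and then the equation fails modulo 49.
  no-solution-5 : ∀ h u → 5 * (h * h) + 4 * h + 4 ≢ u * u + 5 * u
  no-solution-5 h u eq with residues-of-solution 7 P Q {λ i j → i ≡ 1 × j ≡ 1}
    (from-yes (ℕ.allUpTo? (λ i → ℕ.allUpTo? (λ j →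
      (⟦ P ⟧ i % 7 ℕ.≟ ⟦ Q ⟧ j % 7) →-dec (i ℕ.≟ 1 ×-dec j ℕ.≟ 1)) 7) 7)) h u eq
    where
    P Q : Poly
    P = const 5 ⊗ (X ⊗ X) ⊕ const 4 ⊗ X ⊕ const 4
    Q = X ⊗ X ⊕ const 5 ⊗ X
  -- With h = 1 + 7 a and u = 1 + 7 b both sides are 6 modulo 7. Removing 6 and dividing by 7 leaves
  -- 1 modulo 7 on the left and 0 on the right.
  ... | h%7≡1 , u%7≡1 = residues-of-solution 7 (const 35 ⊗ (X ⊗ X) ⊕ const 14 ⊗ X ⊕ const 1) (const 7 ⊗ (X ⊗ X ⊕ X))
    (from-yes (ℕ.allUpTo? (λ i → ℕ.allUpTo? (λ j →
      ¬? ((35 * (i * i) + 14 * i + 1) % 7 ℕ.≟ (7 * (j * j + j)) % 7)) 7) 7)) a b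
    (ℕ.*-cancelˡ-≡ _ _ 7 (ℕ.+-cancelʳ-≡ 6 _ _ (trans (l a) (trans eq₁ (r b)))))
    where
    a b : ℕ
    a = h ℕ./ 7
    b = u ℕ./ 7
    eq₁ : 5 * ((1 + a * 7) * (1 + a * 7)) + 4 * (1 + a * 7) + 4 ≡ (1 + b * 7) * (1 + b * 7) + 5 * (1 + b * 7)
    eq₁ = subst₂ (λ h u → 5 * (h * h) + 4 * h + 4 ≡ u * u + 5 * u)
      (trans (m≡m%n+[m/n]*n h 7) (cong (_+ a * 7) h%7≡1)) (trans (m≡m%n+[m/n]*n u 7) (cong (_+ b * 7) u%7≡1)) eq
    l : ∀ a → 7 * (35 * (a * a) + 14 * a + 1) + 6 ≡ 5 * ((1 + a * 7) * (1 + a * 7)) + 4 * (1 + a * 7) + 4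
    l = solve-∀
    r : ∀ b → (1 + b * 7) * (1 + b * 7) + 5 * (1 + b * 7) ≡ 7 * (7 * (b * b + b)) + 6
    r = solve-∀

  -- With x = 6 h + 2 and y = 2 u + 3 the equation of pell₃ is x² - 3 y² = -47, and step
  -- multiplies x + y √3 by the unit 7 + 4 √3.
  data Orbit₃ : ℕ → ℕ → Set where
    base : Orbit₃ 2 3
    step : ∀ {h u} → Orbit₃ h u → Orbit₃ (7 * h + 4 * u + 8) (12 * h + 7 * u + 13)

  pell₃-small : ∀ h u → h < 5 → 3 * (h * h) + 2 * h + 2 ≡ u * u + 3 * u → h ≡ 2 × u ≡ 3
  pell₃-small h u h<5 eq = from-yes (ℕ.allUpTo? (λ i → ℕ.allUpTo? (λ j →
      (3 * (i * i) + 2 * i + 2 ℕ.≟ j * j + 3 * j) →-dec (i ℕ.≟ 2 ×-dec j ℕ.≟ 3)) 10) 5) h<5 u<10 eq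
    where
    expand : ∀ h → 3 * (h * h) + 2 * h + 2 + (1 + (h * h + 6 * h + 1)) ≡ (2 * h + 2) * (2 * h + 2)
    expand = solve-∀
    u<10 : u < 10
    u<10 = ℕ.<-≤-trans
      (²-cancel-< (ℕ.≤-<-trans (ℕ.m≤m+n (u * u) (3 * u))
        (subst₂ _<_ eq (expand h) (ℕ.m<m+n _ (ℕ.s≤s ℕ.z≤n)))))
      (ℕ.+-monoˡ-≤ 2 (ℕ.*-monoʳ-≤ 2 (ℕ.s≤s⁻¹ h<5)))

  -- Makes the next value 7 h - 4 u - 4 of h a natural number. As u is about √3 h and 7² - 3 · 4² =
  -- 1, the quadratic margin is a single h², which absorbs the lower terms for h ≥ 5.
  descent₃-h : ∀ h u → 5 ≤ h → 3 * (h * h) + 2 * h + 2 ≡ u * u + 3 * u → 4 * u + 4 ≤ 7 * h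
  descent₃-h h u 5≤h eq with 4 * u + 4 ℕ.≤? 7 * h
  ... | yes le = le
  ... | no ¬le with ℕ.m≤n⇒∃[o]m+o≡n 5≤h | ℕ.m≤n⇒∃[o]m+o≡n (ℕ.≰⇒> ¬le)
  ...   | k , refl | d , 7h+1+d≡4u+4 = contradiction (trans (rhs k) (cong (16 *_) eq)) (ℕ.<⇒≢ (begin-strict
      48 * (k * k) + 512 * k + 1392
        <⟨ ℕ.m<m+n _ (ℕ.s≤s ℕ.z≤n) ⟩
      48 * (k * k) + 512 * k + 1392 + (1 + (k * k + 20 * k + 15 + 14 * (k * d) + d * d + 76 * d))
        ≡⟨ lhs k d ⟩
      (7 * k + 32 + d) * (7 * k + 32 + d) + 12 * (7 * k + 32 + d)
        ≡⟨ cong (λ z → z * z + 12 * z) 4u≡ ⟨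
      4 * u * (4 * u) + 12 * (4 * u)
        ≡⟨ mid u ⟩
      16 * (u * u + 3 * u) ∎))
    where
    open ℕ.≤-Reasoning
    4u≡ : 4 * u ≡ 7 * k + 32 + d
    4u≡ = ℕ.+-cancelʳ-≡ 4 (4 * u) (7 * k + 32 + d) (trans (sym 7h+1+d≡4u+4) (shift k d))
      where
      shift : ∀ k d → 1 + 7 * (5 + k) + d ≡ 7 * k + 32 + d + 4
      shift = solve-∀
    rhs : ∀ k → 48 * (k * k) + 512 * k + 1392 ≡ 16 * (3 * ((5 + k) * (5 + k)) + 2 * (5 + k) + 2)
    rhs = solve-∀
    lhs : ∀ k d → 48 * (k * k) + 512 * k + 1392 + (1 + (k * k + 20 * k + 15 + 14 * (k * d) + d * d + 76 * d))
          ≡ (7 * k + 32 + d) * (7 * k + 32 + d) + 12 * (7 * k + 32 + d)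
    lhs = solve-∀
    mid : ∀ u → 4 * u * (4 * u) + 12 * (4 * u) ≡ 16 * (u * u + 3 * u)
    mid = solve-∀

  -- Makes the next value 7 u + 5 - 12 h of u a natural number. The margin is 3 · 7² - 12² = 3, and
  -- 2 (2 u) ≤ u² + 4 absorbs the linear term.
  descent₃-u : ∀ h u → 3 * (h * h) + 2 * h + 2 ≡ u * u + 3 * u → 12 * h ≤ 7 * u + 5
  descent₃-u h u eq with 12 * h ℕ.≤? 7 * u + 5
  ... | yes le = le
  ... | no ¬le with ℕ.m≤n⇒∃[o]m+o≡n (ℕ.≰⇒> ¬le)
  ...   | d , 7u+6+d≡12h = contradiction (cong (144 *_) (sym eq)) (ℕ.<⇒≢ (begin-strict
      144 * (u * u + 3 * u)
        ≡⟨ lhs u ⟩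
      144 * (u * u) + 420 * u + 3 * (2 * (u * 2))
        ≤⟨ ℕ.+-monoʳ-≤ (144 * (u * u) + 420 * u) (ℕ.*-monoʳ-≤ 3 (2mn≤m²+n² u 2)) ⟩
      144 * (u * u) + 420 * u + 3 * (u * u + 4)
        <⟨ ℕ.m<m+n _ (ℕ.s≤s ℕ.z≤n) ⟩
      144 * (u * u) + 420 * u + 3 * (u * u + 4) + (1 + (527 + 42 * (u * d) + 3 * (d * d) + 60 * d))
        ≡⟨ mid u d ⟩
      3 * ((1 + (7 * u + 5) + d) * (1 + (7 * u + 5) + d)) + 24 * (1 + (7 * u + 5) + d) + 288
        ≡⟨ cong (λ z → 3 * (z * z) + 24 * z + 288) 7u+6+d≡12h ⟩
      3 * (12 * h * (12 * h)) + 24 * (12 * h) + 288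
        ≡⟨ rhs h ⟩
      144 * (3 * (h * h) + 2 * h + 2) ∎))
    where
    open ℕ.≤-Reasoning
    lhs : ∀ u → 144 * (u * u + 3 * u) ≡ 144 * (u * u) + 420 * u + 3 * (2 * (u * 2))
    lhs = solve-∀
    mid : ∀ u d → 144 * (u * u) + 420 * u + 3 * (u * u + 4) + (1 + (527 + 42 * (u * d) + 3 * (d * d) + 60 * d))
          ≡ 3 * ((1 + (7 * u + 5) + d) * (1 + (7 * u + 5) + d)) + 24 * (1 + (7 * u + 5) + d) + 288
    mid = solve-∀
    rhs : ∀ h → 3 * (12 * h * (12 * h)) + 24 * (12 * h) + 288 ≡ 144 * (3 * (h * h) + 2 * h + 2)
    rhs = solve-∀

  -- The inverse of `step` preserves the equation and lowers h until h < 5, where only (2, 3)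
  -- remains.
  pell₃ : ∀ h u → 3 * (h * h) + 2 * h + 2 ≡ u * u + 3 * u → Orbit₃ h u
  pell₃ = <-rec _ descend
    where
    descend : ∀ h → (∀ {h′} → h′ < h → ∀ u → 3 * (h′ * h′) + 2 * h′ + 2 ≡ u * u + 3 * u → Orbit₃ h′ u) →
              ∀ u → 3 * (h * h) + 2 * h + 2 ≡ u * u + 3 * u → Orbit₃ h u
    descend h rec u eq with h ℕ.<? 5
    ... | yes h<5 with pell₃-small h u h<5 eq
    ...   | refl , refl = base
    descend h rec u eq | no h≮5
      with ℕ.m≤n⇒∃[o]m+o≡n (descent₃-h h u (ℕ.≮⇒≥ h≮5) eq) | ℕ.m≤n⇒∃[o]m+o≡n (descent₃-u h u eq)
    ... | h′ , 4u+4+h′≡7h | u′ , 12h+u′≡7u+5 =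
      subst₂ Orbit₃ (sym h≡) (sym u≡) (step (rec h′<h u′ eq′))
      where
      h≡ : h ≡ 7 * h′ + 4 * u′ + 8
      h≡ = ℕ.+-cancelˡ-≡ (28 * u + 20 + 48 * h) h (7 * h′ + 4 * u′ + 8)
        (trans (l h u) (trans (cong₂ (λ y z → 7 * y + 4 * z) (sym 4u+4+h′≡7h) (sym 12h+u′≡7u+5)) (r h u h′ u′)))
        where
        l : ∀ h u → 28 * u + 20 + 48 * h + h ≡ 7 * (7 * h) + 4 * (7 * u + 5)
        l = solve-∀
        r : ∀ h u h′ u′ → 7 * (4 * u + 4 + h′) + 4 * (12 * h + u′) ≡ 28 * u + 20 + 48 * h + (7 * h′ + 4 * u′ + 8)
        r = solve-∀
      u≡ : u ≡ 12 * h′ + 7 * u′ + 13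
      u≡ = ℕ.+-cancelˡ-≡ (84 * h + 48 * u + 35) u (12 * h′ + 7 * u′ + 13)
        (trans (l h u) (trans (cong₂ (λ y z → 12 * y + 7 * z) (sym 4u+4+h′≡7h) (sym 12h+u′≡7u+5)) (r h u h′ u′)))
        where
        l : ∀ h u → 84 * h + 48 * u + 35 + u ≡ 12 * (7 * h) + 7 * (7 * u + 5)
        l = solve-∀
        r : ∀ h u h′ u′ → 12 * (4 * u + 4 + h′) + 7 * (12 * h + u′) ≡ 84 * h + 48 * u + 35 + (12 * h′ + 7 * u′ + 13)
        r = solve-∀
      h′<h : h′ < h
      h′<h = subst (h′ <_) (trans (l h′ u′) (sym h≡)) (ℕ.m<m+n h′ (ℕ.s≤s ℕ.z≤n))
        where
        l : ∀ h′ u′ → h′ + (1 + (6 * h′ + 4 * u′ + 7)) ≡ 7 * h′ + 4 * u′ + 8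
        l = solve-∀
      eq′ : 3 * (h′ * h′) + 2 * h′ + 2 ≡ u′ * u′ + 3 * u′
      eq′ = sym (ℕ.+-cancelˡ-≡ (3 * (h * h) + 2 * h + 2) (u′ * u′ + 3 * u′) (3 * (h′ * h′) + 2 * h′ + 2)
        (trans (subst₂ (λ h u → 3 * (h * h) + 2 * h + 2 + (u′ * u′ + 3 * u′) ≡ u * u + 3 * u + (3 * (h′ * h′) + 2 * h′ + 2))
          (sym h≡) (sym u≡) (invariant h′ u′)) (cong (_+ (3 * (h′ * h′) + 2 * h′ + 2)) (sym eq))))
        where
        invariant : ∀ h′ u′ → let h = 7 * h′ + 4 * u′ + 8 ; u = 12 * h′ + 7 * u′ + 13 in
          3 * (h * h) + 2 * h + 2 + (u′ * u′ + 3 * u′) ≡ u * u + 3 * u + (3 * (h′ * h′) + 2 * h′ + 2)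
        invariant = solve-∀

  data Residues₃ : ℕ → ℕ → Set where
    res-2-3 : ∀ a b → Residues₃ (7 * a + 2) (7 * b + 3)
    res-6-2 : ∀ a b → Residues₃ (7 * a + 6) (7 * b + 2)
    res-2-1 : ∀ a b → Residues₃ (7 * a + 2) (7 * b + 1)
    res-5-2 : ∀ a b → Residues₃ (7 * a + 5) (7 * b + 2)

  -- Modulo 7 the unit 7 + 4 √3 is 4 √3, whose fourth power is 1; the residues therefore repeat with
  -- period four.
  residues₃ : ∀ {h u} → Orbit₃ h u → Residues₃ h u
  residues₃ base = res-2-3 0 0
  residues₃ (step o) with residues₃ o
  ... | res-2-3 a b = subst₂ Residues₃ (hEq a b) (uEq a b) (res-6-2 (7 * a + 4 * b + 4) (12 * a + 7 * b + 8))
    where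
    hEq : ∀ a b → 7 * (7 * a + 4 * b + 4) + 6 ≡ 7 * (7 * a + 2) + 4 * (7 * b + 3) + 8
    hEq = solve-∀
    uEq : ∀ a b → 7 * (12 * a + 7 * b + 8) + 2 ≡ 12 * (7 * a + 2) + 7 * (7 * b + 3) + 13
    uEq = solve-∀
  ... | res-6-2 a b = subst₂ Residues₃ (hEq a b) (uEq a b) (res-2-1 (7 * a + 4 * b + 8) (12 * a + 7 * b + 14))
    where
    hEq : ∀ a b → 7 * (7 * a + 4 * b + 8) + 2 ≡ 7 * (7 * a + 6) + 4 * (7 * b + 2) + 8
    hEq = solve-∀
    uEq : ∀ a b → 7 * (12 * a + 7 * b + 14) + 1 ≡ 12 * (7 * a + 6) + 7 * (7 * b + 2) + 13
    uEq = solve-∀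
  ... | res-2-1 a b = subst₂ Residues₃ (hEq a b) (uEq a b) (res-5-2 (7 * a + 4 * b + 3) (12 * a + 7 * b + 6))
    where
    hEq : ∀ a b → 7 * (7 * a + 4 * b + 3) + 5 ≡ 7 * (7 * a + 2) + 4 * (7 * b + 1) + 8
    hEq = solve-∀
    uEq : ∀ a b → 7 * (12 * a + 7 * b + 6) + 2 ≡ 12 * (7 * a + 2) + 7 * (7 * b + 1) + 13
    uEq = solve-∀
  ... | res-5-2 a b = subst₂ Residues₃ (hEq a b) (uEq a b) (res-2-3 (7 * a + 4 * b + 7) (12 * a + 7 * b + 12))
    where
    hEq : ∀ a b → 7 * (7 * a + 4 * b + 7) + 2 ≡ 7 * (7 * a + 5) + 4 * (7 * b + 2) + 8
    hEq = solve-∀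
    uEq : ∀ a b → 7 * (12 * a + 7 * b + 12) + 3 ≡ 12 * (7 * a + 5) + 7 * (7 * b + 2) + 13
    uEq = solve-∀

  -- If h is 2 modulo 7, then p is 4 + 2 + 1. For residues (6, 2), p is 1 and both h + 1 and B = 2 p
  -- - u vanish. For (5, 2), p is 3, B is 4 and q is 4 · 5 + 1.
  seven-divides : ∀ {h u p q B} → Residues₃ h u → p ≡ h * h + h + 1 → B + u ≡ 2 * p → q ≡ suc (B * h) →
    7 ∣ p ⊎ (7 ∣ suc h × 7 ∣ B) ⊎ 7 ∣ q
  seven-divides (res-2-3 a b) refl _ _ = inj₁ (divides (7 * (a * a) + 5 * a + 1) (eq a))
    where
    eq : ∀ a → (7 * a + 2) * (7 * a + 2) + (7 * a + 2) + 1 ≡ (7 * (a * a) + 5 * a + 1) * 7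
    eq = solve-∀
  seven-divides (res-2-1 a b) refl _ _ = inj₁ (divides (7 * (a * a) + 5 * a + 1) (eq a))
    where
    eq : ∀ a → (7 * a + 2) * (7 * a + 2) + (7 * a + 2) + 1 ≡ (7 * (a * a) + 5 * a + 1) * 7
    eq = solve-∀
  seven-divides {B = B} (res-6-2 a b) refl B+u≡2p _ = inj₂ (inj₁ (divides (suc a) (succ a) ,
    ∣m+n∣m⇒∣n (divides (14 * (a * a) + 26 * a + 13) (trans (l b B) (trans (cong (_+ 5) B+u≡2p) (r a)))) (m∣m*n (suc b))))
    where
    succ : ∀ a → 1 + (7 * a + 6) ≡ (1 + a) * 7
    succ = solve-∀
    l : ∀ b B → 7 * (1 + b) + B ≡ B + (7 * b + 2) + 5
    l = solve-∀
    r : ∀ a → 2 * ((7 * a + 6) * (7 * a + 6) + (7 * a + 6) + 1) + 5 ≡ (14 * (a * a) + 26 * a + 13) * 7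
    r = solve-∀
  seven-divides {B = B} (res-5-2 a b) refl B+u≡2p refl = inj₂ (inj₂
    (∣m+n∣m⇒∣n (divides (98 * (a * a * a) + 224 * (a * a) + 172 * a + 45)
      (trans (l a b B) (trans (cong (λ z → z * (7 * a + 5) + 5) B+u≡2p) (r a))))
      (m∣m*n (7 * (a * b) + 5 * b + 2 * a + 2))))
    where
    l : ∀ a b B → 7 * (7 * (a * b) + 5 * b + 2 * a + 2) + (1 + B * (7 * a + 5)) ≡ (B + (7 * b + 2)) * (7 * a + 5) + 5
    l = solve-∀
    r : ∀ a → 2 * ((7 * a + 5) * (7 * a + 5) + (7 * a + 5) + 1) * (7 * a + 5) + 5
        ≡ (98 * (a * a * a) + 224 * (a * a) + 172 * a + 45) * 7
    r = solve-∀

  -- Evenness is essential, since h = 1, u = 2 solves the equation. The limit 49 is where the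
  -- descent starts, and u < 3 h + 3 bounds the search.
  no-small-even-6 : ∀ h u → h < 49 → 2 ∣ h → 6 * (h * h) + 5 * h + 5 ≢ u * u + 6 * u
  no-small-even-6 h u h<49 2∣h eq = from-yes (ℕ.allUpTo? (λ j → ℕ.allUpTo? (λ v →
      ¬? (6 * (2 * j * (2 * j)) + 5 * (2 * j) + 5 ℕ.≟ v * v + 6 * v)) 147) 25)
      j<25 u<147 (subst (λ h → 6 * (h * h) + 5 * h + 5 ≡ u * u + 6 * u) h≡2j eq)
    where
    h≡2j : h ≡ 2 * quotient 2∣h
    h≡2j = trans (_∣_.equality 2∣h) (ℕ.*-comm (quotient 2∣h) 2)
    j<25 : quotient 2∣h < 25
    j<25 = ℕ.*-cancelˡ-< 2 (quotient 2∣h) 25 (subst (_< 50) h≡2j (ℕ.m≤n⇒m≤1+n h<49))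
    expand : ∀ h → 6 * (h * h) + 5 * h + 5 + (1 + (3 * (h * h) + 13 * h + 3)) ≡ (3 * h + 3) * (3 * h + 3)
    expand = solve-∀
    u<147 : u < 147
    u<147 = ℕ.<-≤-trans
      (²-cancel-< (ℕ.≤-<-trans (ℕ.m≤m+n (u * u) (6 * u))
        (subst₂ _<_ eq (expand h) (ℕ.m<m+n _ (ℕ.s≤s ℕ.z≤n)))))
      (ℕ.+-monoˡ-≤ 3 (ℕ.*-monoʳ-≤ 3 (ℕ.s≤s⁻¹ h<49)))

  -- Makes 49 h - 20 u - 40 a natural number. Since 49² - 6 · 20² = 1, the estimate needs h² + 58 h
  -- > 5159, which holds from h = 49 on.
  descent₆-h : ∀ h u → 49 ≤ h → 6 * (h * h) + 5 * h + 5 ≡ u * u + 6 * u → 20 * u + 40 ≤ 49 * h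
  descent₆-h h u 49≤h eq with 20 * u + 40 ℕ.≤? 49 * h
  ... | yes le = le
  ... | no ¬le = contradiction (cong (λ z → 400 * z + 3159) eq) (ℕ.<⇒≢ (begin-strict
      400 * (6 * (h * h) + 5 * h + 5) + 3159
        ≡⟨ expand h ⟩
      2400 * (h * h) + 2000 * h + 5159
        <⟨ ℕ.+-monoʳ-< (2400 * (h * h) + 2000 * h) (ℕ.<-≤-trans (ℕ.m<m+n 5159 {84} (ℕ.s≤s ℕ.z≤n))
             (ℕ.+-mono-≤ (ℕ.*-mono-≤ 49≤h 49≤h) (ℕ.*-monoʳ-≤ 58 49≤h))) ⟩
      2400 * (h * h) + 2000 * h + (h * h + 58 * h)
        ≡⟨ collect h ⟩
      49 * h * (49 * h) + 42 * (49 * h)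
        ≤⟨ ℕ.+-mono-≤ (ℕ.*-mono-≤ 49h≤v 49h≤v) (ℕ.*-monoʳ-≤ 42 49h≤v) ⟩
      (20 * u + 39) * (20 * u + 39) + 42 * (20 * u + 39)
        ≡⟨ scale u ⟩
      400 * (u * u + 6 * u) + 3159 ∎))
    where
    open ℕ.≤-Reasoning
    49h≤v : 49 * h ≤ 20 * u + 39
    49h≤v = ℕ.s≤s⁻¹ (subst (49 * h <_) (ℕ.+-suc (20 * u) 39) (ℕ.≰⇒> ¬le))
    expand : ∀ h → 400 * (6 * (h * h) + 5 * h + 5) + 3159 ≡ 2400 * (h * h) + 2000 * h + 5159
    expand = solve-∀
    collect : ∀ h → 2400 * (h * h) + 2000 * h + (h * h + 58 * h) ≡ 49 * h * (49 * h) + 42 * (49 * h)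
    collect = solve-∀
    scale : ∀ u → (20 * u + 39) * (20 * u + 39) + 42 * (20 * u + 39) ≡ 400 * (u * u + 6 * u) + 3159
    scale = solve-∀

  -- Makes 49 u + 94 - 120 h a natural number. The margin of 49² u² over 2400 u² is a single u²,
  -- spent on the linear term through 2 · 95 u ≤ u² + 95².
  descent₆-u : ∀ h u → 6 * (h * h) + 5 * h + 5 ≡ u * u + 6 * u → 120 * h ≤ 49 * u + 94
  descent₆-u h u eq with 120 * h ℕ.≤? 49 * u + 94
  ... | yes le = le
  ... | no ¬le = contradiction (cong (2400 *_) (sym eq)) (ℕ.<⇒≢ (begin-strict
      2400 * (u * u + 6 * u)
        ≡⟨ split u ⟩
      2400 * (u * u) + 14210 * u + 2 * (u * 95)
        ≤⟨ ℕ.+-monoʳ-≤ (2400 * (u * u) + 14210 * u) (2mn≤m²+n² u 95) ⟩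
      2400 * (u * u) + 14210 * u + (u * u + 9025)
        <⟨ ℕ.m<m+n (2400 * (u * u) + 14210 * u + (u * u + 9025)) {21500} (ℕ.s≤s ℕ.z≤n) ⟩
      2400 * (u * u) + 14210 * u + (u * u + 9025) + 21500
        ≡⟨ collect u ⟩
      (49 * u + 95) * (49 * u + 95) + 100 * (49 * u + 95) + 12000
        ≤⟨ ℕ.+-monoˡ-≤ 12000 (ℕ.+-mono-≤ (ℕ.*-mono-≤ v≤120h v≤120h) (ℕ.*-monoʳ-≤ 100 v≤120h)) ⟩
      120 * h * (120 * h) + 100 * (120 * h) + 12000
        ≡⟨ scale h ⟩
      2400 * (6 * (h * h) + 5 * h + 5) ∎))
    where
    open ℕ.≤-Reasoning
    v≤120h : 49 * u + 95 ≤ 120 * h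
    v≤120h = subst (_≤ 120 * h) (sym (ℕ.+-suc (49 * u) 94)) (ℕ.≰⇒> ¬le)
    split : ∀ u → 2400 * (u * u + 6 * u) ≡ 2400 * (u * u) + 14210 * u + 2 * (u * 95)
    split = solve-∀
    collect : ∀ u → 2400 * (u * u) + 14210 * u + (u * u + 9025) + 21500
      ≡ (49 * u + 95) * (49 * u + 95) + 100 * (49 * u + 95) + 12000
    collect = solve-∀
    scale : ∀ h → 120 * h * (120 * h) + 100 * (120 * h) + 12000 ≡ 2400 * (6 * (h * h) + 5 * h + 5)
    scale = solve-∀

  -- With x = 12 h + 5 and y = u + 3 the equation is x² - 24 y² = -311; the descent divides
  -- x + y √24 by the unit 49 + 10 √24 and preserves the parity of h.
  no-even-solution-6 : ∀ h u → 2 ∣ h → 6 * (h * h) + 5 * h + 5 ≢ u * u + 6 * u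
  no-even-solution-6 = <-rec _ descend
    where
    descend : ∀ h → (∀ {h′} → h′ < h → ∀ u → 2 ∣ h′ → 6 * (h′ * h′) + 5 * h′ + 5 ≢ u * u + 6 * u) →
              ∀ u → 2 ∣ h → 6 * (h * h) + 5 * h + 5 ≢ u * u + 6 * u
    descend h rec u 2∣h eq with h ℕ.<? 49
    ... | yes h<49 = no-small-even-6 h u h<49 2∣h eq
    ... | no  h≮49
      with ℕ.m≤n⇒∃[o]m+o≡n (descent₆-h h u (ℕ.≮⇒≥ h≮49) eq) | ℕ.m≤n⇒∃[o]m+o≡n (descent₆-u h u eq)
    ... | h′ , 20u+40+h′≡49h | u′ , 120h+u′≡49u+94 = rec h′<h u′ 2∣h′ eq′
      where
      h≡ : h ≡ 49 * h′ + 20 * u′ + 80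
      h≡ = ℕ.+-cancelˡ-≡ (980 * u + 1880 + 2400 * h) h (49 * h′ + 20 * u′ + 80)
        (trans (l h u) (trans (cong₂ (λ y z → 49 * y + 20 * z) (sym 20u+40+h′≡49h) (sym 120h+u′≡49u+94)) (r h u h′ u′)))
        where
        l : ∀ h u → 980 * u + 1880 + 2400 * h + h ≡ 49 * (49 * h) + 20 * (49 * u + 94)
        l = solve-∀
        r : ∀ h u h′ u′ → 49 * (20 * u + 40 + h′) + 20 * (120 * h + u′) ≡ 980 * u + 1880 + 2400 * h + (49 * h′ + 20 * u′ + 80)
        r = solve-∀
      u≡ : u ≡ 120 * h′ + 49 * u′ + 194
      u≡ = ℕ.+-cancelˡ-≡ (5880 * h + 2400 * u + 4606) u (120 * h′ + 49 * u′ + 194)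
        (trans (l h u) (trans (cong₂ (λ y z → 120 * y + 49 * z) (sym 20u+40+h′≡49h) (sym 120h+u′≡49u+94)) (r h u h′ u′)))
        where
        l : ∀ h u → 5880 * h + 2400 * u + 4606 + u ≡ 120 * (49 * h) + 49 * (49 * u + 94)
        l = solve-∀
        r : ∀ h u h′ u′ → 120 * (20 * u + 40 + h′) + 49 * (120 * h + u′) ≡ 5880 * h + 2400 * u + 4606 + (120 * h′ + 49 * u′ + 194)
        r = solve-∀
      h≡h′+even : h ≡ 2 * (24 * h′ + 10 * u′ + 40) + h′
      h≡h′+even = trans h≡ (l h′ u′)
        where
        l : ∀ h′ u′ → 49 * h′ + 20 * u′ + 80 ≡ 2 * (24 * h′ + 10 * u′ + 40) + h′
        l = solve-∀
      2∣h′ : 2 ∣ h′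
      2∣h′ = ∣m+n∣m⇒∣n (subst (2 ∣_) h≡h′+even 2∣h) (m∣m*n (24 * h′ + 10 * u′ + 40))
      h′<h : h′ < h
      h′<h = subst (h′ <_) (trans (l h′ u′) (sym h≡)) (ℕ.m<m+n h′ (ℕ.s≤s ℕ.z≤n))
        where
        l : ∀ h′ u′ → h′ + (1 + (48 * h′ + 20 * u′ + 79)) ≡ 49 * h′ + 20 * u′ + 80
        l = solve-∀
      eq′ : 6 * (h′ * h′) + 5 * h′ + 5 ≡ u′ * u′ + 6 * u′
      eq′ = sym (ℕ.+-cancelˡ-≡ (6 * (h * h) + 5 * h + 5) (u′ * u′ + 6 * u′) (6 * (h′ * h′) + 5 * h′ + 5)
        (trans (subst₂ (λ h u → 6 * (h * h) + 5 * h + 5 + (u′ * u′ + 6 * u′) ≡ u * u + 6 * u + (6 * (h′ * h′) + 5 * h′ + 5))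
          (sym h≡) (sym u≡) (invariant h′ u′)) (cong (_+ (6 * (h′ * h′) + 5 * h′ + 5)) (sym eq))))
        where
        invariant : ∀ h′ u′ → let h = 49 * h′ + 20 * u′ + 80 ; u = 120 * h′ + 49 * u′ + 194 in
          6 * (h * h) + 5 * h + 5 + (u′ * u′ + 6 * u′) ≡ u * u + 6 * u + (6 * (h′ * h′) + 5 * h′ + 5)
        invariant = solve-∀

  -- Reduction to the extremal case m = k = 1

  0<m : ∀ {n p q r H B} (P : Parameters n p q r H B) → 0 < Parameters.m P
  0<m {p = p} {B = B} P = ℕ.n≢0⇒n>0 λ m≡0 → contradiction (trans (sym m*B≡) (cong (_* B) m≡0))
    (ℕ.>⇒≢ (ℕ.<-≤-trans (ℕ.≤-trans (ℕ.s≤s ℕ.z≤n) 2≤E) (ℕ.m≤n+m E p)))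
    where open Parameters P

  -- E < p bounds m B by 2 p, so the hypothesis yields 5 B ≤ 4 H² m. Then 5 B⁴ ≤ 4 (B H)² (m B) ≤ 8
  -- p (B H)², and B H is below both q and r.
  crude-regime : ∀ {n p q r H B} (P : Parameters n p q r H B) → let open Parameters P in
    5 * p ≤ 2 * (H * H * (m * m)) → 5 * B ^ 4 ≤ 8 * n
  crude-regime {n} {p} {q} {r} {H} {B} P 5p≤2H²m² = begin
    5 * B ^ 4                          ≡⟨ split B ⟩
    5 * B * (B * B * B)                ≤⟨ ℕ.*-monoˡ-≤ (B * B * B) 5B≤4H²m ⟩
    4 * (H * H) * m * (B * B * B)      ≡⟨ regroup B H m ⟩
    4 * (B * H * (B * H)) * (m * B)    ≤⟨ ℕ.*-monoʳ-≤ (4 * (B * H * (B * H))) mB≤2p ⟩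
    4 * (B * H * (B * H)) * (p + p)    ≡⟨ collect (B * H) p ⟩
    8 * (p * (B * H) * (B * H))        ≤⟨ ℕ.*-monoʳ-≤ 8 (ℕ.*-mono-≤ (ℕ.*-monoʳ-≤ p BH≤q) (ℕ.≤-trans BH≤q (ℕ.<⇒≤ q<r))) ⟩
    8 * (p * q * r)                    ≡⟨ cong (8 *_) n≡ ⟨
    8 * n                              ∎
    where
    open Parameters P
    open ℕ.≤-Reasoning
    split : ∀ B → 5 * (B * (B * (B * (B * 1)))) ≡ 5 * B * (B * B * B)
    split = solve-∀
    regroup : ∀ B H m → 4 * (H * H) * m * (B * B * B) ≡ 4 * (B * H * (B * H)) * (m * B)
    regroup = solve-∀
    collect : ∀ x p → 4 * (x * x) * (p + p) ≡ 8 * (p * x * x)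
    collect = solve-∀
    mB≤2p : m * B ≤ p + p
    mB≤2p = subst (_≤ p + p) (sym m*B≡) (ℕ.+-monoʳ-≤ p (ℕ.<⇒≤ E<p))
    BH≤q : B * H ≤ q
    BH≤q = subst (B * H ≤_) (sym q≡) (ℕ.n≤1+n (B * H))
    instance
      m≢0 : NonZero m
      m≢0 = ℕ.>-nonZero (0<m P)
    5B≤4H²m : 5 * B ≤ 4 * (H * H) * m
    5B≤4H²m = ℕ.*-cancelˡ-≤ m (begin
      m * (5 * B)              ≡⟨ swap m B ⟩
      5 * (m * B)              ≤⟨ ℕ.*-monoʳ-≤ 5 mB≤2p ⟩
      5 * (p + p)              ≡⟨ double p ⟩
      2 * (5 * p)              ≤⟨ ℕ.*-monoʳ-≤ 2 5p≤2H²m² ⟩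
      2 * (2 * (H * H * (m * m))) ≡⟨ expand H m ⟩
      m * (4 * (H * H) * m)    ∎)
      where
      swap : ∀ m B → m * (5 * B) ≡ 5 * (m * B)
      swap = solve-∀
      double : ∀ p → 5 * (p + p) ≡ 2 * (5 * p)
      double = solve-∀
      expand : ∀ H m → 2 * (2 * (H * H * (m * m))) ≡ m * (4 * (H * H) * m)
      expand = solve-∀

  factor-≤ : ∀ {a s} .{{_ : NonZero s}} k → k * a ≡ s → a ≤ s
  factor-≤ k ka≡s = ∣⇒≤ (divides k (sym ka≡s))

  -- The ratio 2/5 in `crude` lies between 1/3, the limit of p/H² for m = 1 and k = 3, and 1, its
  -- limit in the extremal case. The two sporadic cases, p = 3 and p = 9, are small values at which
  -- the inequality of `crude` fails.
  data Regime (A H m : ℕ) : Set where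
    crude     : 5 * suc (A * H) ≤ 2 * (H * H * (m * m)) → Regime A H m
    extremal  : A ≡ suc H → m ≡ 1 → Regime A H m
    sporadic₁ : A ≡ 1 → H ≡ 2 → m ≡ 1 → Regime A H m
    sporadic₄ : A ≡ 4 → H ≡ 2 → m ≡ 2 → Regime A H m

  -- A ≤ m + H bounds p by H² + m H + 1, which suffices for m ≥ 3, and for m = 2 with H ≥ 4. For m =
  -- 1, k = 2 contradicts the evenness of H = 2 η, and k ≥ 3 gives 3 A ≤ 1 + H.
  regime : ∀ A m K η → K * A ≡ m + η * 2 → 0 < A * (η * 2) → 0 < m → Regime A (η * 2) m
  regime zero m K η _ () _
  regime A@(suc _) m K zero _ 0<AH _ = contradiction (subst (0 <_) (ℕ.*-zeroʳ A) 0<AH) (ℕ.<-irrefl refl)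
  regime A@(suc _) 1 1 (suc e) KA≡ _ _ = extremal (trans (sym (ℕ.+-identityʳ A)) KA≡) refl
  regime A@(suc _) 1 2 (suc e) KA≡ _ _ =
    contradiction (∣m+n∣m⇒∣n (subst (2 ∣_) (trans KA≡ (ℕ.+-comm 1 (suc e * 2))) (m∣m*n A)) (n∣m*n (suc e)))
      (from-no (2 ∣? 1))
  regime A@(suc _) 1 (suc (suc (suc K))) η@(suc e) KA≡ _ _ = thrice A η (ℕ.≤-trans (ℕ.*-monoˡ-≤ A (ℕ.m≤m+n 3 K)) (ℕ.≤-reflexive KA≡))
    where
    thrice : ∀ A η .{{_ : NonZero A}} .{{_ : NonZero η}} → 3 * A ≤ 1 + η * 2 → Regime A (η * 2) 1
    thrice 1 1 _ = sporadic₁ refl refl refl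
    thrice 1 2 _ = crude (ℕ.m≤m+n 25 7)
    thrice 1 3 _ = crude (ℕ.m≤m+n 35 37)
    thrice 2 3 _ = crude (ℕ.m≤m+n 65 7)
    thrice A@(suc (suc k)) 1 3A≤ = contradiction (ℕ.≤-trans (ℕ.*-monoʳ-≤ 3 (ℕ.s≤s (ℕ.s≤s (ℕ.z≤n {k})))) 3A≤) (from-no (6 ℕ.≤? 3))
    thrice A@(suc (suc k)) 2 3A≤ = contradiction (ℕ.≤-trans (ℕ.*-monoʳ-≤ 3 (ℕ.s≤s (ℕ.s≤s (ℕ.z≤n {k})))) 3A≤) (from-no (6 ℕ.≤? 5))
    thrice A@(suc (suc (suc k))) 3 3A≤ = contradiction (ℕ.≤-trans (ℕ.*-monoʳ-≤ 3 (ℕ.s≤s (ℕ.s≤s (ℕ.s≤s (ℕ.z≤n {k}))))) 3A≤) (from-no (9 ℕ.≤? 7))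
    thrice A η@(suc (suc (suc (suc e)))) 3A≤ = crude (ℕ.*-cancelˡ-≤ 3 (begin
      3 * (5 * suc (A * (η * 2)))            ≡⟨ l A (η * 2) ⟩
      5 * (3 * A * (η * 2)) + 15             ≤⟨ ℕ.+-monoˡ-≤ 15 (ℕ.*-monoʳ-≤ 5 (ℕ.*-monoˡ-≤ (η * 2) 3A≤)) ⟩
      5 * ((1 + η * 2) * (η * 2)) + 15       ≤⟨ ℕ.m≤m+n _ (4 * (e * e) + 22 * e + 9) ⟩
      5 * ((1 + η * 2) * (η * 2)) + 15 + (4 * (e * e) + 22 * e + 9)  ≡⟨ r e ⟩
      3 * (2 * (η * 2 * (η * 2) * (1 * 1)))  ∎))
      where
      open ℕ.≤-Reasoning
      l : ∀ A H → 3 * (5 * (1 + A * H)) ≡ 5 * (3 * A * H) + 15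
      l = solve-∀
      r : ∀ e → 5 * ((1 + (4 + e) * 2) * ((4 + e) * 2)) + 15 + (4 * (e * e) + 22 * e + 9)
          ≡ 3 * (2 * ((4 + e) * 2 * ((4 + e) * 2) * (1 * 1)))
      r = solve-∀
  regime 1 2 K 1 _ _ _ = crude (ℕ.m≤m+n 15 17)
  regime 2 2 K 1 _ _ _ = crude (ℕ.m≤m+n 25 7)
  regime 3 2 K 1 KA≡ _ _ = contradiction (divides K (sym KA≡)) (from-no (3 ∣? 4))
  regime 4 2 K 1 _ _ _ = sporadic₄ refl refl refl
  regime A@(suc (suc (suc (suc (suc k))))) 2 K 1 KA≡ _ _ =
    contradiction (factor-≤ K KA≡) λ { (ℕ.s≤s (ℕ.s≤s (ℕ.s≤s (ℕ.s≤s ())))) }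
  regime A@(suc _) 2 K η@(suc (suc e)) KA≡ _ _ = crude (begin
    5 * suc (A * (η * 2))
      ≤⟨ ℕ.*-monoʳ-≤ 5 (ℕ.s≤s (ℕ.*-monoˡ-≤ (η * 2) (factor-≤ K KA≡))) ⟩
    5 * suc ((2 + η * 2) * (η * 2))
      ≤⟨ ℕ.m≤m+n _ (12 * (e * e) + 28 * e + 3) ⟩
    5 * suc ((2 + η * 2) * (η * 2)) + (12 * (e * e) + 28 * e + 3)
      ≡⟨ r e ⟩
    2 * (η * 2 * (η * 2) * (2 * 2)) ∎)
    where
    open ℕ.≤-Reasoning
    r : ∀ e → 5 * (1 + ((2 + (2 + e) * 2) * ((2 + e) * 2))) + (12 * (e * e) + 28 * e + 3)
        ≡ 2 * ((2 + e) * 2 * ((2 + e) * 2) * (2 * 2))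
    r = solve-∀
  regime A@(suc _) m@(suc (suc (suc a))) K η@(suc e) KA≡ _ _ = crude (begin
    5 * suc (A * (η * 2))
      ≤⟨ ℕ.*-monoʳ-≤ 5 (ℕ.s≤s (ℕ.*-monoˡ-≤ (η * 2) (factor-≤ K KA≡))) ⟩
    5 * suc ((m + η * 2) * (η * 2))
      ≤⟨ ℕ.m≤m+n _ (excess a e) ⟩
    5 * suc ((m + η * 2) * (η * 2)) + excess a e
      ≡⟨ r a e ⟩
    2 * (η * 2 * (η * 2) * (m * m)) ∎)
    where
    open ℕ.≤-Reasoning
    excess : ℕ → ℕ → ℕ
    excess a e = 17 + 38 * a + 8 * (a * a) + 74 * e + 86 * (a * e) + 16 * (a * a * e)
                 + 52 * (e * e) + 48 * (a * e * e) + 8 * (a * a * e * e)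
    r : ∀ a e → 5 * (1 + ((3 + a + (1 + e) * 2) * ((1 + e) * 2)))
                + (17 + 38 * a + 8 * (a * a) + 74 * e + 86 * (a * e) + 16 * (a * a * e)
                   + 52 * (e * e) + 48 * (a * e * e) + 8 * (a * a * e * e))
        ≡ 2 * ((1 + e) * 2 * ((1 + e) * 2) * ((3 + a) * (3 + a)))
    r = solve-∀

  record Extremal (n p q r B : ℕ) : Set where
    field
      {h u w E} : ℕ
      2≤h     : 2 ≤ h
      2∣h     : 2 ∣ h
      p≡      : p ≡ h * h + h + 1
      q≡      : q ≡ suc (B * h)
      n≡      : n ≡ pqr w h
      p<q     : p < q
      E+u≡p   : E + u ≡ p
      2≤E     : 2 ≤ E
      B+u≡2p  : B + u ≡ 2 * p
      w*E≡    : w * E ≡ u * u + (h + 1)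
      coprime : Coprime (suc h) B

  -- Eliminating B gives 2 E C = 9 E + 89, so E divides the prime 89.
  sporadic₄-impossible : ∀ {B C E} → 2 * B ≡ 9 + E → E * C ≡ 4 * B * 2 + 4 + B → 2 ≤ E → E < 9 → ⊥
  sporadic₄-impossible {B} {C} {E} 2B≡9+E EC≡ 2≤E E<9 =
    from-yes (ℕ.allUpTo? (λ E → (2 ℕ.≤? E) →-dec ¬? (E ∣? 89)) 9) E<9 2≤E
      (∣m+n∣m⇒∣n (divides (2 * C) (trans (l E) (trans (cong (λ z → 9 * z + 8) (sym 2B≡9+E))
        (trans (m B) (trans (cong (2 *_) (sym EC≡)) (r E C))))))
        (n∣m*n 9))
    where
    l : ∀ E → 9 * E + 89 ≡ 9 * (9 + E) + 8
    l = solve-∀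
    m : ∀ B → 9 * (2 * B) + 8 ≡ 2 * (4 * B * 2 + 4 + B)
    m = solve-∀
    r : ∀ E C → 2 * (E * C) ≡ 2 * C * E
    r = solve-∀

  extremal-parameters : ∀ {n p q r h B} (P : Parameters n p q r h B) → let open Parameters P in
    A ≡ suc h → m ≡ 1 → Extremal n p q r B
  extremal-parameters {n} {p} {q} {r} {h} {B} record
    { A = A ; C = C ; E = E ; n≡ = n≡ ; p≡ = p≡ ; q≡ = q≡ ; r≡ = r≡ ; p<q = p<q ; 2∣H = 2∣h ; 0<AH = 0<AH
    ; E*C≡ = EC≡ ; m*B≡ = mB≡ ; 2≤E = 2≤E ; E<p = E<p ; coprime = coprime } refl refl
    with ℕ.m≤n⇒∃[o]m+o≡n (ℕ.<⇒≤ E<p)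
  ... | u , E+u≡p = record
    { h = h ; u = u ; w = w ; E = E
    ; 2≤h = 2≤h ; 2∣h = 2∣h ; p≡ = p≡′ ; q≡ = q≡ ; n≡ = n≡′ ; p<q = p<q
    ; E+u≡p = E+u≡p ; 2≤E = 2≤E ; B+u≡2p = B+u≡2p ; w*E≡ = wE≡ ; coprime = coprime }
    where
    instance
      h≢0 : NonZero h
      h≢0 = ℕ.≢-nonZero λ h≡0 → contradiction
        (subst (0 <_) (trans (cong (suc h *_) h≡0) (ℕ.*-zeroʳ (suc h))) 0<AH) (ℕ.<-irrefl refl)
      E≢0 : NonZero E
      E≢0 = ℕ.>-nonZero (ℕ.≤-trans (ℕ.s≤s ℕ.z≤n) 2≤E)
    2≤h : 2 ≤ h
    2≤h = ∣⇒≤ 2∣h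
    p≡′ : p ≡ h * h + h + 1
    p≡′ = trans p≡ (expand h)
      where
      expand : ∀ h → 1 + (1 + h) * h ≡ h * h + h + 1
      expand = solve-∀
    B≡ : B ≡ p + E
    B≡ = trans (sym (ℕ.*-identityˡ B)) mB≡
    B+u≡2p : B + u ≡ 2 * p
    B+u≡2p = trans (cong (_+ u) B≡) (trans (ℕ.+-assoc p E u) (trans (cong (λ z → p + z) E+u≡p) (double p)))
      where
      double : ∀ p → p + p ≡ 2 * p
      double = solve-∀
    -- E C = p B + h + 1 is divided by E after writing p = E + u and B = p + E: the part u² + h + 1
    -- left over is what w E must equal.
    EC≡′ : E * C ≡ E * (2 * p + u) + (u * u + (h + 1))
    EC≡′ = trans EC≡ (trans (factor h B) (trans (cong₂ (λ y z → y * z + suc h) (sym p≡) B≡)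
      (subst (λ p → p * (p + E) + suc h ≡ E * (2 * p + u) + (u * u + (h + 1))) E+u≡p (expand E u h))))
      where
      factor : ∀ h B → (1 + h) * B * h + (1 + h) + B ≡ (1 + (1 + h) * h) * B + (1 + h)
      factor = solve-∀
      expand : ∀ E u h → (E + u) * (E + u + E) + (1 + h) ≡ E * (2 * (E + u) + u) + (u * u + (h + 1))
      expand = solve-∀
    2p+u≤C : 2 * p + u ≤ C
    2p+u≤C = ℕ.*-cancelˡ-≤ E (subst (E * (2 * p + u) ≤_) (sym EC≡′) (ℕ.m≤m+n _ _))
    w : ℕ
    w = C ∸ (2 * p + u)
    C≡ : C ≡ 2 * p + u + w
    C≡ = sym (ℕ.m+[n∸m]≡n 2p+u≤C)
    wE≡ : w * E ≡ u * u + (h + 1)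
    wE≡ = trans (ℕ.*-comm w E) (ℕ.+-cancelˡ-≡ (E * (2 * p + u)) (E * w) (u * u + (h + 1))
      (trans (sym (ℕ.*-distribˡ-+ E (2 * p + u) w)) (trans (cong (E *_) (sym C≡)) EC≡′)))
    n≡′ : n ≡ pqr w h
    n≡′ = trans n≡ (trans (ℕ.*-assoc p q r) (trans (cong (p *_) (trans
      (cong₂ _*_ (trans q≡ (cong (λ z → suc (z * h)) B≡)) (trans r≡ (cong (λ z → suc (z * h)) C≡)))
      qr≡)) (cong (λ p → p * (h * h * (4 * (p * p) + w * p + (h + 1)) + h * (4 * p + w) + 1)) p≡′)))
      where
      expand : ∀ E u w h →
        (1 + (E + u + E) * h) * (1 + (2 * (E + u) + u + w) * h) + h * h * (u * u + (h + 1))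
        ≡ h * h * (4 * ((E + u) * (E + u)) + w * (E + u) + (h + 1)) + h * (4 * (E + u) + w) + 1 + h * h * (w * E)
      expand = solve-∀
      -- B C and B + C no longer involve u. The term h² w E on both sides lets the equation for w E
      -- enter without subtraction.
      qr≡ : suc ((p + E) * h) * suc ((2 * p + u + w) * h) ≡ h * h * (4 * (p * p) + w * p + (h + 1)) + h * (4 * p + w) + 1
      qr≡ = ℕ.+-cancelʳ-≡ (h * h * (w * E)) _ _
        (subst (λ p → suc ((p + E) * h) * suc ((2 * p + u + w) * h) + h * h * (w * E)
                      ≡ h * h * (4 * (p * p) + w * p + (h + 1)) + h * (4 * p + w) + 1 + h * h * (w * E)) E+u≡p
          (trans (cong (λ z → suc ((E + u + E) * h) * suc ((2 * (E + u) + u + w) * h) + h * h * z) wE≡) (expand E u w h)))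

  -- p = 3 forces E = 2, B = 5 and C = 8, that is n = 3 · 11 · 17 = 561.
  sporadic₁-crude : ∀ {n p q r H B} (P : Parameters n p q r H B) → let open Parameters P in
    A ≡ 1 → H ≡ 2 → m ≡ 1 → 5 * B ^ 4 ≤ 8 * n
  sporadic₁-crude {n} {p} {q} {r} {_} {B} record
    { C = C ; E = E ; n≡ = n≡ ; p≡ = refl ; q≡ = q≡ ; r≡ = r≡ ; E*C≡ = EC≡ ; m*B≡ = mB≡ ; 2≤E = 2≤E ; E<p = E<p }
    refl refl refl = subst₂ (λ B n → 5 * B ^ 4 ≤ 8 * n) (sym B≡5)
      (sym (trans n≡ (cong₂ (λ q r → 3 * q * r) (trans q≡ (cong (λ z → suc (z * 2)) B≡5)) (trans r≡ (cong (λ z → suc (z * 2)) C≡8)))))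
      (ℕ.m≤m+n 3125 1363)
    where
    E≡2 : E ≡ 2
    E≡2 = ℕ.≤-antisym (ℕ.s≤s⁻¹ E<p) 2≤E
    B≡5 : B ≡ 5
    B≡5 = trans (sym (ℕ.*-identityˡ B)) (trans mB≡ (cong (λ z → 3 + z) E≡2))
    C≡8 : C ≡ 8
    C≡8 = ℕ.*-cancelˡ-≡ C 8 2 (trans (cong (_* C) (sym E≡2)) (trans EC≡ (cong (λ z → 1 * z * 2 + 1 + z) B≡5)))

  sporadic₄-absurd : ∀ {n p q r H B} (P : Parameters n p q r H B) → let open Parameters P in
    A ≡ 4 → H ≡ 2 → m ≡ 2 → ⊥
  sporadic₄-absurd {B = B} record { p≡ = refl ; E*C≡ = EC≡ ; m*B≡ = mB≡ ; 2≤E = 2≤E ; E<p = E<p } refl refl refl =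
    sporadic₄-impossible {B} mB≡ EC≡ 2≤E E<p

  classify : ∀ {n p q r H B} → Parameters n p q r H B → 5 * B ^ 4 ≤ 8 * n ⊎ Extremal n p q r B
  classify {n} {p} {q} {r} {H} {B} P = cases (subst (λ H → Regime A H m) (sym H≡) (regime A m k (quotient 2∣H)
      (trans k*A≡ (cong (λ z → m + z) H≡)) (subst (λ H → 0 < A * H) H≡ 0<AH) (0<m P)))
    where
    open Parameters P
    H≡ : H ≡ quotient 2∣H * 2
    H≡ = _∣_.equality 2∣H
    cases : Regime A H m → 5 * B ^ 4 ≤ 8 * n ⊎ Extremal n p q r B
    cases (crude le) = inj₁ (crude-regime P (subst (λ p → 5 * p ≤ 2 * (H * H * (m * m))) (sym p≡) le))
    cases (extremal A≡ m≡) = inj₂ (extremal-parameters P A≡ m≡)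
    cases (sporadic₁ A≡ H≡ m≡) = inj₁ (sporadic₁-crude P A≡ H≡ m≡)
    cases (sporadic₄ A≡ H≡ m≡) = ⊥-elim (sporadic₄-absurd P A≡ H≡ m≡)

  -- Consequences of the extremal equation

  extremal-equation : ∀ {n p q r B} (x : Extremal n p q r B) → let open Extremal x in
    w * p ≡ u * u + w * u + (h + 1)
  extremal-equation x = trans (cong (w *_) (sym E+u≡p)) (trans (ℕ.*-distribˡ-+ w E u)
    (trans (cong (_+ w * u) w*E≡) (swap (u * u) (h + 1) (w * u))))
    where
    open Extremal x
    swap : ∀ a b c → a + b + c ≡ a + c + b
    swap = solve-∀

  -- Replacing w by w₀ weakens w E = u² + h + 1 to an inequality and can only lower `pqr`. These two
  -- facts are all that the tight estimate needs about w.
  extremal-≥ : ∀ {n p q r B} (x : Extremal n p q r B) → let open Extremal x in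
    ∀ w₀ → w₀ ≤ w → w₀ * (h * h + h + 1) ≤ u * u + w₀ * u + (h + 1) × pqr w₀ h ≤ n
  extremal-≥ {p = p} x w₀ w₀≤w = large-u , ℕ.≤-trans pqr-mono (ℕ.≤-reflexive (sym n≡))
    where
    open Extremal x
    open ℕ.≤-Reasoning
    large-u : w₀ * (h * h + h + 1) ≤ u * u + w₀ * u + (h + 1)
    large-u = begin
      w₀ * (h * h + h + 1)         ≡⟨ cong (w₀ *_) (trans (sym p≡) (sym E+u≡p)) ⟩
      w₀ * (E + u)                 ≡⟨ ℕ.*-distribˡ-+ w₀ E u ⟩
      w₀ * E + w₀ * u              ≤⟨ ℕ.+-monoˡ-≤ (w₀ * u) (ℕ.*-monoˡ-≤ E w₀≤w) ⟩
      w * E + w₀ * u               ≡⟨ cong (_+ w₀ * u) w*E≡ ⟩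
      u * u + (h + 1) + w₀ * u     ≡⟨ swap (u * u) (h + 1) (w₀ * u) ⟩
      u * u + w₀ * u + (h + 1)     ∎
      where
      swap : ∀ a b c → a + b + c ≡ a + c + b
      swap = solve-∀
    pqr-mono : pqr w₀ h ≤ pqr w h
    pqr-mono = ℕ.*-monoʳ-≤ p′ (ℕ.+-monoˡ-≤ 1 (ℕ.+-mono-≤
      (ℕ.*-monoʳ-≤ (h * h) (ℕ.+-monoˡ-≤ (h + 1) (ℕ.+-monoʳ-≤ (4 * (p′ * p′)) (ℕ.*-monoˡ-≤ p′ w₀≤w))))
      (ℕ.*-monoʳ-≤ h (ℕ.+-monoʳ-≤ (4 * p′) w₀≤w))))
      where p′ = h * h + h + 1

  extremal-separated : ∀ {n p q r B} (x : Extremal n p q r B) → let open Extremal x in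
    ∀ w′ → w ≡ suc w′ → suc w′ * (h * h) + w′ * h + w′ ≡ u * u + suc w′ * u
  extremal-separated {p = p} x w′ w≡ = ℕ.+-cancelʳ-≡ (h + 1) _ _
    (trans (expand w′ h) (trans (cong₂ _*_ (sym w≡) (sym p≡))
      (trans (extremal-equation x) (cong (λ w → u * u + w * u + (h + 1)) w≡))))
    where
    open Extremal x
    expand : ∀ w h → (1 + w) * (h * h) + w * h + w + (h + 1) ≡ (1 + w) * (h * h + h + 1)
    expand = solve-∀

  extremal-w≥3 : ∀ {n p q r B} (x : Extremal n p q r B) → 3 ≤ Extremal.w x
  extremal-w≥3 x = go w refl
    where
    open Extremal x
    go : ∀ v → w ≡ v → 3 ≤ w
    go 0 w≡ = contradiction (trans (cong (_* E) (sym w≡)) w*E≡) (ℕ.<⇒≢ (ℕ.≤-trans (ℕ.m≤n+m 1 h) (ℕ.m≤n+m (h + 1) (u * u))))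
    go 1 w≡ = contradiction (trans (simplify h) (trans (extremal-separated x 0 w≡) (cong (λ z → u * u + z) (ℕ.*-identityˡ u))))
      (no-solution-1 h u (ℕ.≤-trans (ℕ.s≤s ℕ.z≤n) 2≤h))
      where
      simplify : ∀ h → h * h ≡ 1 * (h * h) + 0 * h + 0
      simplify = solve-∀
    go 2 w≡ = contradiction (trans (cong (λ z → 2 * (h * h) + z + 1) (sym (ℕ.*-identityˡ h))) (extremal-separated x 1 w≡)) (no-solution-2 h u)
    go (suc (suc (suc v))) w≡ = subst (3 ≤_) (sym w≡) (ℕ.m≤m+n 3 v)

  -- Exclusion of small w when p and q are prime

  7-prime-factor : ∀ {p} → Prime p → 7 ∣ p → p ≡ 7
  7-prime-factor p-prime 7∣p with prime⇒irreducible p-prime 7∣p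
  ... | inj₂ 7≡p = sym 7≡p

  7≤p : ∀ {n p q r B} → Extremal n p q r B → 7 ≤ p
  7≤p x = subst (7 ≤_) (sym p≡) (ℕ.+-monoˡ-≤ 1 (ℕ.+-mono-≤ (ℕ.*-mono-≤ 2≤h 2≤h) 2≤h))
    where open Extremal x

  -- 7 dividing p forces p = 7 and h = 2, and `pqr 3 2` evaluates to 6601 = 7 · 23 · 41. 7 dividing
  -- q is impossible because q > p ≥ 7.
  extremal-3-prime : ∀ {n p q r B} (x : Extremal n p q r B) → Extremal.w x ≡ 3 → Prime p → Prime q → n ≡ 6601
  extremal-3-prime {n} {p} {q} x w≡3 p-prime q-prime
    with seven-divides (residues₃ (pell₃ h u (extremal-separated x 2 w≡3))) p≡ B+u≡2p q≡
    where open Extremal x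
  ... | inj₁ 7∣p = trans n≡ (cong₂ pqr w≡3 (ℕ.≤-antisym h≤2 2≤h))
    where
    open Extremal x
    h≤2 : h ≤ 2
    h≤2 with h ℕ.≤? 2
    ... | yes h≤2 = h≤2
    ... | no  h≰2 = contradiction (7-prime-factor p-prime 7∣p) (ℕ.>⇒≢ (subst (7 <_) (sym p≡)
      (ℕ.<-≤-trans (ℕ.m<m+n 7 {6} (ℕ.s≤s ℕ.z≤n))
        (ℕ.+-monoˡ-≤ 1 (ℕ.+-mono-≤ (ℕ.*-mono-≤ (ℕ.≰⇒> h≰2) (ℕ.≰⇒> h≰2)) (ℕ.≰⇒> h≰2))))))
  ... | inj₂ (inj₁ 7∣A,B) = contradiction (Extremal.coprime x 7∣A,B) λ ()
  ... | inj₂ (inj₂ 7∣q) = contradiction (7-prime-factor q-prime 7∣q) (ℕ.>⇒≢ (ℕ.≤-<-trans (7≤p x) (Extremal.p<q x)))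

  -- The single solution has p = 43 and B = 75, hence q = 451 = 11 · 41.
  extremal-4-composite : ∀ {n p q r B} (x : Extremal n p q r B) → Extremal.w x ≡ 4 → ¬ Prime q
  extremal-4-composite {q = q} {B = B} x w≡4 q-prime
    with solution-4 h u (ℕ.≤-trans (ℕ.s≤s ℕ.z≤n) 2≤h) (extremal-separated x 3 w≡4)
    where open Extremal x
  ... | h≡6 , u≡11 = contradiction (prime⇒irreducible (subst Prime q≡451 q-prime) 11∣451) λ { (inj₁ ()) ; (inj₂ ()) }
    where
    open Extremal x
    11∣451 : 11 ∣ 451
    11∣451 = divides 41 refl
    B≡75 : B ≡ 75
    B≡75 = ℕ.+-cancelʳ-≡ 11 B 75 (trans (cong (λ z → B + z) (sym u≡11)) (trans B+u≡2p (cong (2 *_) (trans p≡ (cong (λ h → h * h + h + 1) h≡6)))))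
    q≡451 : q ≡ 451
    q≡451 = trans q≡ (cong₂ (λ B h → suc (B * h)) B≡75 h≡6)

  -- Evenness leaves h = 2, so p = 7 = E + u. E ≥ 3 would give w E ≥ 21 but u² + 3 ≤ 19; hence E =
  -- 2, u = 5, w = 14, B = 9 and n = 8911, for which the crude inequality is numerical.
  extremal-small-crude : ∀ {n p q r B} (x : Extremal n p q r B) → 7 ≤ Extremal.w x → Extremal.h x < 4 → 5 * B ^ 4 ≤ 8 * n
  extremal-small-crude {n} {p} {q} {r} {B} x 7≤w h<4 =
    subst₂ (λ B n → 5 * B ^ 4 ≤ 8 * n) (sym B≡9) (sym (trans n≡ (cong₂ pqr w≡14 h≡2))) (ℕ.m≤m+n 32805 38483)
    where
    open Extremal x
    h≡2 : h ≡ 2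
    h≡2 = ℕ.≤-antisym (ℕ.s≤s⁻¹ (ℕ.≤∧≢⇒< (ℕ.s≤s⁻¹ h<4) λ h≡3 → from-no (2 ∣? 3) (subst (2 ∣_) h≡3 2∣h))) 2≤h
    E+u≡7 : E + u ≡ 7
    E+u≡7 = trans E+u≡p (trans p≡ (cong (λ h → h * h + h + 1) h≡2))
    wE≡ : w * E ≡ u * u + 3
    wE≡ = trans w*E≡ (cong (λ h → u * u + (h + 1)) h≡2)
    E≤2 : E ≤ 2
    E≤2 with E ℕ.≤? 2
    ... | yes E≤2 = E≤2
    ... | no  E≰2 = contradiction wE≡ (ℕ.>⇒≢ (ℕ.≤-<-trans (ℕ.+-monoˡ-≤ 3 (ℕ.*-mono-≤ u≤4 u≤4))
        (ℕ.<-≤-trans (ℕ.m<m+n 19 {2} (ℕ.s≤s ℕ.z≤n)) (ℕ.*-mono-≤ 7≤w (ℕ.≰⇒> E≰2)))))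
      where
      u≤4 : u ≤ 4
      u≤4 = ℕ.+-cancelˡ-≤ 3 u 4 (ℕ.≤-trans (ℕ.+-monoˡ-≤ u (ℕ.≰⇒> E≰2)) (ℕ.≤-reflexive E+u≡7))
    E≡2 : E ≡ 2
    E≡2 = ℕ.≤-antisym E≤2 2≤E
    u≡5 : u ≡ 5
    u≡5 = ℕ.+-cancelˡ-≡ 2 u 5 (trans (cong (_+ u) (sym E≡2)) E+u≡7)
    w≡14 : w ≡ 14
    w≡14 = ℕ.*-cancelʳ-≡ w 14 2 (trans (cong (w *_) (sym E≡2)) (trans wE≡ (cong (λ u → u * u + 3) u≡5)))
    B≡9 : B ≡ 9
    B≡9 = ℕ.+-cancelʳ-≡ 5 B 9 (trans (cong (λ z → B + z) (sym u≡5)) (trans B+u≡2p (cong (2 *_) (trans p≡ (cong (λ h → h * h + h + 1) h≡2)))))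

  extremal-prime-w≥7 : ∀ {n p q r B} (x : Extremal n p q r B) → Prime p → Prime q → n ≢ 6601 → 7 ≤ Extremal.w x
  extremal-prime-w≥7 x p-prime q-prime n≢6601 = go w refl (extremal-w≥3 x)
    where
    open Extremal x
    go : ∀ v → w ≡ v → 3 ≤ w → 7 ≤ w
    go 0 w≡ 3≤w = contradiction (subst (3 ≤_) w≡ 3≤w) λ ()
    go 1 w≡ 3≤w = contradiction (subst (3 ≤_) w≡ 3≤w) (from-no (3 ℕ.≤? 1))
    go 2 w≡ 3≤w = contradiction (subst (3 ≤_) w≡ 3≤w) (from-no (3 ℕ.≤? 2))
    go 3 w≡ _ = contradiction (extremal-3-prime x w≡ p-prime q-prime) n≢6601
    go 4 w≡ _ = contradiction q-prime (extremal-4-composite x w≡)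
    go 5 w≡ _ = contradiction (extremal-separated x 4 w≡) (no-solution-5 h u)
    go 6 w≡ _ = contradiction (extremal-separated x 5 w≡) (no-even-solution-6 h u 2∣h)
    go (suc (suc (suc (suc (suc (suc (suc v))))))) w≡ _ = subst (7 ≤_) (sym w≡) (ℕ.m≤m+n 7 v)

  -- Both bounds from the crude and the extremal case

  n-nonZero : ∀ {n} → K₃N n → NonZero n
  n-nonZero k = subst NonZero (sym n≡pqr) (ℕ.m*n≢0 (p * q) r {{ℕ.m*n≢0 p q {{p≢0}} {{q≢0}}}} {{r≢0}})
    where
    open K₃N k
    p≢0 : NonZero p
    p≢0 = ℕ.>-nonZero (ℕ.<-trans (ℕ.s≤s ℕ.z≤n) 1<p)
    q≢0 : NonZero q
    q≢0 = ℕ.>-nonZero (ℕ.≤-<-trans ℕ.z≤n p<q)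
    r≢0 : NonZero r
    r≢0 = ℕ.>-nonZero (ℕ.≤-<-trans ℕ.z≤n q<r)

  K₃N-bound : ∀ n (k : K₃N n) → fromℕ (K₃N.B k) ℝ.< bound₃ n
  K₃N-bound n k = [ crude₃ n B , case-extremal ]′ (classify (parameters k))
    where
    open K₃N k using (p; q; r; B)
    instance _ = n-nonZero k
    case-extremal : Extremal n p q r B → fromℕ B ℝ.< bound₃ n
    case-extremal x = tight₃ n h u B 2≤h (trans B+u≡2p (cong (2 *_) p≡))
      (proj₁ (extremal-≥ x 3 (extremal-w≥3 x))) (proj₂ (extremal-≥ x 3 (extremal-w≥3 x)))
      where open Extremal x

  C₃N-bound : ∀ n (c : C₃N n) → n ≢ 6601 → fromℕ (C₃N.B c) ℝ.< bound₇ n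
  C₃N-bound n c n≢6601 = [ crude₇ n B , case-extremal ]′ (classify (parameters k₃n))
    where
    open C₃N c using (k₃n; p; q; r; B; p-prime; q-prime)
    instance _ = n-nonZero k₃n
    case-extremal : Extremal n p q r B → fromℕ B ℝ.< bound₇ n
    case-extremal x = [ (λ h<4 → crude₇ n B (extremal-small-crude x 7≤w h<4)) ,
                   (λ 4≤h → tight₇ n h u B 4≤h (trans B+u≡2p (cong (2 *_) p≡))
                      (proj₁ (extremal-≥ x 7 7≤w)) (proj₂ (extremal-≥ x 7 7≤w))) ]′ (ℕ.<-≤-connex h 4)
      where
      open Extremal x
      7≤w = extremal-prime-w≥7 x p-prime q-prime n≢6601

open import Defs

theorem4p8 : (∀ (n : ℕ) (k : K₃N n) →
    fromℕ (K₃N.B k)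
    < √ 2 * root 4 of n over 1
    - (√ 3 - fromℚ ½) * root 8 of n over 4
    + (fromℕ 39 + √ 3) / 24)
    ×
    (∀ (n : ℕ) (c : C₃N n) → n ≢ 6601 →
    fromℕ (C₃N.B c)
    < √ 2 * root 4 of n over 1
    - (√ 7 - fromℚ ½) * root 8 of n over 4
    + (fromℕ 175 - fromℕ 3 * √ 7) / 56)
theorem4p8 = K₃N-bound , C₃N-bound
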